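{- Let $\mathcal{C}$ be an $[n,k,d]_{q^m/q}$ code. If $\mathcal{C}$ is rank-nondegenerate, then $n\le km$ and, as $q\to+\infty$, $$\mathbb{E}^{\mathrm{rk}}[q^{n-\mathcal{C}^*}]\sim\begin{cases}1 & \text{if } n\le m-1,\\ q^{n-m} & \text{if } m+1\le n\le km,\\ 2 & \text{if } n=m.\end{cases}$$ If in addition $\mathcal{C}$ is rank-2-nondegenerate, then $n\le mk/2$, and for $k\ge3$ and $q\to+\infty$ we have $$\mathrm{Var}^{\mathrm{rk}}[q^{n-\mathcal{C}^*}]\sim\begin{cases}q^{ -m+n+1} & \text{if } k\le n\le m-2 \text{ or } m+2\le n\le mk/2,\\ 1 & \text{if } n=m-1,\\ q & \text{if } n=m,\\ q^2 & \text{if } n=m+1.\end{cases}$$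
   Context: Let $q$ be a prime power and $n,m,k$ positive integers. For $v\in\mathbb{F}_{q^m}^n$ and an ordered basis $\Gamma=(\gamma_1,\dots,\gamma_m)$ of $\mathbb{F}_{q^m}$ over $\mathbb{F}_q$, let $\Gamma(v)\in\mathbb{F}_q^{n\times m}$ be the matrix with $v_i=\sum_{j}\Gamma(v)_{ij}\gamma_j$. The rank support $\sigma^{\mathrm{rk}}(v)\subseteq\mathbb{F}_q^n$ is the column space of $\Gamma(v)$ (independent of $\Gamma$), and $\mathrm{rk}(v)=\dim_{\mathbb{F}_q}\sigma^{\mathrm{rk}}(v)$. An $[n,k,d]_{q^m/q}$ code is a $k$-dimensional $\mathbb{F}_{q^m}$-subspace $\mathcal{C}\subseteq\mathbb{F}_{q^m}^n$ whose minimum rank distance, i.e. the minimum rank of its nonzero codewords, equals $d$; the zero code in $\mathbb{F}_{q^m}^n$ has minimum rank distance $n+1$ by convention. The code is rank-nondegenerate if $\sum_{v\in\mathcal{C}}\sigma^{\mathrm{rk}}(v)=\mathbb{F}_q^n$. With $\mathcal{C}^\perp=\{v\in\mathbb{F}_{q^m}^n: u v^\top=0 \ \forall u\in\mathcal{C}\}$, the code $\mathcal{C}$ is rank-2-nondegenerate if $\mathcal{C}^\perp$ has minimum rank distance at least $3$. $\mathcal{C}^*$ denotes the random variable $\mathrm{rk}(v)$, where $v$ is a uniformly random nonzero codeword of $\mathcal{C}$; $\mathbb{E}^{\mathrm{rk}}$ and $\mathrm{Var}^{\mathrm{rk}}$ denote mean and variance (of the function $q^{n-\mathrm{rk}(v)}$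 here). The asymptotic statements are for fixed $n,m,k$, with $q$ ranging over prime powers tending to infinity and $\mathcal{C}$ a code over the corresponding field with the stated properties; $g\sim h$ means that the ratio $g/h$ tends to $1$.
   Formalization: The mean case n = m is stated for k ≥ 2 (for k = 1 every nonzero codeword has rank n and the mean is exactly 1), and n ≤ mk/2 is stated for m ≥ 2 (for m = 1 the full space with n = k ≥ 2 is rank-2-nondegenerate but violates it). -}

module Defs where

open import Algebra.Bundles using (CommutativeRing)
open import Algebra.Morphism.Structures using (module RingMorphisms)
open import Algebra.Structures using (IsCommutativeRing)
import Algebra.Properties.Ring as RingProperties
open import Data.Fin using (Fin)
import Data.Fin.Properties as Fin
open import Data.Integer as ℤ using (ℤ; -[1+_]; _⊖_)
open import Data.List as List using (List; []; _∷_)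
open import Data.List.Relation.Unary.All using (All)
open import Data.Nat as ℕ using (ℕ; zero; suc; _≤_; _^_)
open import Data.Nat.Primality using (Prime)
open import Data.Nat.Properties using (m^n≢0)
open import Data.Product using (Σ; ∃; ∃₂; _×_; _,_; proj₁; proj₂)
open import Data.Rational as ℚ using (ℚ; 0ℚ; 1ℚ)
open import Data.Sum using (_⊎_)
open import Data.Vec as Vec using (Vec; []; _∷_)
import Data.Vec.Properties as Vec
open import Function using (_∘_; _⇔_; _↔_; mk⇔; id; Equivalence; Inverse)
open import Function.Properties.Inverse using (↔⇒↣)
open import Level using (0ℓ)
open import Relation.Binary using (DecidableEquality)
open import Relation.Binary.PropositionalEquality
open import Relation.Nullary using (Dec; yes; no; ¬_; ¬?; contradiction; _×-dec_)
open import Relation.Nullary.Decidable using (map′; via-injection)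
open import Relation.Unary using (Pred; Decidable)

------------------------------------------------------------------------
-- Finite fields

PrimePower : ℕ → Set
PrimePower q = ∃₂ λ p e → Prime p × 1 ≤ e × q ≡ p ^ e

record FiniteField (q : ℕ) : Set₁ where
  infixl 6 _+_
  infixl 7 _*_
  infix  8 -_
  field
    Carrier           : Set
    _+_ _*_           : Carrier → Carrier → Carrier
    -_                : Carrier → Carrier
    0# 1#             : Carrier
    isCommutativeRing : IsCommutativeRing (_≡_ {A = Carrier}) _+_ _*_ -_ 0# 1#
    0≢1               : 0# ≢ 1#
    inverse           : ∀ x → x ≢ 0# → ∃ λ y → x * y ≡ 1#
    cardinality       : Carrier ↔ Fin q

  commutativeRing : CommutativeRing 0ℓ 0ℓ
  commutativeRing = record { isCommutativeRing = isCommutativeRing }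

  open CommutativeRing commutativeRing public using (rawRing; ring)

  infix 4 _≟_
  _≟_ : DecidableEquality Carrier
  _≟_ = via-injection (↔⇒↣ cardinality) Fin._≟_

  elements : List Carrier
  elements = List.map (Inverse.from cardinality) (List.allFin q)

------------------------------------------------------------------------
-- Linear algebra in the spaces Fⁿ

module LinearAlgebra {q : ℕ} (F : FiniteField q) where
  open FiniteField F

  infixl 6 _+ᵥ_
  infixr 7 _*ᵥ_
  infix  4 _≟ᵥ_

  0ᵥ : ∀ {n} → Vec Carrier n
  0ᵥ = Vec.replicate _ 0#

  _+ᵥ_ : ∀ {n} → Vec Carrier n → Vec Carrier n → Vec Carrier n
  _+ᵥ_ = Vec.zipWith _+_

  _*ᵥ_ : ∀ {n} → Carrier → Vec Carrier n → Vec Carrier n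
  c *ᵥ v = Vec.map (c *_) v

  dot : ∀ {n} → Vec Carrier n → Vec Carrier n → Carrier
  dot u v = Vec.foldr′ _+_ 0# (Vec.zipWith _*_ u v)

  _≟ᵥ_ : ∀ {n} → DecidableEquality (Vec Carrier n)
  _≟ᵥ_ = Vec.≡-dec _≟_

  allVectors : ∀ n → List (Vec Carrier n)
  allVectors zero    = [] ∷ []
  allVectors (suc n) = List.cartesianProductWith _∷_ elements (allVectors n)

  linComb : ∀ {n d} → Vec Carrier d → Vec (Vec Carrier n) d → Vec Carrier n
  linComb cs vs = Vec.foldr′ _+ᵥ_ 0ᵥ (Vec.zipWith _*ᵥ_ cs vs)

  Span : ∀ {n d} → Vec (Vec Carrier n) d → Pred (Vec Carrier n) 0ℓ
  Span vs x = ∃ λ cs → x ≡ linComb cs vs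

  record IsSubspace {n} (V : Pred (Vec Carrier n) 0ℓ) : Set where
    field
      zero-closed  : V 0ᵥ
      +-closed     : ∀ {x y} → V x → V y → V (x +ᵥ y)
      scale-closed : ∀ c {x} → V x → V (c *ᵥ x)

  -- Elements of the sum of a family of subspaces are finite sums of
  -- elements of its members.
  SumOf : ∀ {n} {I : Set} → (I → Pred (Vec Carrier n) 0ℓ) → Pred (Vec Carrier n) 0ℓ
  SumOf V x = ∃ λ ys → All (λ y → ∃ λ i → V i y) ys × x ≡ List.foldr _+ᵥ_ 0ᵥ ys

  LinearlyIndependent : ∀ {n d} → Vec (Vec Carrier n) d → Set
  LinearlyIndependent vs = ∀ cs → linComb cs vs ≡ 0ᵥ → cs ≡ 0ᵥ

  IsBasis : ∀ {n d} → Pred (Vec Carrier n) 0ℓ → Vec (Vec Carrier n) d → Set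
  IsBasis V vs = LinearlyIndependent vs × (∀ x → V x ⇔ Span vs x)

  HasDimension : ∀ {n} → Pred (Vec Carrier n) 0ℓ → ℕ → Set
  HasDimension {n} V d = ∃ λ (vs : Vec (Vec Carrier n) d) → IsBasis V vs

  private
    open module R = CommutativeRing commutativeRing
      using (+-comm; +-assoc; +-identityˡ; +-identityʳ; -‿inverseʳ
            ; *-comm; *-assoc; *-identityˡ; distribˡ; distribʳ; zeroˡ; zeroʳ)
    open RingProperties ring using (-‿distribˡ-*)

  +ᵥ-identityˡ : ∀ {n} (x : Vec Carrier n) → 0ᵥ +ᵥ x ≡ x
  +ᵥ-identityˡ = Vec.zipWith-identityˡ +-identityˡ

  0*ᵥ : ∀ {n} (x : Vec Carrier n) → 0# *ᵥ x ≡ 0ᵥ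
  0*ᵥ []      = refl
  0*ᵥ (x ∷ v) = cong₂ _∷_ (zeroˡ x) (0*ᵥ v)

  *ᵥ0 : ∀ {n} c → c *ᵥ 0ᵥ {n} ≡ 0ᵥ
  *ᵥ0 {zero}  c = refl
  *ᵥ0 {suc n} c = cong₂ _∷_ (zeroʳ c) (*ᵥ0 c)

  *ᵥ-distribˡ : ∀ {n} c (x y : Vec Carrier n) → c *ᵥ (x +ᵥ y) ≡ c *ᵥ x +ᵥ c *ᵥ y
  *ᵥ-distribˡ c []      []      = refl
  *ᵥ-distribˡ c (x ∷ v) (y ∷ w) = cong₂ _∷_ (distribˡ c x y) (*ᵥ-distribˡ c v w)

  *ᵥ-assoc : ∀ {n} c e (x : Vec Carrier n) → (c * e) *ᵥ x ≡ c *ᵥ e *ᵥ x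
  *ᵥ-assoc c e []      = refl
  *ᵥ-assoc c e (x ∷ v) = cong₂ _∷_ (*-assoc c e x) (*ᵥ-assoc c e v)

  linComb-*ᵥ : ∀ {n d} c (cs : Vec Carrier d) (vs : Vec (Vec Carrier n) d) →
               linComb (c *ᵥ cs) vs ≡ c *ᵥ linComb cs vs
  linComb-*ᵥ c []       []       = sym (*ᵥ0 c)
  linComb-*ᵥ c (e ∷ cs) (v ∷ vs) =
    trans (cong₂ _+ᵥ_ (*ᵥ-assoc c e v) (linComb-*ᵥ c cs vs))
          (sym (*ᵥ-distribˡ c (e *ᵥ v) (linComb cs vs)))

  *ᵥ-distribʳ : ∀ {n} (x : Vec Carrier n) c e → (c + e) *ᵥ x ≡ c *ᵥ x +ᵥ e *ᵥ x
  *ᵥ-distribʳ []      c e = refl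
  *ᵥ-distribʳ (x ∷ v) c e = cong₂ _∷_ (distribʳ x c e) (*ᵥ-distribʳ v c e)

  interchange : ∀ {n} (x y z w : Vec Carrier n) →
                (x +ᵥ y) +ᵥ (z +ᵥ w) ≡ (x +ᵥ z) +ᵥ (y +ᵥ w)
  interchange x y z w = begin
    (x +ᵥ y) +ᵥ (z +ᵥ w) ≡⟨ +ᵥ-assoc x y (z +ᵥ w) ⟩
    x +ᵥ (y +ᵥ (z +ᵥ w)) ≡⟨ cong (x +ᵥ_) (+ᵥ-assoc y z w) ⟨
    x +ᵥ ((y +ᵥ z) +ᵥ w) ≡⟨ cong (λ t → x +ᵥ (t +ᵥ w)) (Vec.zipWith-comm +-comm y z) ⟩
    x +ᵥ ((z +ᵥ y) +ᵥ w) ≡⟨ cong (x +ᵥ_) (+ᵥ-assoc z y w) ⟩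
    x +ᵥ (z +ᵥ (y +ᵥ w)) ≡⟨ +ᵥ-assoc x z (y +ᵥ w) ⟨
    (x +ᵥ z) +ᵥ (y +ᵥ w) ∎
    where
      open ≡-Reasoning
      +ᵥ-assoc = Vec.zipWith-assoc +-assoc

  linComb-+ᵥ : ∀ {n d} (cs es : Vec Carrier d) (vs : Vec (Vec Carrier n) d) →
               linComb (cs +ᵥ es) vs ≡ linComb cs vs +ᵥ linComb es vs
  linComb-+ᵥ []       []       []       = sym (+ᵥ-identityˡ 0ᵥ)
  linComb-+ᵥ (c ∷ cs) (e ∷ es) (v ∷ vs) =
    trans (cong₂ _+ᵥ_ (*ᵥ-distribʳ v c e) (linComb-+ᵥ cs es vs))
          (interchange (c *ᵥ v) (e *ᵥ v) (linComb cs vs) (linComb es vs))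

  cancel : ∀ {n} c i (v w : Vec Carrier n) → c * i ≡ 1# →
           c *ᵥ v +ᵥ w ≡ 0ᵥ → v ≡ (- i) *ᵥ w
  cancel c i []      []      ci eq = refl
  cancel c i (x ∷ v) (y ∷ w) ci eq =
    cong₂ _∷_ head (cancel c i v w ci (Vec.∷-injectiveʳ eq))
    where
      open ≡-Reasoning
      icx : i * (c * x) ≡ x
      icx = trans (sym (*-assoc i c x))
              (trans (cong (_* x) (trans (*-comm i c) ci)) (*-identityˡ x))
      head : x ≡ - i * y
      head = begin
        x                             ≡⟨ +-identityʳ x ⟨
        x + 0#                        ≡⟨ cong (x +_) (-‿inverseʳ (i * y)) ⟨
        x + (i * y + - (i * y))       ≡⟨ +-assoc x (i * y) (- (i * y)) ⟨
        x + i * y + - (i * y)         ≡⟨ cong (λ t → t + i * y + - (i * y)) icx ⟨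
        i * (c * x) + i * y + - (i * y) ≡⟨ cong (_+ - (i * y)) (distribˡ i (c * x) y) ⟨
        i * (c * x + y) + - (i * y)   ≡⟨ cong (λ t → i * t + - (i * y)) (Vec.∷-injectiveˡ eq) ⟩
        i * 0# + - (i * y)            ≡⟨ cong (_+ - (i * y)) (zeroʳ i) ⟩
        0# + - (i * y)                ≡⟨ +-identityˡ _ ⟩
        - (i * y)                     ≡⟨ -‿distribˡ-* i y ⟩
        - i * y                       ∎

  anyElement? : {P : Pred Carrier 0ℓ} → Decidable P → Dec (∃ P)
  anyElement? {P} P? =
    map′ (λ (i , p) → Inverse.from cardinality i , p)
         (λ (x , p) → Inverse.to cardinality x ,
                      subst P (sym (Inverse.strictlyInverseʳ cardinality x)) p)
         (Fin.any? (P? ∘ Inverse.from cardinality))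

  anyVector? : ∀ {n} {P : Pred (Vec Carrier n) 0ℓ} → Decidable P → Dec (∃ P)
  anyVector? {zero}  P? = map′ ([] ,_) (λ { ([] , p) → p }) (P? [])
  anyVector? {suc n} P? =
    map′ (λ (x , v , p) → x ∷ v , p) (λ { (x ∷ v , p) → x , v , p })
         (anyElement? λ x → anyVector? λ v → P? (x ∷ v))

  Span? : ∀ {n d} (vs : Vec (Vec Carrier n) d) → Decidable (Span vs)
  Span? vs x = anyVector? λ cs → x ≟ᵥ linComb cs vs

  span-hasDimension : ∀ {n l} (vs : Vec (Vec Carrier n) l) → ∃ (HasDimension (Span vs))
  span-hasDimension [] = 0 , [] , (λ { [] _ → refl }) , λ x → mk⇔ id id
  span-hasDimension {n} (v ∷ vs) with span-hasDimension vs | Span? vs v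
  ... | d , bs , indep , gen | yes (es , v≡) = d , bs , indep , gen′
    where
      gen′ : ∀ x → Span (v ∷ vs) x ⇔ Span bs x
      gen′ x = mk⇔
        (λ { (c ∷ cs , eq) → Equivalence.to (gen x)
               ( c *ᵥ es +ᵥ cs
               , trans eq (sym (trans (linComb-+ᵥ (c *ᵥ es) cs vs)
                   (cong (_+ᵥ linComb cs vs)
                     (trans (linComb-*ᵥ c es vs) (cong (c *ᵥ_) (sym v≡)))))) ) })
        (λ s → let (cs , eq) = Equivalence.from (gen x) s in
               0# ∷ cs , trans eq (sym (trans (cong (_+ᵥ linComb cs vs) (0*ᵥ v))
                                              (+ᵥ-identityˡ _))))
  ... | d , bs , indep , gen | no v∉ = suc d , v ∷ bs , indep′ , gen′
    where
      indep′ : LinearlyIndependent (v ∷ bs)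
      indep′ (c ∷ cs) eq with c ≟ 0#
      ... | yes refl = cong (0# ∷_) (indep cs
              (trans (sym (+ᵥ-identityˡ _))
                     (trans (cong (_+ᵥ linComb cs bs) (sym (0*ᵥ v))) eq)))
      ... | no c≢0 = let (i , ci) = inverse c c≢0 in
              contradiction
                (Equivalence.from (gen v)
                  ( (- i) *ᵥ cs
                  , trans (cancel c i v (linComb cs bs) ci eq)
                          (sym (linComb-*ᵥ (- i) cs bs)) ))
                v∉
      gen′ : ∀ x → Span (v ∷ vs) x ⇔ Span (v ∷ bs) x
      gen′ x = mk⇔
        (λ { (c ∷ cs , eq) →
               let (es , eq′) = Equivalence.to (gen (linComb cs vs)) (cs , refl) in
               c ∷ es , trans eq (cong (c *ᵥ v +ᵥ_) eq′) })
        (λ { (c ∷ cs , eq) →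
               let (es , eq′) = Equivalence.from (gen (linComb cs bs)) (cs , refl) in
               c ∷ es , trans eq (cong (c *ᵥ v +ᵥ_) eq′) })

  dim-Span : ∀ {n l} → Vec (Vec Carrier n) l → ℕ
  dim-Span vs = proj₁ (span-hasDimension vs)

  hasDimension⇒dec : ∀ {n d} {V : Pred (Vec Carrier n) 0ℓ} → HasDimension V d → Decidable V
  hasDimension⇒dec (vs , _ , gen) x =
    map′ (Equivalence.from (gen x)) (Equivalence.to (gen x)) (Span? vs x)

------------------------------------------------------------------------
-- Field extensions and ordered bases

record FieldExtension (q m : ℕ) : Set₁ where
  field
    base : FiniteField q
    top  : FiniteField (q ^ m)

  module K = FiniteField base
  module L = FiniteField top

  field
    ι     : K.Carrier → L.Carrier
    ι-hom : RingMorphisms.IsRingHomomorphism K.rawRing L.rawRing ι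

record OrderedBasis {q m : ℕ} (E : FieldExtension q m) : Set where
  open FieldExtension E
  open LinearAlgebra base using (0ᵥ)

  field
    γ : Vec L.Carrier m

  combine : Vec K.Carrier m → L.Carrier
  combine cs = Vec.foldr′ L._+_ L.0# (Vec.zipWith (λ c g → ι c L.* g) cs γ)

  field
    independent : ∀ cs → combine cs ≡ L.0# → cs ≡ 0ᵥ
    spanning    : ∀ x → ∃ λ cs → x ≡ combine cs

  coordinates : L.Carrier → Vec K.Carrier m
  coordinates x = proj₁ (spanning x)

------------------------------------------------------------------------
-- Rank-metric codes

module RankMetric {q m : ℕ} {E : FieldExtension q m} (Γ : OrderedBasis E) where
  open FieldExtension E
  open OrderedBasis Γ
  private
    module LK = LinearAlgebra base
    module LL = LinearAlgebra top

  matrix : ∀ {n} → Vec L.Carrier n → Vec (Vec K.Carrier m) n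
  matrix v = Vec.map coordinates v

  columns : ∀ {n} → Vec L.Carrier n → Vec (Vec K.Carrier n) m
  columns v = Vec.transpose (matrix v)

  support : ∀ {n} → Vec L.Carrier n → Pred (Vec K.Carrier n) 0ℓ
  support v = LK.Span (columns v)

  rk : ∀ {n} → Vec L.Carrier n → ℕ
  rk v = LK.dim-Span (columns v)

  MinRankDistance : ∀ {n} → Pred (Vec L.Carrier n) 0ℓ → ℕ → Set
  MinRankDistance {n} C d =
      ((∀ v → C v → v ≡ LL.0ᵥ) × d ≡ suc n)
    ⊎ ((∃ λ v → C v × v ≢ LL.0ᵥ × rk v ≡ d) × (∀ v → C v → v ≢ LL.0ᵥ → d ≤ rk v))

  Dual : ∀ {n} → Pred (Vec L.Carrier n) 0ℓ → Pred (Vec L.Carrier n) 0ℓ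
  Dual C v = ∀ u → C u → LL.dot u v ≡ L.0#

record Code {q m : ℕ} {E : FieldExtension q m} (Γ : OrderedBasis E) (n k d : ℕ) : Set₁ where
  open FieldExtension E
  open RankMetric Γ
  private
    module LK = LinearAlgebra base
    module LL = LinearAlgebra top

  field
    Word            : Pred (Vec L.Carrier n) 0ℓ
    isSubspace      : LL.IsSubspace Word
    hasDimension    : LL.HasDimension Word k
    minRankDistance : MinRankDistance Word d

  RankNondegenerate : Set
  RankNondegenerate = ∀ x → LK.SumOf (λ (v : ∃ Word) → support (proj₁ v)) x

  Rank2Nondegenerate : Set
  Rank2Nondegenerate = ∃ λ d′ → MinRankDistance (Dual Word) d′ × 3 ≤ d′

  nonzeroCodewords : List (Vec L.Carrier n)
  nonzeroCodewords =
    List.filter (λ v → LL.hasDimension⇒dec hasDimension v ×-dec ¬? (v LL.≟ᵥ LL.0ᵥ))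
                (LL.allVectors n)

------------------------------------------------------------------------
-- Mean, variance and asymptotics

-- The value at [] is a junk value; the samples used below are nonempty
-- for codes of positive dimension.
average : List ℚ → ℚ
average []       = 0ℚ
average (x ∷ xs) = List.foldr ℚ._+_ 0ℚ (x ∷ xs) ℚ.* (ℤ.+ 1 ℚ./ suc (List.length xs))

-- Mean and variance of f at a uniformly random entry of a list.
mean : ∀ {A : Set} → List A → (A → ℚ) → ℚ
mean xs f = average (List.map f xs)

variance : ∀ {A : Set} → List A → (A → ℚ) → ℚ
variance xs f = mean xs λ x → (f x ℚ.- mean xs f) ℚ.* (f x ℚ.- mean xs f)

-- Integer powers; only used with a positive base.
infixr 8 _^ᶻ_
_^ᶻ_ : ℕ → ℤ → ℚ
q     ^ᶻ (ℤ.+ e)  = ℤ.+ (q ^ e) ℚ./ 1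
zero  ^ᶻ -[1+ e ] = 0ℚ
suc p ^ᶻ -[1+ e ] = (ℤ.+ 1 ℚ./ (suc p ^ suc e)) {{m^n≢0 (suc p) (suc e)}}

module _ {q m : ℕ} {E : FieldExtension q m} {Γ : OrderedBasis E} {n k d : ℕ}
         (C : Code Γ n k d) where
  open RankMetric Γ using (rk)
  open Code C

  𝔼-rk : ℚ
  𝔼-rk = mean nonzeroCodewords λ v → q ^ᶻ (n ⊖ rk v)

  Var-rk : ℚ
  Var-rk = variance nonzeroCodewords λ v → q ^ᶻ (n ⊖ rk v)

-- The ratio g / h is within ε of 1.
RatioNear1 : ℚ → ℚ → ℚ → Set
RatioNear1 ε g h = Σ (ℚ.NonZero h) λ h≢0 →
  ℚ.∣ (g ℚ.÷ h) {{h≢0}} ℚ.- 1ℚ ∣ ℚ.< ε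

CodeProperty : (n m k : ℕ) → Set₁
CodeProperty n m k =
  ∀ {q} {E : FieldExtension q m} {Γ : OrderedBasis E} {d} → Code Γ n k d → Set

CodeQuantity : (n m k : ℕ) → Set₁
CodeQuantity n m k =
  ∀ {q} {E : FieldExtension q m} {Γ : OrderedBasis E} {d} → Code Γ n k d → ℚ

-- g ∼ h as the prime power q tends to infinity with n, m, k fixed, for
-- codes with property P: the tolerance is uniform over all such codes.
Asymptotic : (n m k : ℕ) → CodeProperty n m k → CodeQuantity n m k → (ℕ → ℚ) → Set₁
Asymptotic n m k P g h =
  ∀ ε → 0ℚ ℚ.< ε → ∃ λ Q → ∀ q → PrimePower q → Q ≤ q →
  ∀ (E : FieldExtension q m) (Γ : OrderedBasis E) d (C : Code Γ n k d) →
  P C → RatioNear1 ε (g C) (h q)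

RankNondegenerate : ∀ {n m k} → CodeProperty n m k
RankNondegenerate C = Code.RankNondegenerate C

RankAndRank2Nondegenerate : ∀ {n m k} → CodeProperty n m k
RankAndRank2Nondegenerate C = Code.RankNondegenerate C × Code.Rank2Nondegenerate C

{-# OPTIONS --safe #-}
module Submission where

-- Over K = F_q the number q^(n - rk v) counts the x in K^n with x v = 0.  Hence the
-- first moment counts pairs (v, x) and the second one triples (v, x, y) with
-- x v = y v = 0.  Summing over v first, each nonzero x (each independent pair x, y)
-- imposes one (two independent) linear conditions over L = F_{q^m} on the codeword:
-- this is exactly rank-nondegeneracy (rank-2-nondegeneracy), because a x + b y has
-- rank at most 2 and so lies in the dual code only if it vanishes.  With Q = q^m,
-- T = Q^(k-1), U = Q^(k-2), Z = q^n and A = Q^k - 1 this gives the exact values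
--   mean     = 1 + (Z - 1)(T - 1) / A,
--   variance = (Z - 1)(Q - 1) U ((q - 1) Q (T - 1) - (Z - q)(Q - 1)) / A²,
-- and the variance is asymptotic to q Z / Q as soon as Z ≤ T, which covers all cases.
-- The same rank argument makes (x, y) ↦ γ₁ x + γ₂ y, read as functionals on the code,
-- injective, whence 2 n ≤ m k.

open import Algebra.Bundles using (CommutativeRing; CommutativeMonoid)
open import Algebra.Morphism.Structures using (module RingMorphisms)
import Algebra.Properties.CommutativeSemigroup as CommutativeSemigroupProperties
import Algebra.Properties.Group as GroupProperties
import Algebra.Properties.Ring as RingProperties
open import Data.Fin as Fin using (Fin)
import Data.Fin.Properties as Fin
open import Data.Integer as ℤ using (_⊖_)
import Data.Integer.Properties as ℤ
open import Data.List as List using (List; []; _∷_; length)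
import Data.List.Properties as List
open import Data.List.Membership.Propositional using (_∈_)
open import Data.List.Membership.Propositional.Properties
  using (∈-map⁺; ∈-map⁻; ∈-allFin; ∈-cartesianProductWith⁺; ∈-filter⁺; ∈-filter⁻)
open import Data.List.Membership.Propositional.Properties.WithK using (unique∧set⇒bag)
open import Data.List.Relation.Binary.BagAndSetEquality using (∼bag⇒↭)
open import Data.List.Relation.Binary.Permutation.Propositional using (_↭_)
import Data.List.Relation.Binary.Permutation.Propositional.Properties as ↭
open import Data.List.Relation.Unary.All as All using (All; []; _∷_)
open import Data.List.Relation.Unary.AllPairs using ([]; _∷_)
open import Data.List.Relation.Unary.Any using (here; there)
open import Data.List.Relation.Unary.Unique.Propositional using (Unique)
import Data.List.Relation.Unary.Unique.Propositional.Properties as Unique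
open import Data.Nat
  using (ℕ; zero; suc; pred; _+_; _*_; _∸_; _^_; _≤_; _<_; z≤n; s≤s; s≤s⁻¹;
         NonZero; >-nonZero; ≢-nonZero⁻¹; >-nonZero⁻¹)
open import Data.Nat.Divisibility using (∣⇒≤; divides)
open import Data.Nat.ListAction using (sum)
open import Data.Nat.ListAction.Properties using (sum-++; sum-↭)
open import Data.Nat.Properties as ℕ using (module ≤-Reasoning)
open import Data.Nat.Solver using (module +-*-Solver)
open import Data.Product using (∃; ∃₂; _×_; _,_; proj₁; proj₂)
open import Data.Product.Function.NonDependent.Propositional using (_×-↔_)
open import Data.Rational as ℚ using (ℚ; 0ℚ; 1ℚ)
import Data.Rational.Properties as ℚ
import Data.Rational.Solver as ℚ
open import Data.Rational.Unnormalised as ℚᵘ using (mkℚᵘ; *≡*; *≤*; *<*)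
import Data.Rational.Unnormalised.Properties as ℚᵘ
open import Data.Sum using (inj₁; inj₂)
open import Data.Vec as Vec using (Vec; []; _∷_)
import Data.Vec.Properties as Vec
open import Defs
open import Function
  using (_∘_; _⇔_; _↔_; mk⇔; mk↔ₛ′; id; Equivalence; Inverse; Injection; Injective)
open import Function.Properties.Inverse using (↔⇒↣; ↔-sym; ↔-trans)
open import Level using (0ℓ)
open import Relation.Binary.PropositionalEquality
open import Relation.Nullary using (Dec; yes; no; ¬_; contradiction; _×-dec_)
open import Relation.Unary using (Pred; Decidable)

-- Counting

-- Why the variance has this size: q^(n - rk v) - 1 is the sum, over nonzero x, of the indicators of
-- x v = 0. Each indicator has probability about 1/Q and is shared by the q - 1 nonzero multiples of
-- x, which gives the main term (Z - 1)(q - 1)/Q. If v = 0 were allowed, the indicators of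
-- independent x, y would be uncorrelated; without it their covariance is -U (Q - 1)²/A², the source
-- of the subtracted (Z - q)(Q - 1). For Z ≤ T this is smaller than the main term by a factor of
-- order at least q. The formal obstacle is subtraction and division. Counts are identities in ℕ
-- with the negative terms moved across; T and U are specified by T Q = Q^k and U Q² = Q^k; and
-- fractions are compared by cross-multiplication. Relative errors have the form c/q with absolute
-- constants (c = 2 for the mean, c = 5 for the variance), so the threshold for q depends on ε alone
-- and the limit is uniform over all codes.

module _ {A : Set} where

  ∑ : List A → (A → ℕ) → ℕ
  ∑ xs f = sum (List.map f xs)

  ∑-cong : ∀ {f g} (xs : List A) → (∀ x → f x ≡ g x) → ∑ xs f ≡ ∑ xs g
  ∑-cong xs f≡g = cong sum (List.map-cong f≡g xs)

  ∑-+ : ∀ (xs : List A) f g → ∑ xs (λ x → f x + g x) ≡ ∑ xs f + ∑ xs g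
  ∑-+ []       f g = refl
  ∑-+ (x ∷ xs) f g rewrite ∑-+ xs f g =
    CommutativeSemigroupProperties.interchange ℕ.+-commutativeSemigroup (f x) (g x) _ _

  ∑-*ˡ : ∀ (xs : List A) c f → ∑ xs (λ x → c * f x) ≡ c * ∑ xs f
  ∑-*ˡ []       c f = sym (ℕ.*-zeroʳ c)
  ∑-*ˡ (x ∷ xs) c f rewrite ∑-*ˡ xs c f = sym (ℕ.*-distribˡ-+ c (f x) _)

  ∑-*ʳ : ∀ (xs : List A) c f → ∑ xs (λ x → f x * c) ≡ ∑ xs f * c
  ∑-*ʳ xs c f = trans (∑-cong xs λ x → ℕ.*-comm (f x) c)
                      (trans (∑-*ˡ xs c f) (ℕ.*-comm c _))

  ∑-const : ∀ (xs : List A) c → ∑ xs (λ _ → c) ≡ length xs * c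
  ∑-const []       c = refl
  ∑-const (x ∷ xs) c = cong (c +_) (∑-const xs c)

∑-swap : ∀ {A B : Set} (xs : List A) (ys : List B) (f : A → B → ℕ) →
         ∑ xs (λ x → ∑ ys (f x)) ≡ ∑ ys (λ y → ∑ xs (λ x → f x y))
∑-swap []       ys f = sym (trans (∑-const ys 0) (ℕ.*-zeroʳ (length ys)))
∑-swap (x ∷ xs) ys f = trans (cong (∑ ys (f x) +_) (∑-swap xs ys f))
                             (sym (∑-+ ys (f x) _))

∑-cartesianProductWith : ∀ {A B C : Set} (h : A → B → C) xs ys (f : C → ℕ) →
  ∑ (List.cartesianProductWith h xs ys) f ≡ ∑ xs (λ x → ∑ ys (λ y → f (h x y)))
∑-cartesianProductWith h []       ys f = refl
∑-cartesianProductWith h (x ∷ xs) ys f = begin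
  ∑ (List.map (h x) ys List.++ rest) f
    ≡⟨ cong sum (List.map-++ f (List.map (h x) ys) rest) ⟩
  sum (List.map f (List.map (h x) ys) List.++ List.map f rest)
    ≡⟨ sum-++ (List.map f (List.map (h x) ys)) _ ⟩
  ∑ (List.map (h x) ys) f + ∑ rest f
    ≡⟨ cong₂ _+_ (cong sum (sym (List.map-∘ ys))) (∑-cartesianProductWith h xs ys f) ⟩
  ∑ (x ∷ xs) (λ x → ∑ ys (λ y → f (h x y))) ∎
  where
    open ≡-Reasoning
    rest = List.cartesianProductWith h xs ys

𝟙 : ∀ {P : Set} → Dec P → ℕ
𝟙 (yes _) = 1
𝟙 (no _)  = 0

𝟙-yes : ∀ {P : Set} (P? : Dec P) → P → 𝟙 P? ≡ 1
𝟙-yes (yes _) p = refl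
𝟙-yes (no ¬p) p = contradiction p ¬p

𝟙-no : ∀ {P : Set} (P? : Dec P) → ¬ P → 𝟙 P? ≡ 0
𝟙-no (yes p) ¬p = contradiction p ¬p
𝟙-no (no _)  ¬p = refl

𝟙-cong : ∀ {P Q : Set} (P? : Dec P) (Q? : Dec Q) → P ⇔ Q → 𝟙 P? ≡ 𝟙 Q?
𝟙-cong (yes p) Q? P⇔Q = sym (𝟙-yes Q? (Equivalence.to P⇔Q p))
𝟙-cong (no ¬p) Q? P⇔Q = sym (𝟙-no Q? (¬p ∘ Equivalence.from P⇔Q))

𝟙-× : ∀ {P Q : Set} (P? : Dec P) (Q? : Dec Q) → 𝟙 P? * 𝟙 Q? ≡ 𝟙 (P? ×-dec Q?)
𝟙-× (yes _) (yes _) = refl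
𝟙-× (yes _) (no _)  = refl
𝟙-× (no _)  _       = refl

module _ {A : Set} {P : Pred A 0ℓ} (P? : Decidable P) where

  count : List A → ℕ
  count xs = ∑ xs (λ x → 𝟙 (P? x))

  count-none : ∀ xs → (∀ {x} → x ∈ xs → ¬ P x) → count xs ≡ 0
  count-none []       none = refl
  count-none (x ∷ xs) none =
    cong₂ _+_ (𝟙-no (P? x) (none (here refl))) (count-none xs (none ∘ there))

  count-unique : ∀ {xs a} → Unique xs → a ∈ xs → P a → (∀ {x} → P x → x ≡ a) →
                 count xs ≡ 1
  count-unique {x ∷ xs} (x∉xs ∷ _) (here refl) pa only =
    cong₂ _+_ (𝟙-yes (P? x) pa)
      (count-none xs λ y∈ py → All.lookup x∉xs y∈ (sym (only py)))
  count-unique {x ∷ xs} (x∉xs ∷ u) (there a∈) pa only =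
    cong₂ _+_ (𝟙-no (P? x) λ px → All.lookup x∉xs a∈ (only px))
      (count-unique u a∈ pa only)

  -- Both sides are moved so that the complement of P need not be counted.
  ∑-two-valued : ∀ {f} α β xs → (∀ x → P x → f x ≡ α) → (∀ x → ¬ P x → f x ≡ β) →
                 ∑ xs f + count xs * β ≡ length xs * β + count xs * α
  ∑-two-valued         α β []       f≡α f≡β = refl
  ∑-two-valued {f = f} α β (x ∷ xs) f≡α f≡β with P? x | ∑-two-valued α β xs f≡α f≡β
  ... | yes p | ih rewrite f≡α x p = begin
        (α + s) + (β + c * β)       ≡⟨ solve 4 (λ a s b t → (a :+ s) :+ (b :+ t) := (a :+ b) :+ (s :+ t)) refl α s β (c * β) ⟩
        (α + β) + (s + c * β)       ≡⟨ cong (α + β +_) ih ⟩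
        (α + β) + (l * β + c * α)   ≡⟨ solve 4 (λ a b t u → (a :+ b) :+ (t :+ u) := (b :+ t) :+ (a :+ u)) refl α β (l * β) (c * α) ⟩
        (β + l * β) + (α + c * α)   ∎
    where
      open ≡-Reasoning
      open +-*-Solver using (solve; con; _:+_; _:*_; _:=_)
      s = ∑ xs f
      c = count xs
      l = length xs
  ... | no ¬p | ih rewrite f≡β x ¬p =
        trans (ℕ.+-assoc β (∑ xs f) (count xs * β)) (trans (cong (β +_) ih) (sym (ℕ.+-assoc β (length xs * β) (count xs * α))))

injection-≤ : ∀ {A B : Set} {a b} → A ↔ Fin a → B ↔ Fin b →
              (f : A → B) → Injective _≡_ _≡_ f → a ≤ b
injection-≤ A↔ B↔ f inj = Fin.injective⇒≤ {f = Inverse.to B↔ ∘ f ∘ Inverse.from A↔}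
  (Injection.injective (↔⇒↣ (↔-sym A↔)) ∘ inj ∘ Injection.injective (↔⇒↣ B↔))

Vec↔Fin : ∀ {A : Set} {a} → A ↔ Fin a → ∀ n → Vec A n ↔ Fin (a ^ n)
Vec↔Fin A↔ zero    = mk↔ₛ′ (λ _ → Fin.zero) (λ _ → []) (λ { Fin.zero → refl ; (Fin.suc ()) }) (λ { [] → refl })
Vec↔Fin A↔ (suc n) =
  ↔-trans (mk↔ₛ′ (λ { (x ∷ v) → x , v }) (λ { (x , v) → x ∷ v }) (λ { (x , v) → refl }) (λ { (x ∷ v) → refl }))
          (↔-trans (A↔ ×-↔ Vec↔Fin A↔ n) (↔-sym Fin.*↔×))

-- Turns comparisons of cardinalities into comparisons of dimensions; the bounds on ranks and on `n`
-- below are obtained in this way.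
^-cancelʳ-≤ : ∀ {m i j} → 2 ≤ m → m ^ i ≤ m ^ j → i ≤ j
^-cancelʳ-≤ {m} 2≤m mⁱ≤mʲ = ℕ.≮⇒≥ λ j<i → ℕ.<⇒≱ (ℕ.^-monoʳ-< m 2≤m j<i) mⁱ≤mʲ

-- Linear algebra over a finite field

module VectorSpace {q : ℕ} (F : FiniteField q) where
  open FiniteField F public
    renaming (_+_ to infixl 6 _⊕_; _*_ to infixl 7 _⊙_; -_ to infix 8 ⊝_)
  open LinearAlgebra F public
  private
    module R = CommutativeRing commutativeRing
  open RingProperties ring using (-1*x≈-x)

  2≤q : 2 ≤ q
  2≤q = Fin≢⇒2≤ (λ eq → 0≢1 (Injection.injective (↔⇒↣ cardinality) eq))
    where
      Fin≢⇒2≤ : ∀ {n} {i j : Fin n} → i ≢ j → 2 ≤ n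
      Fin≢⇒2≤ {1} {Fin.zero} {Fin.zero} i≢j = contradiction refl i≢j
      Fin≢⇒2≤ {suc (suc n)} _ = s≤s (s≤s z≤n)

  elements-unique : Unique elements
  elements-unique = Unique.map⁺ (Injection.injective (↔⇒↣ (↔-sym cardinality)))
                                (Unique.allFin⁺ q)

  ∈-elements : ∀ x → x ∈ elements
  ∈-elements x = subst (_∈ elements) (Inverse.strictlyInverseʳ cardinality x)
                       (∈-map⁺ _ (∈-allFin _))

  length-elements : length elements ≡ q
  length-elements = trans (List.length-map _ (List.allFin q)) (List.length-tabulate id)

  allVectors-unique : ∀ n → Unique (allVectors n)
  allVectors-unique zero    = [] ∷ []
  allVectors-unique (suc n) =
    Unique.cartesianProductWith⁺ _∷_ Vec.∷-injective elements-unique (allVectors-unique n)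

  ∈-allVectors : ∀ {n} (v : Vec Carrier n) → v ∈ allVectors n
  ∈-allVectors []      = here refl
  ∈-allVectors (x ∷ v) = ∈-cartesianProductWith⁺ _∷_ (∈-elements x) (∈-allVectors v)

  length-allVectors : ∀ n → length (allVectors n) ≡ q ^ n
  length-allVectors zero    = refl
  length-allVectors (suc n) = begin
    length (allVectors (suc n))                      ≡⟨ ∑-1 (allVectors (suc n)) ⟨
    ∑ (allVectors (suc n)) (λ _ → 1)                 ≡⟨ ∑-cartesianProductWith _∷_ elements (allVectors n) _ ⟩
    ∑ elements (λ _ → ∑ (allVectors n) (λ _ → 1))    ≡⟨ ∑-cong elements (λ _ → ∑-1 (allVectors n)) ⟩
    ∑ elements (λ _ → length (allVectors n))         ≡⟨ ∑-const elements _ ⟩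
    length elements * length (allVectors n)          ≡⟨ cong₂ _*_ length-elements (length-allVectors n) ⟩
    q * q ^ n                                        ∎
    where
      open ≡-Reasoning
      ∑-1 : ∀ {A : Set} (xs : List A) → ∑ xs (λ _ → 1) ≡ length xs
      ∑-1 xs = trans (∑-const xs 1) (ℕ.*-identityʳ (length xs))

  ∑-const-allVectors : ∀ n c → ∑ (allVectors n) (λ _ → c) ≡ q ^ n * c
  ∑-const-allVectors n c = trans (∑-const (allVectors n) c) (cong (_* c) (length-allVectors n))

  count-unique-vector : ∀ {n} {P : Pred (Vec Carrier n) 0ℓ} (P? : Decidable P) {a} →
                        P a → (∀ {x} → P x → x ≡ a) → count P? (allVectors n) ≡ 1
  count-unique-vector P? {a} = count-unique P? (allVectors-unique _) (∈-allVectors a)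

  +ᵥ-identityʳ : ∀ {n} (x : Vec Carrier n) → x +ᵥ 0ᵥ ≡ x
  +ᵥ-identityʳ = Vec.zipWith-identityʳ R.+-identityʳ

  vector-difference : ∀ {n} (u v : Vec Carrier n) → u +ᵥ (⊝ 1#) *ᵥ v ≡ 0ᵥ → u ≡ v
  vector-difference []      []      eq = refl
  vector-difference (x ∷ u) (y ∷ v) eq =
    cong₂ _∷_ (begin
      x                       ≡⟨ R.+-identityʳ x ⟨
      x ⊕ 0#                  ≡⟨ cong (x ⊕_) (R.-‿inverseˡ y) ⟨
      x ⊕ (⊝ y ⊕ y)           ≡⟨ R.+-assoc x (⊝ y) y ⟨
      x ⊕ ⊝ y ⊕ y             ≡⟨ cong (λ t → x ⊕ t ⊕ y) (-1*x≈-x y) ⟨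
      x ⊕ (⊝ 1#) ⊙ y ⊕ y      ≡⟨ cong (_⊕ y) (Vec.∷-injectiveˡ eq) ⟩
      0# ⊕ y                  ≡⟨ R.+-identityˡ y ⟩
      y                       ∎)
      (vector-difference u v (Vec.∷-injectiveʳ eq))
    where open ≡-Reasoning

  difference-self : ∀ {n} (v : Vec Carrier n) → v +ᵥ (⊝ 1#) *ᵥ v ≡ 0ᵥ
  difference-self []      = refl
  difference-self (x ∷ v) =
    cong₂ _∷_ (trans (cong (x ⊕_) (-1*x≈-x x)) (R.-‿inverseʳ x)) (difference-self v)

  linComb-injective : ∀ {n d} (vs : Vec (Vec Carrier n) d) → LinearlyIndependent vs →
                      ∀ {cs es} → linComb cs vs ≡ linComb es vs → cs ≡ es
  linComb-injective vs indep {cs} {es} eq = vector-difference cs es (indep _ (begin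
    linComb (cs +ᵥ (⊝ 1#) *ᵥ es) vs               ≡⟨ linComb-+ᵥ cs ((⊝ 1#) *ᵥ es) vs ⟩
    linComb cs vs +ᵥ linComb ((⊝ 1#) *ᵥ es) vs    ≡⟨ cong₂ _+ᵥ_ eq (linComb-*ᵥ (⊝ 1#) es vs) ⟩
    linComb es vs +ᵥ (⊝ 1#) *ᵥ linComb es vs      ≡⟨ difference-self _ ⟩
    0ᵥ                                            ∎))
    where open ≡-Reasoning

  linComb-0ᵥ : ∀ {n d} (vs : Vec (Vec Carrier n) d) → linComb 0ᵥ vs ≡ 0ᵥ
  linComb-0ᵥ []       = refl
  linComb-0ᵥ (v ∷ vs) = trans (cong₂ _+ᵥ_ (0*ᵥ v) (linComb-0ᵥ vs)) (+ᵥ-identityˡ 0ᵥ)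

  independent-∷ : ∀ {n d v} {vs : Vec (Vec Carrier n) d} →
                  LinearlyIndependent vs → ¬ Span vs v → LinearlyIndependent (v ∷ vs)
  independent-∷ {v = v} {vs} indep v∉ (c ∷ cs) eq with c ≟ 0#
  ... | yes refl = cong (0# ∷_) (indep cs
          (trans (sym (+ᵥ-identityˡ _)) (trans (cong (_+ᵥ linComb cs vs) (sym (0*ᵥ v))) eq)))
  ... | no c≢0 = let (i , ci) = inverse c c≢0 in contradiction
          ((⊝ i) *ᵥ cs , trans (cancel c i v (linComb cs vs) ci eq) (sym (linComb-*ᵥ (⊝ i) cs vs))) v∉

  independent-singleton : ∀ {n} {v : Vec Carrier n} → v ≢ 0ᵥ → LinearlyIndependent (v ∷ [])
  independent-singleton v≢0 = independent-∷ (λ { [] _ → refl }) λ { ([] , v≡0) → v≢0 v≡0 }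

  -- The kernel criterion for injectivity, for an arbitrary operation `∙` on the source, so that it
  -- applies both to vectors over K and to pairs of them without building a group on the pairs. The
  -- term `x ∙ inv y` stands for the difference.
  additive-injective : ∀ {A : Set} {n} (_∙_ : A → A → A) (inv : A → A) (f : A → Vec Carrier n) →
                       (∀ x y → f (x ∙ y) ≡ f x +ᵥ f y) → (∀ x → f (x ∙ inv x) ≡ 0ᵥ) →
                       (∀ x y → f (x ∙ inv y) ≡ 0ᵥ → x ≡ y) → Injective _≡_ _≡_ f
  additive-injective _∙_ inv f additive cancels kernel {x} {y} fx≡fy = kernel x y (begin
    f (x ∙ inv y)       ≡⟨ additive x (inv y) ⟩
    f x +ᵥ f (inv y)    ≡⟨ cong (_+ᵥ f (inv y)) fx≡fy ⟩
    f y +ᵥ f (inv y)    ≡⟨ additive y (inv y) ⟨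
    f (y ∙ inv y)       ≡⟨ cancels y ⟩
    0ᵥ                  ∎)
    where open ≡-Reasoning

  dot-comm : ∀ {n} (u v : Vec Carrier n) → dot u v ≡ dot v u
  dot-comm []      []      = refl
  dot-comm (x ∷ u) (y ∷ v) = cong₂ _⊕_ (R.*-comm x y) (dot-comm u v)

  dot-+ᵥ : ∀ {n} (u v w : Vec Carrier n) → dot (u +ᵥ v) w ≡ dot u w ⊕ dot v w
  dot-+ᵥ []      []      []      = sym (R.+-identityˡ 0#)
  dot-+ᵥ (x ∷ u) (y ∷ v) (z ∷ w) =
    trans (cong₂ _⊕_ (R.distribʳ z x y) (dot-+ᵥ u v w))
          (CommutativeSemigroupProperties.interchange
             (CommutativeMonoid.commutativeSemigroup R.+-commutativeMonoid) _ _ _ _)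

  dot-*ᵥ : ∀ {n} c (u w : Vec Carrier n) → dot (c *ᵥ u) w ≡ c ⊙ dot u w
  dot-*ᵥ c []      []      = sym (R.zeroʳ c)
  dot-*ᵥ c (x ∷ u) (z ∷ w) =
    trans (cong₂ _⊕_ (R.*-assoc c x z) (dot-*ᵥ c u w)) (sym (R.distribˡ c _ _))

  dot-0ᵥ : ∀ {n} (w : Vec Carrier n) → dot 0ᵥ w ≡ 0#
  dot-0ᵥ []      = refl
  dot-0ᵥ (x ∷ w) = trans (cong₂ _⊕_ (R.zeroˡ x) (dot-0ᵥ w)) (R.+-identityˡ 0#)

  dot-nondegenerate : ∀ {n} (w : Vec Carrier n) → (∀ c → dot w c ≡ 0#) → w ≡ 0ᵥ
  dot-nondegenerate []      _   = refl
  dot-nondegenerate (x ∷ w) w⊥ =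
    cong₂ _∷_
      (begin
        x                     ≡⟨ R.*-identityʳ x ⟨
        x ⊙ 1#                ≡⟨ R.+-identityʳ (x ⊙ 1#) ⟨
        x ⊙ 1# ⊕ 0#           ≡⟨ cong (x ⊙ 1# ⊕_) (trans (dot-comm w 0ᵥ) (dot-0ᵥ w)) ⟨
        x ⊙ 1# ⊕ dot w 0ᵥ     ≡⟨ w⊥ (1# ∷ 0ᵥ) ⟩
        0#                    ∎)
      (dot-nondegenerate w λ c → begin
        dot w c               ≡⟨ R.+-identityˡ _ ⟨
        0# ⊕ dot w c          ≡⟨ cong (_⊕ dot w c) (R.zeroʳ x) ⟨
        x ⊙ 0# ⊕ dot w c      ≡⟨ w⊥ (0# ∷ c) ⟩
        0#                    ∎)
    where open ≡-Reasoning

  -- The product of the row `x` with the matrix whose columns are `vs`; its kernel is the orthogonal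
  -- complement of their span.
  dots : ∀ {n d} → Vec (Vec Carrier n) d → Vec Carrier n → Vec Carrier d
  dots vs x = Vec.map (dot x) vs

  dots-+ᵥ : ∀ {n d} (vs : Vec (Vec Carrier n) d) x y → dots vs (x +ᵥ y) ≡ dots vs x +ᵥ dots vs y
  dots-+ᵥ []       x y = refl
  dots-+ᵥ (v ∷ vs) x y = cong₂ _∷_ (dot-+ᵥ x y v) (dots-+ᵥ vs x y)

  dots-*ᵥ : ∀ {n d} (vs : Vec (Vec Carrier n) d) c x → dots vs (c *ᵥ x) ≡ c *ᵥ dots vs x
  dots-*ᵥ []       c x = refl
  dots-*ᵥ (v ∷ vs) c x = cong₂ _∷_ (dot-*ᵥ c x v) (dots-*ᵥ vs c x)

  dots-0ᵥ : ∀ {n d} (vs : Vec (Vec Carrier n) d) → dots vs 0ᵥ ≡ 0ᵥ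
  dots-0ᵥ []       = refl
  dots-0ᵥ (v ∷ vs) = cong₂ _∷_ (dot-0ᵥ v) (dots-0ᵥ vs)

  -- `dots vs` is the adjoint of `c ↦ linComb c vs`. This lets the same incidences be counted by `x`
  -- or by `c` in `count-orthogonal`.
  dot-linComb : ∀ {n d} (x : Vec Carrier n) cs (vs : Vec (Vec Carrier n) d) →
                dot x (linComb cs vs) ≡ dot (dots vs x) cs
  dot-linComb x []       []       = trans (dot-comm x 0ᵥ) (dot-0ᵥ x)
  dot-linComb x (c ∷ cs) (v ∷ vs) = begin
    dot x (c *ᵥ v +ᵥ linComb cs vs)           ≡⟨ dot-comm x _ ⟩
    dot (c *ᵥ v +ᵥ linComb cs vs) x           ≡⟨ dot-+ᵥ (c *ᵥ v) (linComb cs vs) x ⟩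
    dot (c *ᵥ v) x ⊕ dot (linComb cs vs) x    ≡⟨ cong₂ _⊕_ (dot-*ᵥ c v x) (dot-comm (linComb cs vs) x) ⟩
    c ⊙ dot v x ⊕ dot x (linComb cs vs)       ≡⟨ cong₂ _⊕_ (trans (R.*-comm c _) (cong (_⊙ c) (dot-comm v x)))
                                                           (dot-linComb x cs vs) ⟩
    dot x v ⊙ c ⊕ dot (dots vs x) cs          ∎
    where open ≡-Reasoning

  dots⊥⇔Span⊥ : ∀ {n d} (vs : Vec (Vec Carrier n) d) x →
                dots vs x ≡ 0ᵥ ⇔ (∀ {y} → Span vs y → dot x y ≡ 0#)
  dots⊥⇔Span⊥ vs x = mk⇔
    (λ { eq (cs , refl) → trans (dot-linComb x cs vs) (trans (cong (λ t → dot t cs) eq) (dot-0ᵥ cs)) })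
    (λ ⊥ → dot-nondegenerate _ λ cs → trans (sym (dot-linComb x cs vs)) (⊥ (cs , refl)))

  linComb-transpose : ∀ {n d} (cs : Vec Carrier d) (M : Vec (Vec Carrier d) n) →
                      linComb cs (Vec.transpose M) ≡ dots M cs
  linComb-transpose cs []      = linComb-replicate cs
    where
      linComb-replicate : ∀ {d} (cs : Vec Carrier d) → linComb cs (Vec.replicate d []) ≡ []
      linComb-replicate []       = refl
      linComb-replicate (c ∷ cs) = cong (Vec.zipWith _⊕_ []) (linComb-replicate cs)
  linComb-transpose cs (r ∷ M) = trans (linComb-∷ cs r (Vec.transpose M))
                                       (cong (dot cs r ∷_) (linComb-transpose cs M))
    where
      linComb-∷ : ∀ {n d} (cs : Vec Carrier d) r (N : Vec (Vec Carrier n) d) →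
                  linComb cs (Vec.replicate _ Vec._∷_ Vec.⊛ r Vec.⊛ N) ≡ dot cs r ∷ linComb cs N
      linComb-∷ []       []      []      = refl
      linComb-∷ (c ∷ cs) (x ∷ r) (v ∷ N) = cong (Vec.zipWith _⊕_ _) (linComb-∷ cs r N)

  -- One equation for both kinds of linear form: with indicator 0 it says that q^(n-1) vectors are
  -- zeros, with indicator 1 that all q^n are. In this uniform shape it can be summed over all forms
  -- at once.
  count-zeros : ∀ {n} (w : Vec Carrier n) →
    q * count (λ x → dot x w ≟ 0#) (allVectors n) + 𝟙 (w ≟ᵥ 0ᵥ) * q ^ n
      ≡ q ^ n + 𝟙 (w ≟ᵥ 0ᵥ) * (q * q ^ n)
  count-zeros {zero} [] with 0# ≟ 0#
  ... | yes _ = trans (ℕ.+-comm (q * 1) 1) (cong suc (sym (ℕ.+-identityʳ (q * 1))))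
  ... | no ≢ = contradiction refl ≢
  count-zeros {suc n} (w₀ ∷ w) = begin
    q * count (λ x → dot x (w₀ ∷ w) ≟ 0#) (allVectors (suc n)) + δ * q ^ suc n
      ≡⟨ cong (λ t → q * t + δ * q ^ suc n) (∑-cartesianProductWith _∷_ elements (allVectors n) _) ⟩
    q * ∑ elements (λ x → ∑ (allVectors n) (λ v → 𝟙 (x ⊙ w₀ ⊕ dot v w ≟ 0#))) + δ * q ^ suc n
      ≡⟨ by-head (w₀ ≟ 0#) ⟩
    q ^ suc n + δ * (q * q ^ suc n) ∎
    where
      open ≡-Reasoning
      δ = 𝟙 ((w₀ ∷ w) ≟ᵥ 0ᵥ)

      by-head : Dec (w₀ ≡ 0#) →
        q * ∑ elements (λ x → ∑ (allVectors n) (λ v → 𝟙 (x ⊙ w₀ ⊕ dot v w ≟ 0#))) + δ * q ^ suc n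
          ≡ q ^ suc n + δ * (q * q ^ suc n)
      by-head (yes refl) = begin
        q * ∑ elements (λ x → ∑ (allVectors n) (λ v → 𝟙 (x ⊙ 0# ⊕ dot v w ≟ 0#))) + δ * (q * q ^ n)
          ≡⟨ cong₂ (λ s t → q * s + t * (q * q ^ n)) sum≡ δ≡ ⟩
        q * (q * z) + δ′ * (q * q ^ n)
          ≡⟨ solve 4 (λ q z d m → q :* (q :* z) :+ d :* (q :* m) := q :* (q :* z :+ d :* m)) refl q z δ′ (q ^ n) ⟩
        q * (q * z + δ′ * q ^ n)
          ≡⟨ cong (q *_) (count-zeros w) ⟩
        q * (q ^ n + δ′ * (q * q ^ n))
          ≡⟨ solve 3 (λ q d m → q :* (m :+ d :* (q :* m)) := q :* m :+ d :* (q :* (q :* m))) refl q δ′ (q ^ n) ⟩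
        q * q ^ n + δ′ * (q * (q * q ^ n))
          ≡⟨ cong (λ t → q * q ^ n + t * (q * (q * q ^ n))) δ≡ ⟨
        q * q ^ n + δ * (q * (q * q ^ n)) ∎
        where
          open +-*-Solver using (solve; con; _:+_; _:*_; _:=_)
          z = count (λ x → dot x w ≟ 0#) (allVectors n)
          δ′ = 𝟙 (w ≟ᵥ 0ᵥ)
          δ≡ : δ ≡ δ′
          δ≡ = 𝟙-cong ((0# ∷ w) ≟ᵥ 0ᵥ) (w ≟ᵥ 0ᵥ) (mk⇔ Vec.∷-injectiveʳ (cong (0# ∷_)))
          drop : ∀ x t → x ⊙ 0# ⊕ t ≡ t
          drop x t = trans (cong (_⊕ t) (R.zeroʳ x)) (R.+-identityˡ t)
          sum≡ : ∑ elements (λ x → ∑ (allVectors n) (λ v → 𝟙 (x ⊙ 0# ⊕ dot v w ≟ 0#))) ≡ q * z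
          sum≡ = trans
            (∑-cong elements λ x → ∑-cong (allVectors n) λ v → cong (λ t → 𝟙 (t ≟ 0#)) (drop x (dot v w)))
            (trans (∑-const elements z) (cong (_* z) length-elements))
      -- With `w₀` invertible, each tail `v` extends to a zero by exactly one head, hence q^n zeros
      -- in all.
      by-head (no w₀≢0) = begin
        q * ∑ elements (λ x → ∑ (allVectors n) (λ v → 𝟙 (x ⊙ w₀ ⊕ dot v w ≟ 0#))) + δ * q ^ suc n
          ≡⟨ cong₂ (λ s t → q * s + t * q ^ suc n) sum≡ δ≡0 ⟩
        q ^ suc n + 0
          ≡⟨ cong (λ t → q ^ suc n + t * (q * q ^ suc n)) δ≡0 ⟨
        q ^ suc n + δ * (q * q ^ suc n) ∎
        where
          δ≡0 : δ ≡ 0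
          δ≡0 = 𝟙-no ((w₀ ∷ w) ≟ᵥ 0ᵥ) (w₀≢0 ∘ Vec.∷-injectiveˡ)
          i = proj₁ (inverse w₀ w₀≢0)
          w₀i≡1 : w₀ ⊙ i ≡ 1#
          w₀i≡1 = proj₂ (inverse w₀ w₀≢0)
          iw₀≡1 : i ⊙ w₀ ≡ 1#
          iw₀≡1 = trans (R.*-comm i w₀) w₀i≡1
          solution : ∀ t → ((⊝ t) ⊙ i) ⊙ w₀ ⊕ t ≡ 0#
          solution t = begin
            ((⊝ t) ⊙ i) ⊙ w₀ ⊕ t   ≡⟨ cong (_⊕ t) (R.*-assoc (⊝ t) i w₀) ⟩
            (⊝ t) ⊙ (i ⊙ w₀) ⊕ t   ≡⟨ cong (λ e → (⊝ t) ⊙ e ⊕ t) iw₀≡1 ⟩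
            (⊝ t) ⊙ 1# ⊕ t         ≡⟨ cong (_⊕ t) (R.*-identityʳ (⊝ t)) ⟩
            ⊝ t ⊕ t                ≡⟨ R.-‿inverseˡ t ⟩
            0#                     ∎
          only : ∀ t {x} → x ⊙ w₀ ⊕ t ≡ 0# → x ≡ (⊝ t) ⊙ i
          only t {x} eq = begin
            x                        ≡⟨ R.*-identityʳ x ⟨
            x ⊙ 1#                   ≡⟨ cong (x ⊙_) w₀i≡1 ⟨
            x ⊙ (w₀ ⊙ i)             ≡⟨ R.*-assoc x w₀ i ⟨
            x ⊙ w₀ ⊙ i               ≡⟨ cong (_⊙ i) (GroupProperties.inverseˡ-unique R.+-group _ _ eq) ⟩
            (⊝ t) ⊙ i                ∎
          sum≡ : ∑ elements (λ x → ∑ (allVectors n) (λ v → 𝟙 (x ⊙ w₀ ⊕ dot v w ≟ 0#))) ≡ q ^ n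
          sum≡ = begin
            ∑ elements (λ x → ∑ (allVectors n) (λ v → 𝟙 (x ⊙ w₀ ⊕ dot v w ≟ 0#)))
              ≡⟨ ∑-swap elements (allVectors n) _ ⟩
            ∑ (allVectors n) (λ v → count (λ x → x ⊙ w₀ ⊕ dot v w ≟ 0#) elements)
              ≡⟨ ∑-cong (allVectors n) (λ v → count-unique _ elements-unique (∈-elements _)
                   (solution (dot v w)) (only (dot v w))) ⟩
            ∑ (allVectors n) (λ _ → 1)
              ≡⟨ ∑-const-allVectors n 1 ⟩
            q ^ n * 1
              ≡⟨ ℕ.*-identityʳ (q ^ n) ⟩
            q ^ n ∎

  -- Double counting of the pairs (x , c) with dot x (linComb c vs) ≡ 0#: for
  -- fixed c the zeros form a hyperplane unless c ≡ 0ᵥ, and for fixed x unless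
  -- x is orthogonal to vs.
  count-orthogonal : ∀ {n d} (vs : Vec (Vec Carrier n) d) → LinearlyIndependent vs →
                     count (λ x → dots vs x ≟ᵥ 0ᵥ) (allVectors n) * q ^ d ≡ q ^ n
  count-orthogonal {n} {d} vs indep = cancel-q (2≤q) (begin
    qZ + q ^ n                                      ≡⟨ cong (qZ +_) (ℕ.*-identityˡ (q ^ n)) ⟨
    qZ + 1 * q ^ n                                  ≡⟨ by-c ⟩
    q ^ d * q ^ n + 1 * (q * q ^ n)                 ≡⟨ cong₂ _+_ (ℕ.*-comm (q ^ d) (q ^ n)) (ℕ.*-identityˡ _) ⟩
    q ^ n * q ^ d + q * q ^ n                       ∎)
    (trans by-x (cong (q ^ n * q ^ d +_)
      (solve 3 (λ κ q m → κ :* (q :* m) := q :* (κ :* m)) refl κ q (q ^ d))))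
    where
      open ≡-Reasoning
      open +-*-Solver using (solve; con; _:+_; _:*_; _:=_)
      κ = count (λ x → dots vs x ≟ᵥ 0ᵥ) (allVectors n)
      hit : Vec Carrier n → Vec Carrier d → ℕ
      hit x c = 𝟙 (dot x (linComb c vs) ≟ 0#)
      qZ = q * ∑ (allVectors d) (λ c → ∑ (allVectors n) (λ x → hit x c))

      collect : ∀ {A : Set} (xs : List A) (z δ : A → ℕ) m l → length xs ≡ l →
                (∀ a → q * z a + δ a * m ≡ m + δ a * (q * m)) →
                q * ∑ xs z + ∑ xs δ * m ≡ l * m + ∑ xs δ * (q * m)
      collect xs z δ m l refl each = begin
        q * ∑ xs z + ∑ xs δ * m                      ≡⟨ cong₂ _+_ (∑-*ˡ xs q z) (∑-*ʳ xs m δ) ⟨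
        ∑ xs (λ a → q * z a) + ∑ xs (λ a → δ a * m)  ≡⟨ ∑-+ xs _ _ ⟨
        ∑ xs (λ a → q * z a + δ a * m)               ≡⟨ ∑-cong xs each ⟩
        ∑ xs (λ a → m + δ a * (q * m))               ≡⟨ ∑-+ xs _ _ ⟩
        ∑ xs (λ a → m) + ∑ xs (λ a → δ a * (q * m))  ≡⟨ cong₂ _+_ (∑-const xs m) (∑-*ʳ xs (q * m) δ) ⟩
        length xs * m + ∑ xs δ * (q * m)             ∎

      by-c : qZ + 1 * q ^ n ≡ q ^ d * q ^ n + 1 * (q * q ^ n)
      by-c = subst (λ t → qZ + t * q ^ n ≡ q ^ d * q ^ n + t * (q * q ^ n))
        (count-unique-vector (λ c → linComb c vs ≟ᵥ 0ᵥ) (linComb-0ᵥ vs) (indep _))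
        (collect (allVectors d) _ _ (q ^ n) (q ^ d) (length-allVectors d)
                 (λ c → count-zeros (linComb c vs)))

      by-x : qZ + κ * q ^ d ≡ q ^ n * q ^ d + κ * (q * q ^ d)
      by-x = trans (cong (λ t → q * t + κ * q ^ d) (∑-swap (allVectors d) (allVectors n) (λ c x → hit x c)))
        (collect (allVectors n) _ _ (q ^ d) (q ^ n) (length-allVectors n) λ x →
          trans (cong (λ t → q * t + 𝟙 (dots vs x ≟ᵥ 0ᵥ) * q ^ d)
                   (∑-cong (allVectors d) λ c → cong (λ t → 𝟙 (t ≟ 0#))
                     (trans (dot-linComb x c vs) (dot-comm (dots vs x) c))))
                (count-zeros (dots vs x)))

      -- Both evaluations of the double count have the form z - x = (q - 1) a, once with a = q^n and
      -- once with a = κ q^d; since q ≥ 2, the two values of a agree.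
      cancel-q : ∀ {q z x a b} → 2 ≤ q → z + a ≡ x + q * a → z + b ≡ x + q * b → b ≡ a
      cancel-q {suc (suc s)} {z} {x} {a} {b} (s≤s (s≤s z≤n)) ea eb =
        ℕ.*-cancelˡ-≡ b a (suc s) (ℕ.+-cancelˡ-≡ (z + x + a + b) _ _ (begin
          z + x + a + b + suc s * b         ≡⟨ solve 5 (λ s z x a b → z :+ x :+ a :+ b :+ (con 1 :+ s) :* b
                                                 := (z :+ a) :+ (x :+ (con 2 :+ s) :* b)) refl s z x a b ⟩
          (z + a) + (x + suc (suc s) * b)   ≡⟨ cong₂ _+_ ea (sym eb) ⟩
          (x + suc (suc s) * a) + (z + b)   ≡⟨ solve 5 (λ s z x a b → (x :+ (con 2 :+ s) :* a) :+ (z :+ b)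
                                                 := z :+ x :+ a :+ b :+ (con 1 :+ s) :* a) refl s z x a b ⟩
          z + x + a + b + suc s * a         ∎))

  -- By independence the indicator of the span at `y` equals the number of coefficient vectors
  -- representing `y`; the double sum is then taken over the coefficients.
  count-Span : ∀ {n d} (vs : Vec (Vec Carrier n) d) → LinearlyIndependent vs →
               count (Span? vs) (allVectors n) ≡ q ^ d
  count-Span {n} {d} vs indep = begin
    count (Span? vs) (allVectors n)
      ≡⟨ ∑-cong (allVectors n) representations ⟩
    ∑ (allVectors n) (λ y → count (λ c → y ≟ᵥ linComb c vs) (allVectors d))
      ≡⟨ ∑-swap (allVectors n) (allVectors d) _ ⟩
    ∑ (allVectors d) (λ c → count (_≟ᵥ linComb c vs) (allVectors n))
      ≡⟨ ∑-cong (allVectors d) (λ c → count-unique-vector (_≟ᵥ linComb c vs) refl id) ⟩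
    ∑ (allVectors d) (λ _ → 1)
      ≡⟨ ∑-const-allVectors d 1 ⟩
    q ^ d * 1
      ≡⟨ ℕ.*-identityʳ (q ^ d) ⟩
    q ^ d ∎
    where
      open ≡-Reasoning
      representations : ∀ y → 𝟙 (Span? vs y) ≡ count (λ c → y ≟ᵥ linComb c vs) (allVectors d)
      representations y with Span? vs y
      ... | yes (c , y≡) = sym (count-unique-vector _ y≡ λ {x} y≡′ →
                             linComb-injective vs indep {x} {c} (trans (sym y≡′) y≡))
      ... | no y∉        = sym (count-none _ (allVectors d) λ {c} _ y≡ → y∉ (c , y≡))

  -- Two duplicate-free lists with the same elements are permutations of each other. The explicit
  -- `0ᵥ` restores the filtered-out zero word, so that sums over nonzero codewords become sums over
  -- all coordinate vectors.
  basis-↭ : ∀ {n d} {V : Pred (Vec Carrier n) 0ℓ} (vs : Vec (Vec Carrier n) d) → IsBasis V vs →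
            (V? : Decidable (λ v → V v × v ≢ 0ᵥ)) →
            0ᵥ ∷ List.filter V? (allVectors n) ↭ List.map (λ c → linComb c vs) (allVectors d)
  basis-↭ {n} {d} {V} vs (indep , gen) V? = ∼bag⇒↭ (unique∧set⇒bag
    (All.tabulate (λ y∈ 0≡y → proj₂ (proj₂ (∈-filter⁻ V? {xs = allVectors n} y∈)) (sym 0≡y))
      ∷ Unique.filter⁺ V? (allVectors-unique n))
    (Unique.map⁺ (linComb-injective vs indep) (allVectors-unique d))
    (mk⇔ to from))
    where
      combine = λ c → linComb c vs
      combinations = List.map combine (allVectors d)
      to : ∀ {v} → v ∈ 0ᵥ ∷ List.filter V? (allVectors n) → v ∈ combinations
      to (here refl) = subst (_∈ combinations) (linComb-0ᵥ vs) (∈-map⁺ combine (∈-allVectors 0ᵥ))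
      to (there v∈) with Equivalence.to (gen _) (proj₁ (proj₂ (∈-filter⁻ V? {xs = allVectors n} v∈)))
      ... | c , refl = ∈-map⁺ combine (∈-allVectors c)
      from : ∀ {v} → v ∈ combinations → v ∈ 0ᵥ ∷ List.filter V? (allVectors n)
      from {v} v∈ with ∈-map⁻ combine v∈ | v ≟ᵥ 0ᵥ
      ... | _           | yes refl = here refl
      ... | c , _ , v≡ | no v≢0   =
        there (∈-filter⁺ V? (∈-allVectors v) (Equivalence.from (gen v) (c , v≡) , v≢0))

  -- Counting replaces the exchange argument: sending coefficients over `vs` to coefficients over
  -- `ws` of the same vector is injective, whence q^d ≤ q^e.
  independent⇒≤ : ∀ {n d e} (vs : Vec (Vec Carrier n) d) (ws : Vec (Vec Carrier n) e) →
                  LinearlyIndependent vs → (∀ {y} → Span vs y → Span ws y) → d ≤ e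
  independent⇒≤ {n} {d} {e} vs ws indep vs⊆ws = ^-cancelʳ-≤ 2≤q
    (injection-≤ (Vec↔Fin cardinality d) (Vec↔Fin cardinality e) (λ c → proj₁ (coefficients c))
      λ {c} {c′} eq → linComb-injective vs indep {c} {c′}
        (trans (proj₂ (coefficients c)) (trans (cong (λ t → linComb t ws) eq) (sym (proj₂ (coefficients c′))))))
    where
      coefficients : ∀ c → Span ws (linComb c vs)
      coefficients c = vs⊆ws (c , refl)

-- Rank supports

module RankSupport {q m : ℕ} {E : FieldExtension q m} (Γ : OrderedBasis E) where
  open FieldExtension E using (base; top; ι; ι-hom)
  open OrderedBasis Γ
  open RankMetric Γ
  module K = VectorSpace base
  module L = VectorSpace top
  private
    module RL = CommutativeRing L.commutativeRing
  open RingMorphisms.IsRingHomomorphism ι-hom using (+-homo; *-homo; 0#-homo)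

  ιᵥ : ∀ {n} → Vec K.Carrier n → Vec L.Carrier n
  ιᵥ = Vec.map ι

  ιᵥ-+ᵥ : ∀ {n} (x y : Vec K.Carrier n) → ιᵥ (x K.+ᵥ y) ≡ ιᵥ x L.+ᵥ ιᵥ y
  ιᵥ-+ᵥ []      []      = refl
  ιᵥ-+ᵥ (a ∷ x) (b ∷ y) = cong₂ _∷_ (+-homo a b) (ιᵥ-+ᵥ x y)

  ιᵥ-*ᵥ : ∀ {n} c (x : Vec K.Carrier n) → ιᵥ (c K.*ᵥ x) ≡ ι c L.*ᵥ ιᵥ x
  ιᵥ-*ᵥ c []      = refl
  ιᵥ-*ᵥ c (a ∷ x) = cong₂ _∷_ (*-homo c a) (ιᵥ-*ᵥ c x)

  ιᵥ-0ᵥ : ∀ n → ιᵥ (K.0ᵥ {n}) ≡ L.0ᵥ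
  ιᵥ-0ᵥ n = trans (Vec.map-replicate ι K.0# n) (cong (Vec.replicate n) 0#-homo)

  combine≡dot : ∀ cs → combine cs ≡ L.dot (ιᵥ cs) γ
  combine≡dot cs = cong (Vec.foldr′ L._⊕_ L.0#) (sym (Vec.zipWith-map₁ L._⊙_ ι cs γ))

  combine-+ᵥ : ∀ cs es → combine (cs K.+ᵥ es) ≡ combine cs L.⊕ combine es
  combine-+ᵥ cs es = begin
    combine (cs K.+ᵥ es)                      ≡⟨ combine≡dot (cs K.+ᵥ es) ⟩
    L.dot (ιᵥ (cs K.+ᵥ es)) γ                 ≡⟨ cong (λ t → L.dot t γ) (ιᵥ-+ᵥ cs es) ⟩
    L.dot (ιᵥ cs L.+ᵥ ιᵥ es) γ                ≡⟨ L.dot-+ᵥ (ιᵥ cs) (ιᵥ es) γ ⟩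
    L.dot (ιᵥ cs) γ L.⊕ L.dot (ιᵥ es) γ       ≡⟨ cong₂ L._⊕_ (combine≡dot cs) (combine≡dot es) ⟨
    combine cs L.⊕ combine es                 ∎
    where open ≡-Reasoning

  combine-*ᵥ : ∀ c es → combine (c K.*ᵥ es) ≡ ι c L.⊙ combine es
  combine-*ᵥ c es = begin
    combine (c K.*ᵥ es)            ≡⟨ combine≡dot (c K.*ᵥ es) ⟩
    L.dot (ιᵥ (c K.*ᵥ es)) γ       ≡⟨ cong (λ t → L.dot t γ) (ιᵥ-*ᵥ c es) ⟩
    L.dot (ι c L.*ᵥ ιᵥ es) γ       ≡⟨ L.dot-*ᵥ (ι c) (ιᵥ es) γ ⟩
    ι c L.⊙ L.dot (ιᵥ es) γ        ≡⟨ cong (ι c L.⊙_) (combine≡dot es) ⟨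
    ι c L.⊙ combine es             ∎
    where open ≡-Reasoning

  combine-0ᵥ : combine K.0ᵥ ≡ L.0#
  combine-0ᵥ = trans (combine≡dot K.0ᵥ) (trans (cong (λ t → L.dot t γ) (ιᵥ-0ᵥ m)) (L.dot-0ᵥ γ))

  combine-injective : ∀ {cs es} → combine cs ≡ combine es → cs ≡ es
  combine-injective {cs} {es} eq = K.vector-difference cs es (independent _ (begin
    combine (cs K.+ᵥ -es)             ≡⟨ combine-+ᵥ cs -es ⟩
    combine cs L.⊕ combine -es        ≡⟨ cong (L._⊕ combine -es) eq ⟩
    combine es L.⊕ combine -es        ≡⟨ combine-+ᵥ es -es ⟨
    combine (es K.+ᵥ -es)             ≡⟨ cong combine (K.difference-self es) ⟩
    combine K.0ᵥ                      ≡⟨ combine-0ᵥ ⟩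
    L.0#                              ∎))
    where
      open ≡-Reasoning
      -es = (K.⊝ K.1#) K.*ᵥ es

  combine-coordinates : ∀ a → combine (coordinates a) ≡ a
  combine-coordinates a = sym (proj₂ (spanning a))

  coordinates-combine : ∀ cs → coordinates (combine cs) ≡ cs
  coordinates-combine cs = combine-injective (combine-coordinates (combine cs))

  coordinates-0# : coordinates L.0# ≡ K.0ᵥ
  coordinates-0# = combine-injective (trans (combine-coordinates L.0#) (sym combine-0ᵥ))

  coordinates≡0ᵥ : ∀ {a} → coordinates a ≡ K.0ᵥ → a ≡ L.0#
  coordinates≡0ᵥ {a} eq = trans (sym (combine-coordinates a)) (trans (cong combine eq) combine-0ᵥ)

  coordinates-linear : ∀ a b s t →
    coordinates (a L.⊙ ι s L.⊕ b L.⊙ ι t) ≡ s K.*ᵥ coordinates a K.+ᵥ t K.*ᵥ coordinates b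
  coordinates-linear a b s t = combine-injective (begin
    combine (coordinates (a L.⊙ ι s L.⊕ b L.⊙ ι t))
      ≡⟨ combine-coordinates _ ⟩
    a L.⊙ ι s L.⊕ b L.⊙ ι t
      ≡⟨ cong₂ L._⊕_ (term a s) (term b t) ⟩
    combine (s K.*ᵥ coordinates a) L.⊕ combine (t K.*ᵥ coordinates b)
      ≡⟨ combine-+ᵥ (s K.*ᵥ coordinates a) (t K.*ᵥ coordinates b) ⟨
    combine (s K.*ᵥ coordinates a K.+ᵥ t K.*ᵥ coordinates b) ∎)
    where
      open ≡-Reasoning
      term : ∀ a s → a L.⊙ ι s ≡ combine (s K.*ᵥ coordinates a)
      term a s = trans (RL.*-comm a (ι s)) (sym (trans (combine-*ᵥ s (coordinates a))
                   (cong (ι s L.⊙_) (combine-coordinates a))))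

  dot-ιᵥ : ∀ {n} (x : Vec K.Carrier n) v → L.dot (ιᵥ x) v ≡ combine (K.linComb x (matrix v))
  dot-ιᵥ []      []      = sym combine-0ᵥ
  dot-ιᵥ (s ∷ x) (a ∷ v) = begin
    ι s L.⊙ a L.⊕ L.dot (ιᵥ x) v
      ≡⟨ cong₂ L._⊕_ (trans (cong (ι s L.⊙_) (sym (combine-coordinates a)))
                            (sym (combine-*ᵥ s (coordinates a)))) (dot-ιᵥ x v) ⟩
    combine (s K.*ᵥ coordinates a) L.⊕ combine (K.linComb x (matrix v))
      ≡⟨ combine-+ᵥ (s K.*ᵥ coordinates a) _ ⟨
    combine (s K.*ᵥ coordinates a K.+ᵥ K.linComb x (matrix v)) ∎
    where open ≡-Reasoning

  -- The scalar x v has the row x Γ(v) as its coordinates in `Γ`, so it vanishes exactly when `x` is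
  -- orthogonal to every column of Γ(v).
  ⊥⇔⊥support : ∀ {n} (x : Vec K.Carrier n) v →
               L.dot (ιᵥ x) v ≡ L.0# ⇔ (∀ {y} → support v y → K.dot x y ≡ K.0#)
  ⊥⇔⊥support x v = mk⇔ to from
    where
      open ≡-Reasoning
      dot-support : ∀ cs → K.dot x (K.linComb cs (columns v)) ≡ K.dot cs (K.linComb x (matrix v))
      dot-support cs = begin
        K.dot x (K.linComb cs (columns v))     ≡⟨ cong (K.dot x) (K.linComb-transpose cs (matrix v)) ⟩
        K.dot x (K.dots (matrix v) cs)         ≡⟨ K.dot-comm x _ ⟩
        K.dot (K.dots (matrix v) cs) x         ≡⟨ K.dot-linComb cs x (matrix v) ⟨
        K.dot cs (K.linComb x (matrix v))      ∎
      to : L.dot (ιᵥ x) v ≡ L.0# → ∀ {y} → support v y → K.dot x y ≡ K.0#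
      to eq (cs , refl) = begin
        K.dot x (K.linComb cs (columns v))     ≡⟨ dot-support cs ⟩
        K.dot cs (K.linComb x (matrix v))      ≡⟨ cong (K.dot cs) (independent _ (trans (sym (dot-ιᵥ x v)) eq)) ⟩
        K.dot cs K.0ᵥ                          ≡⟨ K.dot-comm cs K.0ᵥ ⟩
        K.dot K.0ᵥ cs                          ≡⟨ K.dot-0ᵥ cs ⟩
        K.0#                                   ∎
      from : (∀ {y} → support v y → K.dot x y ≡ K.0#) → L.dot (ιᵥ x) v ≡ L.0#
      from ⊥ = trans (dot-ιᵥ x v) (trans (cong combine (K.dot-nondegenerate (K.linComb x (matrix v)) λ cs →
        trans (K.dot-comm (K.linComb x (matrix v)) cs) (trans (sym (dot-support cs)) (⊥ (cs , refl))))) combine-0ᵥ)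

  annihilators : ∀ {n} → Vec L.Carrier n → ℕ
  annihilators {n} v = count (λ x → L.dot (ιᵥ x) v L.≟ L.0#) (K.allVectors n)

  -- The x with x v = 0 form the orthogonal complement of the rank support, to which
  -- `count-orthogonal` applies. Opening `span-hasDimension` exposes the very basis whose length is
  -- `rk v`.
  annihilators*q^rk : ∀ {n} (v : Vec L.Carrier n) → annihilators v * q ^ rk v ≡ q ^ n
  annihilators*q^rk {n} v with K.span-hasDimension (columns v)
  ... | r , bs , indep , gen = trans
    (cong (_* q ^ r) (∑-cong (K.allVectors n) λ x → 𝟙-cong (L.dot (ιᵥ x) v L.≟ L.0#) (K.dots bs x K.≟ᵥ K.0ᵥ) (mk⇔
      (λ eq → Equivalence.from (K.dots⊥⇔Span⊥ bs x) λ y∈ →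
        Equivalence.to (⊥⇔⊥support x v) eq (Equivalence.from (gen _) y∈))
      (λ eq → Equivalence.from (⊥⇔⊥support x v) λ y∈ →
        Equivalence.to (K.dots⊥⇔Span⊥ bs x) eq (Equivalence.to (gen _) y∈)))))
    (K.count-orthogonal bs indep)

  q^[n-rk]≡annihilators : ∀ {n} (v : Vec L.Carrier n) → q ^ᶻ (n ⊖ rk v) ≡ ℤ.+ annihilators v ℚ./ 1
  q^[n-rk]≡annihilators {n} v = trans (cong (q ^ᶻ_) (ℤ.⊖-≥ rk≤n)) (cong (λ t → ℤ.+ t ℚ./ 1)
    (ℕ.*-cancelʳ-≡ (q ^ (n ∸ rk v)) (annihilators v) (q ^ rk v) (begin
      q ^ (n ∸ rk v) * q ^ rk v     ≡⟨ ℕ.^-distribˡ-+-* q (n ∸ rk v) (rk v) ⟨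
      q ^ (n ∸ rk v + rk v)         ≡⟨ cong (q ^_) (ℕ.m∸n+n≡m rk≤n) ⟩
      q ^ n                         ≡⟨ annihilators*q^rk v ⟨
      annihilators v * q ^ rk v     ∎)))
    where
      open ≡-Reasoning
      instance
        q≢0 : NonZero q
        q≢0 = >-nonZero (ℕ.<⇒≤ K.2≤q)
        q^rk≢0 : NonZero (q ^ rk v)
        q^rk≢0 = ℕ.m^n≢0 q (rk v)
      -- The count shows that q^rk divides q^n, which bounds the rank and makes the exponent
      -- `n ⊖ rk v` natural.
      rk≤n : rk v ≤ n
      rk≤n = ^-cancelʳ-≤ K.2≤q (∣⇒≤ {{ℕ.m^n≢0 q n}} (divides (annihilators v) (sym (annihilators*q^rk v))))

  -- Every K-functional on L maps a x + b y into the span of x and y over K, so its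
  -- rank is at most 2.
  module _ {n} (a b : L.Carrier) (x y : Vec K.Carrier n) where

    twoTerm : Vec L.Carrier n
    twoTerm = a L.*ᵥ ιᵥ x L.+ᵥ b L.*ᵥ ιᵥ y

    -- The values at `a` and `b` of the K-functional on L that has the coefficients `cs` in the
    -- coordinates of `Γ`.
    coefficients : Vec K.Carrier m → Vec K.Carrier 2
    coefficients cs = K.dot cs (coordinates a) ∷ K.dot cs (coordinates b) ∷ []

    dots-matrix-twoTerm : ∀ cs → K.dots (matrix twoTerm) cs ≡ K.linComb (coefficients cs) (x ∷ y ∷ [])
    dots-matrix-twoTerm cs = go x y
      where
        module RK = CommutativeRing K.commutativeRing
        open ≡-Reasoning
        α = K.dot cs (coordinates a)
        β = K.dot cs (coordinates b)
        go : ∀ {n} (x y : Vec K.Carrier n) →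
             K.dots (matrix (a L.*ᵥ ιᵥ x L.+ᵥ b L.*ᵥ ιᵥ y)) cs ≡ K.linComb (coefficients cs) (x ∷ y ∷ [])
        go []      []      = refl
        go (s ∷ x) (t ∷ y) = cong₂ _∷_ (begin
          K.dot cs (coordinates (a L.⊙ ι s L.⊕ b L.⊙ ι t))
            ≡⟨ cong (K.dot cs) (coordinates-linear a b s t) ⟩
          K.dot cs (s K.*ᵥ coordinates a K.+ᵥ t K.*ᵥ coordinates b)
            ≡⟨ K.dot-comm cs _ ⟩
          K.dot (s K.*ᵥ coordinates a K.+ᵥ t K.*ᵥ coordinates b) cs
            ≡⟨ K.dot-+ᵥ (s K.*ᵥ coordinates a) (t K.*ᵥ coordinates b) cs ⟩
          K.dot (s K.*ᵥ coordinates a) cs K.⊕ K.dot (t K.*ᵥ coordinates b) cs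
            ≡⟨ cong₂ K._⊕_ (scaled s (coordinates a)) (scaled t (coordinates b)) ⟩
          α K.⊙ s K.⊕ β K.⊙ t
            ≡⟨ cong (α K.⊙ s K.⊕_) (RK.+-identityʳ (β K.⊙ t)) ⟨
          α K.⊙ s K.⊕ (β K.⊙ t K.⊕ K.0#) ∎)
          (go x y)
          where
            scaled : ∀ s u → K.dot (s K.*ᵥ u) cs ≡ K.dot cs u K.⊙ s
            scaled s u = trans (K.dot-*ᵥ s u cs) (trans (RK.*-comm s _) (cong (K._⊙ s) (K.dot-comm u cs)))

    rk-twoTerm : rk twoTerm ≤ 2
    rk-twoTerm with K.span-hasDimension (columns twoTerm)
    ... | r , bs , indep , gen = K.independent⇒≤ bs (x ∷ y ∷ []) indep λ {z} z∈ →
      let (cs , z≡) = Equivalence.from (gen z) z∈ in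
      coefficients cs , trans z≡ (trans (K.linComb-transpose cs (matrix twoTerm)) (dots-matrix-twoTerm cs))

    -- Each K-functional on L, applied entrywise to the vanishing vector a x + b y, yields a
    -- relation between `x` and `y` over K.
    twoTerm≡0ᵥ : twoTerm ≡ L.0ᵥ → ∀ cs → K.linComb (coefficients cs) (x ∷ y ∷ []) ≡ K.0ᵥ
    twoTerm≡0ᵥ eq cs = begin
      K.linComb (coefficients cs) (x ∷ y ∷ [])   ≡⟨ dots-matrix-twoTerm cs ⟨
      K.dots (matrix twoTerm) cs                 ≡⟨ cong (λ w → K.dots (matrix w) cs) eq ⟩
      K.dots (matrix (Vec.replicate n L.0#)) cs  ≡⟨ cong (λ M → K.dots M cs) (Vec.map-replicate coordinates L.0# n) ⟩
      K.dots (Vec.replicate n (coordinates L.0#)) cs ≡⟨ Vec.map-replicate (K.dot cs) _ n ⟩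
      Vec.replicate n (K.dot cs (coordinates L.0#)) ≡⟨ cong (Vec.replicate n) (begin
        K.dot cs (coordinates L.0#) ≡⟨ cong (K.dot cs) coordinates-0# ⟩
        K.dot cs K.0ᵥ               ≡⟨ K.dot-comm cs K.0ᵥ ⟩
        K.dot K.0ᵥ cs               ≡⟨ K.dot-0ᵥ cs ⟩
        K.0#                        ∎) ⟩
      K.0ᵥ                                       ∎
      where open ≡-Reasoning

-- Vectors over K as L-linear functionals on a code

module CodeFunctionals {q m : ℕ} {E : FieldExtension q m} {Γ : OrderedBasis E} {n k d : ℕ}
                       (C : Code Γ n k d) where
  open OrderedBasis Γ
  open RankMetric Γ
  open RankSupport Γ
  open Code C hiding (RankNondegenerate)
  open ≡-Reasoning

  basis : Vec (Vec L.Carrier n) k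
  basis = proj₁ hasDimension

  codeword : Vec L.Carrier k → Vec L.Carrier n
  codeword c = L.linComb c basis

  -- The functional v ↦ x v on the code, in coordinates with respect to the basis.
  φ : Vec K.Carrier n → Vec L.Carrier k
  φ x = L.dots basis (ιᵥ x)

  dot-codeword : ∀ x c → L.dot (ιᵥ x) (codeword c) ≡ L.dot c (φ x)
  dot-codeword x c = trans (L.dot-linComb (ιᵥ x) c basis) (L.dot-comm (φ x) c)

  φ-+ᵥ : ∀ x y → φ (x K.+ᵥ y) ≡ φ x L.+ᵥ φ y
  φ-+ᵥ x y = trans (cong (L.dots basis) (ιᵥ-+ᵥ x y)) (L.dots-+ᵥ basis (ιᵥ x) (ιᵥ y))

  φ-0ᵥ : φ K.0ᵥ ≡ L.0ᵥ
  φ-0ᵥ = trans (cong (L.dots basis) (ιᵥ-0ᵥ n)) (L.dots-0ᵥ basis)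

  -- If `x` annihilates every basis codeword, it annihilates every codeword, hence is orthogonal to
  -- every rank support and to their sum, which is all of K^n.
  φ≡0ᵥ : RankNondegenerate C → ∀ {x} → φ x ≡ L.0ᵥ → x ≡ K.0ᵥ
  φ≡0ᵥ nondegenerate {x} φx≡0 = K.dot-nondegenerate x λ y →
    let (ys , ys∈ , y≡) = nondegenerate y in trans (cong (K.dot x) y≡) (sums ys∈)
    where
      word⊥ : ∀ {v} → Word v → L.dot (ιᵥ x) v ≡ L.0#
      word⊥ v∈ = Equivalence.to (L.dots⊥⇔Span⊥ basis (ιᵥ x)) φx≡0
                   (Equivalence.to (proj₂ (proj₂ hasDimension) _) v∈)
      sums : ∀ {ys} → All (λ y → ∃ λ (v : ∃ Word) → support (proj₁ v) y) ys →
             K.dot x (List.foldr K._+ᵥ_ K.0ᵥ ys) ≡ K.0#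
      sums [] = trans (K.dot-comm x K.0ᵥ) (K.dot-0ᵥ x)
      sums {y ∷ ys} (((v , v∈) , y∈) ∷ ys∈) = begin
        K.dot x (y K.+ᵥ rest)          ≡⟨ K.dot-comm x _ ⟩
        K.dot (y K.+ᵥ rest) x          ≡⟨ K.dot-+ᵥ y rest x ⟩
        K.dot y x K.⊕ K.dot rest x     ≡⟨ cong₂ K._⊕_ (K.dot-comm y x) (K.dot-comm rest x) ⟩
        K.dot x y K.⊕ K.dot x rest     ≡⟨ cong₂ K._⊕_ (Equivalence.to (⊥⇔⊥support x v) (word⊥ v∈) y∈) (sums ys∈) ⟩
        K.0# K.⊕ K.0#                  ≡⟨ CommutativeRing.+-identityˡ K.commutativeRing K.0# ⟩
        K.0#                           ∎
        where rest = List.foldr K._+ᵥ_ K.0ᵥ ys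

  φ-twoTerm : ∀ a b x y → L.dots basis (twoTerm a b x y) ≡ a L.*ᵥ φ x L.+ᵥ b L.*ᵥ φ y
  φ-twoTerm a b x y = trans (L.dots-+ᵥ basis (a L.*ᵥ ιᵥ x) (b L.*ᵥ ιᵥ y))
    (cong₂ L._+ᵥ_ (L.dots-*ᵥ basis a (ιᵥ x)) (L.dots-*ᵥ basis b (ιᵥ y)))

  module _ (rank2 : Rank2Nondegenerate) where

    φ-relation⇒twoTerm≡0ᵥ : ∀ a b x y → a L.*ᵥ φ x L.+ᵥ b L.*ᵥ φ y ≡ L.0ᵥ → twoTerm a b x y ≡ L.0ᵥ
    φ-relation⇒twoTerm≡0ᵥ a b x y eq = from-distance (proj₁ (proj₂ rank2))
      where
        w = twoTerm a b x y
        w∈Dual : Dual Word w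
        w∈Dual u u∈ = trans (L.dot-comm u w)
          (Equivalence.to (L.dots⊥⇔Span⊥ basis w) (trans (φ-twoTerm a b x y) eq)
            (Equivalence.to (proj₂ (proj₂ hasDimension) u) u∈))
        from-distance : MinRankDistance (Dual Word) (proj₁ rank2) → w ≡ L.0ᵥ
        -- For the zero dual the distance is a convention, and membership alone gives w = 0.
        from-distance (inj₁ (trivial , _)) = trivial w w∈Dual
        from-distance (inj₂ (_ , minimal)) with w L.≟ᵥ L.0ᵥ
        ... | yes w≡0 = w≡0
        ... | no  w≢0 = contradiction (rk-twoTerm a b x y)
                          (ℕ.<⇒≱ (ℕ.≤-trans (proj₂ (proj₂ rank2)) (minimal w w∈Dual w≢0)))

    -- A relation over L between φ x and φ y gives a x + b y = 0. Each K-functional turns this into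
    -- a relation over K between the independent `x` and `y`, so it kills `a` and `b`; functionals
    -- separate the elements of L.
    φ-independent : ∀ {x y} → K.LinearlyIndependent (x ∷ y ∷ []) →
                    L.LinearlyIndependent (φ x ∷ φ y ∷ [])
    φ-independent {x} {y} indep (a ∷ b ∷ []) eq =
      cong₂ (λ a b → a ∷ b ∷ []) (vanishes a Vec.∷-injectiveˡ) (vanishes b (Vec.∷-injectiveˡ ∘ Vec.∷-injectiveʳ))
      where
        relation : a L.*ᵥ φ x L.+ᵥ b L.*ᵥ φ y ≡ L.0ᵥ
        relation = trans (cong (a L.*ᵥ φ x L.+ᵥ_) (sym (L.+ᵥ-identityʳ (b L.*ᵥ φ y)))) eq
        coefficients≡0 : ∀ cs → coefficients a b x y cs ≡ K.0ᵥ
        coefficients≡0 cs = indep _ (twoTerm≡0ᵥ a b x y (φ-relation⇒twoTerm≡0ᵥ a b x y relation) cs)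
        vanishes : ∀ e → (∀ {cs} → coefficients a b x y cs ≡ K.0ᵥ → K.dot cs (coordinates e) ≡ K.0#) → e ≡ L.0#
        vanishes e extract = coordinates≡0ᵥ (K.dot-nondegenerate (coordinates e) λ cs →
          trans (K.dot-comm (coordinates e) cs) (extract {cs} (coefficients≡0 cs)))

  -- `φ` embeds K^n additively into L^k, which has q^(m k) elements.
  length-bound : RankNondegenerate C → n ≤ k * m
  length-bound nondegenerate = ^-cancelʳ-≤ K.2≤q (subst (q ^ n ≤_)
    (trans (ℕ.^-*-assoc q m k) (cong (q ^_) (ℕ.*-comm m k)))
    (injection-≤ (Vec↔Fin K.cardinality n) (Vec↔Fin L.cardinality k) φ
      (L.additive-injective K._+ᵥ_ ((K.⊝ K.1#) K.*ᵥ_) φ φ-+ᵥ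
        (λ x → trans (cong φ (K.difference-self x)) φ-0ᵥ)
        (λ x y eq → K.vector-difference x y (φ≡0ᵥ nondegenerate eq)))))

length-bound₂ : ∀ {q m} {E : FieldExtension q m} {Γ : OrderedBasis E} {n k d} (C : Code Γ n k d) →
                2 ≤ m → Code.Rank2Nondegenerate C → 2 * n ≤ m * k
length-bound₂ {q} {suc (suc m)} {E} {Γ} {n} {k} C (s≤s (s≤s z≤n)) rank2 =
  ^-cancelʳ-≤ K.2≤q (subst₂ _≤_ domain (ℕ.^-*-assoc q (suc (suc m)) k)
    (injection-≤ (↔-trans (Vec↔Fin K.cardinality n ×-↔ Vec↔Fin K.cardinality n) (↔-sym Fin.*↔×))
                 (Vec↔Fin L.cardinality k) f
      (L.additive-injective _∙_ inv f additive
        (λ (x , y) → trans (cong₂ (λ x y → a L.*ᵥ φ x L.+ᵥ b L.*ᵥ φ y) (K.difference-self x) (K.difference-self y)) f-0)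
        (λ (x , y) (x′ , y′) eq → let (x≡ , y≡) = f≡0 eq in
          cong₂ _,_ (K.vector-difference x x′ x≡) (K.vector-difference y y′ y≡)))))
  where
    open OrderedBasis Γ
    open RankSupport Γ
    open CodeFunctionals C
    open ≡-Reasoning
    module RK = CommutativeRing K.commutativeRing
    domain : q ^ n * q ^ n ≡ q ^ (2 * n)
    domain = trans (sym (ℕ.^-distribˡ-+-* q n n)) (cong (λ t → q ^ (n + t)) (sym (ℕ.+-identityʳ n)))

    _∙_ : Vec K.Carrier n × Vec K.Carrier n → Vec K.Carrier n × Vec K.Carrier n → Vec K.Carrier n × Vec K.Carrier n
    (x , y) ∙ (x′ , y′) = x K.+ᵥ x′ , y K.+ᵥ y′
    inv : Vec K.Carrier n × Vec K.Carrier n → Vec K.Carrier n × Vec K.Carrier n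
    inv (x , y) = (K.⊝ K.1#) K.*ᵥ x , (K.⊝ K.1#) K.*ᵥ y

    -- Here m ≥ 2 enters: `a` and `b` are the first two elements of the basis `Γ`. Writing them as
    -- `combine e₁` and `combine e₂` gives access to their coordinates through
    -- `coordinates-combine`.
    e₁ e₂ : Vec K.Carrier (suc (suc m))
    e₁ = K.1# ∷ K.0ᵥ
    e₂ = K.0# ∷ K.1# ∷ K.0ᵥ
    a b : L.Carrier
    a = combine e₁
    b = combine e₂

    f : Vec K.Carrier n × Vec K.Carrier n → Vec L.Carrier k
    f (x , y) = a L.*ᵥ φ x L.+ᵥ b L.*ᵥ φ y

    additive : ∀ s t → f (s ∙ t) ≡ f s L.+ᵥ f t
    additive (x , y) (x′ , y′) = trans
      (cong₂ L._+ᵥ_ (trans (cong (a L.*ᵥ_) (φ-+ᵥ x x′)) (L.*ᵥ-distribˡ a (φ x) (φ x′)))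
                    (trans (cong (b L.*ᵥ_) (φ-+ᵥ y y′)) (L.*ᵥ-distribˡ b (φ y) (φ y′))))
      (L.interchange (a L.*ᵥ φ x) (a L.*ᵥ φ x′) (b L.*ᵥ φ y) (b L.*ᵥ φ y′))

    f-0 : f (K.0ᵥ , K.0ᵥ) ≡ L.0ᵥ
    f-0 = trans (cong₂ L._+ᵥ_ (trans (cong (a L.*ᵥ_) φ-0ᵥ) (L.*ᵥ0 a)) (trans (cong (b L.*ᵥ_) φ-0ᵥ) (L.*ᵥ0 b)))
                (L.+ᵥ-identityˡ L.0ᵥ)

    dot-1∷0ᵥ : ∀ {n} c (w : Vec K.Carrier n) → K.dot (K.1# ∷ K.0ᵥ) (c ∷ w) ≡ c
    dot-1∷0ᵥ c w = trans (cong₂ K._⊕_ (RK.*-identityˡ c) (K.dot-0ᵥ w)) (RK.+-identityʳ c)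
    dot-0∷ : ∀ {n} c (u w : Vec K.Carrier n) → K.dot (K.0# ∷ u) (c ∷ w) ≡ K.dot u w
    dot-0∷ c u w = trans (cong (K._⊕ K.dot u w) (RK.zeroˡ c)) (RK.+-identityˡ _)

    linComb-e₁ : ∀ (x y : Vec K.Carrier n) → K.linComb (K.1# ∷ K.0# ∷ []) (x ∷ y ∷ []) ≡ x
    linComb-e₁ x y = trans (cong₂ K._+ᵥ_ (*ᵥ-identityˡ x) (K.linComb-0ᵥ (y ∷ []))) (K.+ᵥ-identityʳ x)
      where
        *ᵥ-identityˡ : ∀ {n} (x : Vec K.Carrier n) → K.1# K.*ᵥ x ≡ x
        *ᵥ-identityˡ x = trans (Vec.map-cong RK.*-identityˡ x) (Vec.map-id x)

    f≡0 : ∀ {x y} → f (x , y) ≡ L.0ᵥ → x ≡ K.0ᵥ × y ≡ K.0ᵥ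
    -- Testing a x + b y = 0 with the coordinate functionals `e₁` and `e₂` isolates `x` and `y`.
    f≡0 {x} {y} eq =
        trans (sym (linComb-e₁ x y)) (trans (sym (cong₂ (λ s t → K.linComb (s ∷ t ∷ []) (x ∷ y ∷ [])) e₁a e₁b)) (vanish e₁))
      , trans (sym (linComb-e₂ x y)) (trans (sym (cong₂ (λ s t → K.linComb (s ∷ t ∷ []) (x ∷ y ∷ [])) e₂a e₂b)) (vanish e₂))
      where
        linComb-e₂ : ∀ (x y : Vec K.Carrier n) → K.linComb (K.0# ∷ K.1# ∷ []) (x ∷ y ∷ []) ≡ y
        linComb-e₂ x y = trans (cong₂ K._+ᵥ_ (K.0*ᵥ x) (cong (K._+ᵥ K.0ᵥ) (trans (Vec.map-cong RK.*-identityˡ y) (Vec.map-id y))))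
          (trans (K.+ᵥ-identityˡ _) (K.+ᵥ-identityʳ y))
        vanish : ∀ cs → K.linComb (coefficients a b x y cs) (x ∷ y ∷ []) ≡ K.0ᵥ
        vanish = twoTerm≡0ᵥ a b x y (φ-relation⇒twoTerm≡0ᵥ rank2 a b x y eq)
        u = K.1# ∷ K.0ᵥ {m}
        e₁a : K.dot e₁ (coordinates a) ≡ K.1#
        e₁a = trans (cong (K.dot e₁) (coordinates-combine e₁)) (dot-1∷0ᵥ K.1# (K.0ᵥ {suc m}))
        e₁b : K.dot e₁ (coordinates b) ≡ K.0#
        e₁b = trans (cong (K.dot e₁) (coordinates-combine e₂)) (dot-1∷0ᵥ K.0# u)
        e₂a : K.dot e₂ (coordinates a) ≡ K.0#
        e₂a = trans (cong (K.dot e₂) (coordinates-combine e₁)) (trans (dot-0∷ K.1# u K.0ᵥ)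
                (trans (K.dot-comm u K.0ᵥ) (K.dot-0ᵥ u)))
        e₂b : K.dot e₂ (coordinates b) ≡ K.1#
        e₂b = trans (cong (K.dot e₂) (coordinates-combine e₂)) (trans (dot-0∷ K.0# u u) (dot-1∷0ᵥ K.1# (K.0ᵥ {m})))

-- Moments

∑-*∑ : ∀ {A B : Set} (xs : List A) (ys : List B) f g →
       ∑ xs f * ∑ ys g ≡ ∑ xs (λ x → ∑ ys (λ y → f x * g y))
∑-*∑ xs ys f g = trans (sym (∑-*ʳ xs (∑ ys g) f)) (∑-cong xs λ x → sym (∑-*ˡ ys (f x) g))

module CodeMoments {q m : ℕ} {E : FieldExtension q m} {Γ : OrderedBasis E} {n k d : ℕ}
                   (C : Code Γ n k d) where
  open FieldExtension E using (ι)
  open RankMetric Γ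
  open RankSupport Γ
  open CodeFunctionals C
  open Code C hiding (RankNondegenerate)
  open ≡-Reasoning

  private
    Q = q ^ m
    instance
      Q≢0 : NonZero Q
      Q≢0 = >-nonZero (ℕ.<⇒≤ L.2≤q)

  -- The zero word, absent from the sample, is added back so that the sum runs over the whole of
  -- L^k.
  ∑-nonzeroCodewords : ∀ f → f L.0ᵥ + ∑ nonzeroCodewords f ≡ ∑ (L.allVectors k) (f ∘ codeword)
  ∑-nonzeroCodewords f = trans (sum-↭ (↭.map⁺ f (L.basis-↭ basis (proj₂ hasDimension) _)))
                               (cong sum (sym (List.map-∘ (L.allVectors k))))

  length-nonzeroCodewords : 1 + length nonzeroCodewords ≡ Q ^ k
  length-nonzeroCodewords = begin
    1 + length nonzeroCodewords                   ≡⟨ cong suc (trans (∑-const nonzeroCodewords 1) (ℕ.*-identityʳ _)) ⟨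
    1 + ∑ nonzeroCodewords (λ _ → 1)              ≡⟨ ∑-nonzeroCodewords (λ _ → 1) ⟩
    ∑ (L.allVectors k) (λ _ → 1)                  ≡⟨ L.∑-const-allVectors k 1 ⟩
    Q ^ k * 1                                     ≡⟨ ℕ.*-identityʳ (Q ^ k) ⟩
    Q ^ k                                         ∎

  annihilators-0ᵥ : annihilators (L.0ᵥ {n}) ≡ q ^ n
  annihilators-0ᵥ = trans
    (∑-cong (K.allVectors n) λ x → 𝟙-yes (L.dot (ιᵥ x) L.0ᵥ L.≟ L.0#) (trans (L.dot-comm (ιᵥ x) L.0ᵥ) (L.dot-0ᵥ (ιᵥ x))))
    (trans (K.∑-const-allVectors n 1) (ℕ.*-identityʳ (q ^ n)))

  hit : Vec K.Carrier n → Vec L.Carrier k → ℕ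
  hit x c = 𝟙 (L.dot (ιᵥ x) (codeword c) L.≟ L.0#)

  hit-0ᵥ : ∀ c → hit K.0ᵥ c ≡ 1
  hit-0ᵥ c = 𝟙-yes (L.dot (ιᵥ K.0ᵥ) (codeword c) L.≟ L.0#)
    (trans (cong (λ t → L.dot t (codeword c)) (ιᵥ-0ᵥ n)) (L.dot-0ᵥ (codeword c)))

  hits : Vec K.Carrier n → ℕ
  hits x = ∑ (L.allVectors k) (hit x)

  hits-0ᵥ : hits K.0ᵥ ≡ Q ^ k
  hits-0ᵥ = trans (∑-cong (L.allVectors k) hit-0ᵥ)
              (trans (L.∑-const-allVectors k 1) (ℕ.*-identityʳ (Q ^ k)))

  hits₂ : Vec K.Carrier n → Vec K.Carrier n → ℕ
  hits₂ x y = ∑ (L.allVectors k) (λ c → hit x c * hit y c)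

  ∑-annihilators : ∑ (L.allVectors k) (annihilators ∘ codeword) ≡ ∑ (K.allVectors n) hits
  ∑-annihilators = ∑-swap (L.allVectors k) (K.allVectors n) (λ c x → hit x c)

  ∑-annihilators² : ∑ (L.allVectors k) (λ c → annihilators (codeword c) * annihilators (codeword c))
                  ≡ ∑ (K.allVectors n) (λ x → ∑ (K.allVectors n) (hits₂ x))
  ∑-annihilators² = begin
    ∑ Lk (λ c → annihilators (codeword c) * annihilators (codeword c))
      ≡⟨ ∑-cong Lk (λ c → ∑-*∑ Kn Kn (λ x → hit x c) (λ y → hit y c)) ⟩
    ∑ Lk (λ c → ∑ Kn (λ x → ∑ Kn (λ y → hit x c * hit y c)))
      ≡⟨ ∑-swap Lk Kn _ ⟩
    ∑ Kn (λ x → ∑ Lk (λ c → ∑ Kn (λ y → hit x c * hit y c)))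
      ≡⟨ ∑-cong Kn (λ x → ∑-swap Lk Kn _) ⟩
    ∑ Kn (λ x → ∑ Kn (hits₂ x)) ∎
    where
      Kn = K.allVectors n
      Lk = L.allVectors k

  module _ (nondegenerate : RankNondegenerate C) where

    -- By nondegeneracy φ x is a nonzero form on L^k, so its zeros form a hyperplane. `T` stands for
    -- Q^(k-1), specified by T Q = Q^k.
    hits≡ : ∀ {T x} → T * Q ≡ Q ^ k → x ≢ K.0ᵥ → hits x ≡ T
    hits≡ {T} {x} TQ x≢0 = ℕ.*-cancelʳ-≡ _ T Q (begin
      hits x * Q                                           ≡⟨ cong₂ _*_ (∑-cong (L.allVectors k) reformulate) (sym (ℕ.*-identityʳ Q)) ⟩
      count (λ c → L.dots (φ x ∷ []) c L.≟ᵥ L.0ᵥ) (L.allVectors k) * Q ^ 1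
                                                           ≡⟨ L.count-orthogonal (φ x ∷ []) (L.independent-singleton (x≢0 ∘ φ≡0ᵥ nondegenerate)) ⟩
      Q ^ k                                                ≡⟨ TQ ⟨
      T * Q                                                ∎)
      where
        reformulate : ∀ c → hit x c ≡ 𝟙 (L.dots (φ x ∷ []) c L.≟ᵥ L.0ᵥ)
        reformulate c = 𝟙-cong (_ L.≟ _) (_ L.≟ᵥ _)
          (mk⇔ (λ eq → cong (_∷ []) (trans (sym (dot-codeword x c)) eq))
               (λ eq → trans (dot-codeword x c) (Vec.∷-injectiveˡ eq)))

    -- The vector x = 0 contributes Q^k and each of the q^n - 1 others contributes `T`; the `T`
    -- added on the left replaces the subtraction.
    moment₁ : ∀ {T} → T * Q ≡ Q ^ k →
              ∑ (L.allVectors k) (annihilators ∘ codeword) + T ≡ q ^ n * T + Q ^ k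
    moment₁ {T} TQ = begin
      ∑ (L.allVectors k) (annihilators ∘ codeword) + T
        ≡⟨ cong₂ _+_ ∑-annihilators (sym (ℕ.*-identityˡ T)) ⟩
      ∑ (K.allVectors n) hits + 1 * T
        ≡⟨ cong (λ e → ∑ (K.allVectors n) hits + e * T) one ⟨
      ∑ (K.allVectors n) hits + zeros * T
        ≡⟨ ∑-two-valued (K._≟ᵥ K.0ᵥ) (Q ^ k) T (K.allVectors n) (λ { _ refl → hits-0ᵥ }) (λ _ → hits≡ TQ) ⟩
      length (K.allVectors n) * T + zeros * Q ^ k
        ≡⟨ cong₂ (λ l e → l * T + e * Q ^ k) (K.length-allVectors n) one ⟩
      q ^ n * T + 1 * Q ^ k
        ≡⟨ cong (q ^ n * T +_) (ℕ.*-identityˡ (Q ^ k)) ⟩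
      q ^ n * T + Q ^ k ∎
      where
        zeros = count (K._≟ᵥ K.0ᵥ) (K.allVectors n)
        one : zeros ≡ 1
        one = K.count-unique-vector (K._≟ᵥ K.0ᵥ {n}) refl id

    module _ (rank2 : Rank2Nondegenerate) where

      -- For `y` a multiple of `x`, the condition on `y` follows from that on `x`, so the pair
      -- counts like `x` alone.
      hits₂-dependent : ∀ {T x y} → T * Q ≡ Q ^ k → x ≢ K.0ᵥ → K.Span (x ∷ []) y → hits₂ x y ≡ T
      hits₂-dependent {T} {x} {y} TQ x≢0 (s ∷ [] , y≡) =
        trans (∑-cong (L.allVectors k) absorb) (hits≡ TQ x≢0)
        where
          absorb : ∀ c → hit x c * hit y c ≡ hit x c
          absorb c with L.dot (ιᵥ x) (codeword c) L.≟ L.0#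
          ... | no _     = refl
          ... | yes xv≡0 = trans (ℕ.*-identityˡ (hit y c)) (𝟙-yes (_ L.≟ _) (begin
            L.dot (ιᵥ y) v                ≡⟨ cong (λ t → L.dot (ιᵥ t) v) (trans y≡ (K.+ᵥ-identityʳ (s K.*ᵥ x))) ⟩
            L.dot (ιᵥ (s K.*ᵥ x)) v       ≡⟨ cong (λ t → L.dot t v) (ιᵥ-*ᵥ s x) ⟩
            L.dot (ι s L.*ᵥ ιᵥ x) v       ≡⟨ L.dot-*ᵥ (ι s) (ιᵥ x) v ⟩
            ι s L.⊙ L.dot (ιᵥ x) v        ≡⟨ cong (ι s L.⊙_) xv≡0 ⟩
            ι s L.⊙ L.0#                  ≡⟨ CommutativeRing.zeroʳ L.commutativeRing (ι s) ⟩
            L.0#                          ∎))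
            where v = codeword c

      -- Rank-2-nondegeneracy makes the forms φ x and φ y independent over L, so their common zeros
      -- have codimension 2.
      hits₂-independent : ∀ {U x y} → U * (Q * Q) ≡ Q ^ k → x ≢ K.0ᵥ → ¬ K.Span (x ∷ []) y → hits₂ x y ≡ U
      hits₂-independent {U} {x} {y} UQQ x≢0 y∉ = ℕ.*-cancelʳ-≡ _ U (Q * Q) {{ℕ.m*n≢0 Q Q}} (begin
        hits₂ x y * (Q * Q)
          ≡⟨ cong₂ _*_ (∑-cong (L.allVectors k) reformulate) (cong (Q *_) (sym (ℕ.*-identityʳ Q))) ⟩
        count (λ c → L.dots (φ y ∷ φ x ∷ []) c L.≟ᵥ L.0ᵥ) (L.allVectors k) * Q ^ 2
          ≡⟨ L.count-orthogonal (φ y ∷ φ x ∷ [])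
               (φ-independent rank2 (K.independent-∷ (K.independent-singleton x≢0) y∉)) ⟩
        Q ^ k
          ≡⟨ UQQ ⟨
        U * (Q * Q) ∎)
        where
          reformulate : ∀ c → hit x c * hit y c ≡ 𝟙 (L.dots (φ y ∷ φ x ∷ []) c L.≟ᵥ L.0ᵥ)
          reformulate c = trans (𝟙-× (L.dot (ιᵥ x) (codeword c) L.≟ L.0#) (L.dot (ιᵥ y) (codeword c) L.≟ L.0#))
            (𝟙-cong ((L.dot (ιᵥ x) (codeword c) L.≟ L.0#) ×-dec (L.dot (ιᵥ y) (codeword c) L.≟ L.0#))
                    (L.dots (φ y ∷ φ x ∷ []) c L.≟ᵥ L.0ᵥ)
              (mk⇔ (λ (ex , ey) → cong₂ (λ s t → s ∷ t ∷ []) (trans (sym (dot-codeword y c)) ey)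
                                                             (trans (sym (dot-codeword x c)) ex))
                   (λ eq → trans (dot-codeword x c) (Vec.∷-injectiveˡ (Vec.∷-injectiveʳ eq))
                         , trans (dot-codeword y c) (Vec.∷-injectiveˡ eq))))

      -- `β` is the sum of `hits₂ x y` over all y for a fixed x ≠ 0: the `q` multiples of x give `T`
      -- each, the q^n - q other vectors `U` each. The row x = 0 reproduces the first moment.
      moment₂ : ∀ {T U β} → T * Q ≡ Q ^ k → U * (Q * Q) ≡ Q ^ k → β + q * U ≡ q ^ n * U + q * T →
                ∑ (L.allVectors k) (λ c → annihilators (codeword c) * annihilators (codeword c)) + β
                  ≡ q ^ n * β + ∑ (L.allVectors k) (annihilators ∘ codeword)
      moment₂ {T} {U} {β} TQ UQQ β≡ = begin
        ∑ (L.allVectors k) (λ c → annihilators (codeword c) * annihilators (codeword c)) + β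
          ≡⟨ cong₂ _+_ ∑-annihilators² (sym (ℕ.*-identityˡ β)) ⟩
        ∑ Kn (λ x → ∑ Kn (hits₂ x)) + 1 * β
          ≡⟨ cong (λ e → ∑ Kn (λ x → ∑ Kn (hits₂ x)) + e * β) one ⟨
        ∑ Kn (λ x → ∑ Kn (hits₂ x)) + zeros * β
          ≡⟨ ∑-two-valued (K._≟ᵥ K.0ᵥ) M β Kn row-0ᵥ row ⟩
        length Kn * β + zeros * M
          ≡⟨ cong₂ (λ l e → l * β + e * M) (K.length-allVectors n) one ⟩
        q ^ n * β + 1 * M
          ≡⟨ cong (q ^ n * β +_) (ℕ.*-identityˡ M) ⟩
        q ^ n * β + M ∎
        where
          Kn = K.allVectors n
          M = ∑ (L.allVectors k) (annihilators ∘ codeword)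
          zeros = count (K._≟ᵥ K.0ᵥ) Kn
          one : zeros ≡ 1
          one = K.count-unique-vector (K._≟ᵥ K.0ᵥ {n}) refl id
          row-0ᵥ : ∀ x → x ≡ K.0ᵥ → ∑ Kn (hits₂ x) ≡ M
          row-0ᵥ _ refl = trans
            (∑-cong Kn λ y → ∑-cong (L.allVectors k) λ c →
              trans (cong (_* hit y c) (hit-0ᵥ c)) (ℕ.*-identityˡ (hit y c)))
            (sym ∑-annihilators)
          row : ∀ x → x ≢ K.0ᵥ → ∑ Kn (hits₂ x) ≡ β
          row x x≢0 = ℕ.+-cancelʳ-≡ (q * U) _ β (begin
            ∑ Kn (hits₂ x) + q * U
              ≡⟨ cong (λ e → ∑ Kn (hits₂ x) + e * U) multiples ⟨
            ∑ Kn (hits₂ x) + count (K.Span? (x ∷ [])) Kn * U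
              ≡⟨ ∑-two-valued (K.Span? (x ∷ [])) T U Kn (λ y → hits₂-dependent TQ x≢0) (λ y → hits₂-independent UQQ x≢0) ⟩
            length Kn * U + count (K.Span? (x ∷ [])) Kn * T
              ≡⟨ cong₂ (λ l e → l * U + e * T) (K.length-allVectors n) multiples ⟩
            q ^ n * U + q * T
              ≡⟨ β≡ ⟨
            β + q * U ∎)
            where
              multiples : count (K.Span? (x ∷ [])) Kn ≡ q
              multiples = trans (K.count-Span (x ∷ []) (K.independent-singleton x≢0)) (ℕ.*-identityʳ q)

-- Natural numbers inside the rationals

⟦_⟧ : ℕ → ℚ
⟦ n ⟧ = ℤ.+ n ℚ./ 1

private
  toℚᵘ-⟦⟧ : ∀ n → ℚ.toℚᵘ ⟦ n ⟧ ℚᵘ.≃ mkℚᵘ (ℤ.+ n) 0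
  toℚᵘ-⟦⟧ n = ℚ.toℚᵘ-fromℚᵘ (mkℚᵘ (ℤ.+ n) 0)

⟦⟧-+ : ∀ a b → ⟦ a + b ⟧ ≡ ⟦ a ⟧ ℚ.+ ⟦ b ⟧
⟦⟧-+ a b = ℚ.toℚᵘ-injective (begin
  ℚ.toℚᵘ ⟦ a + b ⟧                         ≈⟨ toℚᵘ-⟦⟧ (a + b) ⟩
  mkℚᵘ (ℤ.+ (a + b)) 0                     ≈⟨ *≡* (cong (ℤ._* ℤ.+ 1) (sym (cong₂ ℤ._+_ (ℤ.*-identityʳ (ℤ.+ a)) (ℤ.*-identityʳ (ℤ.+ b))))) ⟩
  mkℚᵘ (ℤ.+ a) 0 ℚᵘ.+ mkℚᵘ (ℤ.+ b) 0       ≈⟨ ℚᵘ.+-cong (toℚᵘ-⟦⟧ a) (toℚᵘ-⟦⟧ b) ⟨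
  ℚ.toℚᵘ ⟦ a ⟧ ℚᵘ.+ ℚ.toℚᵘ ⟦ b ⟧           ≈⟨ ℚ.toℚᵘ-homo-+ ⟦ a ⟧ ⟦ b ⟧ ⟨
  ℚ.toℚᵘ (⟦ a ⟧ ℚ.+ ⟦ b ⟧)                 ∎)
  where open import Relation.Binary.Reasoning.Setoid ℚᵘ.≃-setoid

⟦⟧-* : ∀ a b → ⟦ a * b ⟧ ≡ ⟦ a ⟧ ℚ.* ⟦ b ⟧
⟦⟧-* a b = ℚ.toℚᵘ-injective (begin
  ℚ.toℚᵘ ⟦ a * b ⟧                         ≈⟨ toℚᵘ-⟦⟧ (a * b) ⟩
  mkℚᵘ (ℤ.+ (a * b)) 0                     ≈⟨ *≡* (cong (ℤ._* ℤ.+ 1) (ℤ.pos-* a b)) ⟩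
  mkℚᵘ (ℤ.+ a) 0 ℚᵘ.* mkℚᵘ (ℤ.+ b) 0       ≈⟨ ℚᵘ.*-cong (toℚᵘ-⟦⟧ a) (toℚᵘ-⟦⟧ b) ⟨
  ℚ.toℚᵘ ⟦ a ⟧ ℚᵘ.* ℚ.toℚᵘ ⟦ b ⟧           ≈⟨ ℚ.toℚᵘ-homo-* ⟦ a ⟧ ⟦ b ⟧ ⟨
  ℚ.toℚᵘ (⟦ a ⟧ ℚ.* ⟦ b ⟧)                 ∎)
  where open import Relation.Binary.Reasoning.Setoid ℚᵘ.≃-setoid

⟦⟧-mono-≤ : ∀ {a b} → a ≤ b → ⟦ a ⟧ ℚ.≤ ⟦ b ⟧
⟦⟧-mono-≤ {a} {b} a≤b = ℚ.toℚᵘ-cancel-≤ (ℚᵘ.≤-respˡ-≃ (ℚᵘ.≃-sym (toℚᵘ-⟦⟧ a)) (ℚᵘ.≤-respʳ-≃ (ℚᵘ.≃-sym (toℚᵘ-⟦⟧ b))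
  (*≤* (ℤ.*-monoʳ-≤-nonNeg (ℤ.+ 1) (ℤ.+≤+ a≤b)))))

⟦⟧-mono-< : ∀ {a b} → a < b → ⟦ a ⟧ ℚ.< ⟦ b ⟧
⟦⟧-mono-< {a} {b} a<b = ℚ.toℚᵘ-cancel-< (ℚᵘ.<-respˡ-≃ (ℚᵘ.≃-sym (toℚᵘ-⟦⟧ a)) (ℚᵘ.<-respʳ-≃ (ℚᵘ.≃-sym (toℚᵘ-⟦⟧ b))
  (*<* (ℤ.*-monoʳ-<-pos (ℤ.+ 1) (ℤ.+<+ a<b)))))

⟦⟧-positive : ∀ n .{{_ : NonZero n}} → ℚ.Positive ⟦ n ⟧
⟦⟧-positive n@(suc _) = ℚ.positive (⟦⟧-mono-< {0} {n} (s≤s z≤n))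

/-⟦⟧ : ∀ p n .{{_ : NonZero n}} → (ℤ.+ p ℚ./ n) ℚ.* ⟦ n ⟧ ≡ ⟦ p ⟧
/-⟦⟧ p n@(suc e) = ℚ.toℚᵘ-injective (begin
  ℚ.toℚᵘ ((ℤ.+ p ℚ./ n) ℚ.* ⟦ n ⟧)          ≈⟨ ℚ.toℚᵘ-homo-* (ℤ.+ p ℚ./ n) ⟦ n ⟧ ⟩
  ℚ.toℚᵘ (ℤ.+ p ℚ./ n) ℚᵘ.* ℚ.toℚᵘ ⟦ n ⟧    ≈⟨ ℚᵘ.*-cong (ℚ.toℚᵘ-fromℚᵘ (mkℚᵘ (ℤ.+ p) e)) (toℚᵘ-⟦⟧ n) ⟩
  mkℚᵘ (ℤ.+ p) e ℚᵘ.* mkℚᵘ (ℤ.+ n) 0        ≈⟨ *≡* (ℤ.*-assoc (ℤ.+ p) (ℤ.+ n) (ℤ.+ 1)) ⟩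
  mkℚᵘ (ℤ.+ p) 0                            ≈⟨ toℚᵘ-⟦⟧ p ⟨
  ℚ.toℚᵘ ⟦ p ⟧                              ∎)
  where open import Relation.Binary.Reasoning.Setoid ℚᵘ.≃-setoid

-- With the denominator q^b cleared, a signed power of `q` enters the estimates only as a quotient
-- of natural powers.
^ᶻ-⊖ : ∀ q a b .{{_ : NonZero q}} → (q ^ᶻ (a ⊖ b)) ℚ.* ⟦ q ^ b ⟧ ≡ ⟦ q ^ a ⟧
^ᶻ-⊖ q@(suc p) a b with ℕ.≤-total b a
... | inj₁ b≤a = begin
  (q ^ᶻ (a ⊖ b)) ℚ.* ⟦ q ^ b ⟧        ≡⟨ cong (λ e → (q ^ᶻ e) ℚ.* ⟦ q ^ b ⟧) (ℤ.⊖-≥ b≤a) ⟩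
  ⟦ q ^ (a ∸ b) ⟧ ℚ.* ⟦ q ^ b ⟧       ≡⟨ ⟦⟧-* (q ^ (a ∸ b)) (q ^ b) ⟨
  ⟦ q ^ (a ∸ b) * q ^ b ⟧             ≡⟨ cong ⟦_⟧ (ℕ.^-distribˡ-+-* q (a ∸ b) b) ⟨
  ⟦ q ^ (a ∸ b + b) ⟧                 ≡⟨ cong (λ e → ⟦ q ^ e ⟧) (ℕ.m∸n+n≡m b≤a) ⟩
  ⟦ q ^ a ⟧                           ∎
  where open ≡-Reasoning
... | inj₂ a≤b = begin
  (q ^ᶻ (a ⊖ b)) ℚ.* ⟦ q ^ b ⟧                        ≡⟨ cong₂ (λ e f → (q ^ᶻ e) ℚ.* ⟦ q ^ f ⟧) (ℤ.⊖-≤ a≤b) (sym (ℕ.m∸n+n≡m a≤b)) ⟩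
  (q ^ᶻ (ℤ.- ℤ.+ (b ∸ a))) ℚ.* ⟦ q ^ (b ∸ a + a) ⟧    ≡⟨ inverse (b ∸ a) ⟩
  ⟦ q ^ a ⟧                                           ∎
  where
    open ≡-Reasoning
    inverse : ∀ e → (q ^ᶻ (ℤ.- ℤ.+ e)) ℚ.* ⟦ q ^ (e + a) ⟧ ≡ ⟦ q ^ a ⟧
    inverse zero    = ℚ.*-identityˡ ⟦ q ^ a ⟧
    inverse (suc e) = begin
      1/q^e ℚ.* ⟦ q ^ (suc e + a) ⟧                   ≡⟨ cong (λ t → 1/q^e ℚ.* ⟦ t ⟧) (ℕ.^-distribˡ-+-* q (suc e) a) ⟩
      1/q^e ℚ.* ⟦ q ^ suc e * q ^ a ⟧                 ≡⟨ cong (1/q^e ℚ.*_) (⟦⟧-* (q ^ suc e) (q ^ a)) ⟩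
      1/q^e ℚ.* (⟦ q ^ suc e ⟧ ℚ.* ⟦ q ^ a ⟧)         ≡⟨ ℚ.*-assoc 1/q^e ⟦ q ^ suc e ⟧ ⟦ q ^ a ⟧ ⟨
      1/q^e ℚ.* ⟦ q ^ suc e ⟧ ℚ.* ⟦ q ^ a ⟧           ≡⟨ cong (ℚ._* ⟦ q ^ a ⟧) (/-⟦⟧ 1 (q ^ suc e) {{ℕ.m^n≢0 q (suc e)}}) ⟩
      1ℚ ℚ.* ⟦ q ^ a ⟧                                ≡⟨ ℚ.*-identityˡ ⟦ q ^ a ⟧ ⟩
      ⟦ q ^ a ⟧                                       ∎
      where 1/q^e = (ℤ.+ 1 ℚ./ (q ^ suc e)) {{ℕ.m^n≢0 q (suc e)}}

-- Mean and variance

module _ {A : Set} where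

  ∑ℚ : List A → (A → ℚ) → ℚ
  ∑ℚ xs f = List.foldr ℚ._+_ 0ℚ (List.map f xs)

  ∑ℚ-⟦⟧ : ∀ xs {f : A → ℚ} {g : A → ℕ} → (∀ x → f x ≡ ⟦ g x ⟧) → ∑ℚ xs f ≡ ⟦ ∑ xs g ⟧
  ∑ℚ-⟦⟧ []       f≡g = refl
  ∑ℚ-⟦⟧ (x ∷ xs) {f} {g} f≡g = trans (cong₂ ℚ._+_ (f≡g x) (∑ℚ-⟦⟧ xs f≡g)) (sym (⟦⟧-+ (g x) (∑ xs g)))

  average*length : ∀ xs → average xs ℚ.* ⟦ length xs ⟧ ≡ List.foldr ℚ._+_ 0ℚ xs
  average*length []           = refl
  average*length xs@(_ ∷ xs′) = begin
    total ℚ.* (ℤ.+ 1 ℚ./ suc (length xs′)) ℚ.* ⟦ length xs ⟧      ≡⟨ ℚ.*-assoc total _ _ ⟩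
    total ℚ.* ((ℤ.+ 1 ℚ./ suc (length xs′)) ℚ.* ⟦ length xs ⟧)    ≡⟨ cong (total ℚ.*_) (/-⟦⟧ 1 (length xs)) ⟩
    total ℚ.* 1ℚ                                                 ≡⟨ ℚ.*-identityʳ total ⟩
    total                                                        ∎
    where
      open ≡-Reasoning
      total = List.foldr ℚ._+_ 0ℚ xs

  mean*length : ∀ xs (f : A → ℚ) → mean xs f ℚ.* ⟦ length xs ⟧ ≡ ∑ℚ xs f
  mean*length xs f = trans (cong (λ l → mean xs f ℚ.* ⟦ l ⟧) (sym (List.length-map f xs)))
                           (average*length (List.map f xs))

  -- Expansion of the squares, with the cross term moved to the left. `μ` is arbitrary because the
  -- mean of the full list must stay fixed during the induction.
  ∑ℚ-deviation : ∀ xs (f : A → ℚ) μ →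
    ∑ℚ xs (λ x → (f x ℚ.- μ) ℚ.* (f x ℚ.- μ)) ℚ.+ (μ ℚ.+ μ) ℚ.* ∑ℚ xs f
      ≡ ∑ℚ xs (λ x → f x ℚ.* f x) ℚ.+ ⟦ length xs ⟧ ℚ.* (μ ℚ.* μ)
  ∑ℚ-deviation []       f μ = solve 1 (λ μ → con 0ℚ :+ (μ :+ μ) :* con 0ℚ := con 0ℚ :+ con 0ℚ :* (μ :* μ)) refl μ
    where open ℚ.+-*-Solver using (solve; con; _:+_; _:*_; _:-_; _:=_)
  ∑ℚ-deviation (x ∷ xs) f μ = begin
    (a ℚ.- μ) ℚ.* (a ℚ.- μ) ℚ.+ D ℚ.+ (μ ℚ.+ μ) ℚ.* (a ℚ.+ F)
      ≡⟨ solve 4 (λ a μ D F → (a :- μ) :* (a :- μ) :+ D :+ (μ :+ μ) :* (a :+ F)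
                    := a :* a :+ μ :* μ :+ (D :+ (μ :+ μ) :* F)) refl a μ D F ⟩
    a ℚ.* a ℚ.+ μ ℚ.* μ ℚ.+ (D ℚ.+ (μ ℚ.+ μ) ℚ.* F)
      ≡⟨ cong (a ℚ.* a ℚ.+ μ ℚ.* μ ℚ.+_) (∑ℚ-deviation xs f μ) ⟩
    a ℚ.* a ℚ.+ μ ℚ.* μ ℚ.+ (G ℚ.+ l ℚ.* (μ ℚ.* μ))
      ≡⟨ solve 4 (λ a μ G l → a :* a :+ μ :* μ :+ (G :+ l :* (μ :* μ))
                    := a :* a :+ G :+ (con 1ℚ :+ l) :* (μ :* μ)) refl a μ G l ⟩
    a ℚ.* a ℚ.+ G ℚ.+ (1ℚ ℚ.+ l) ℚ.* (μ ℚ.* μ)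
      ≡⟨ cong (λ t → a ℚ.* a ℚ.+ G ℚ.+ t ℚ.* (μ ℚ.* μ)) (⟦⟧-+ 1 (length xs)) ⟨
    a ℚ.* a ℚ.+ G ℚ.+ ⟦ suc (length xs) ⟧ ℚ.* (μ ℚ.* μ) ∎
    where
      open ≡-Reasoning
      open ℚ.+-*-Solver using (solve; con; _:+_; _:*_; _:-_; _:=_)
      a = f x
      D = ∑ℚ xs (λ x → (f x ℚ.- μ) ℚ.* (f x ℚ.- μ))
      F = ∑ℚ xs f
      G = ∑ℚ xs (λ x → f x ℚ.* f x)
      l = ⟦ length xs ⟧

  -- This is Var f = E[f²] - E[f]² multiplied by the squared length.
  variance*length² : ∀ xs (f : A → ℚ) →
    variance xs f ℚ.* (⟦ length xs ⟧ ℚ.* ⟦ length xs ⟧) ℚ.+ ∑ℚ xs f ℚ.* ∑ℚ xs f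
      ≡ ⟦ length xs ⟧ ℚ.* ∑ℚ xs (λ x → f x ℚ.* f x)
  variance*length² xs f = begin
    V ℚ.* (l ℚ.* l) ℚ.+ F ℚ.* F
      ≡⟨ solve 3 (λ V l F → V :* (l :* l) :+ F :* F := V :* l :* l :+ F :* F) refl V l F ⟩
    V ℚ.* l ℚ.* l ℚ.+ F ℚ.* F
      ≡⟨ cong (λ t → t ℚ.* l ℚ.+ F ℚ.* F) (mean*length xs _) ⟩
    D ℚ.* l ℚ.+ F ℚ.* F
      ≡⟨ cong (λ t → D ℚ.* l ℚ.+ t ℚ.* t) (mean*length xs f) ⟨
    D ℚ.* l ℚ.+ (μ ℚ.* l) ℚ.* (μ ℚ.* l)
      ≡⟨ solve 3 (λ D l μ → D :* l :+ (μ :* l) :* (μ :* l)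
                    := (D :+ (μ :+ μ) :* (μ :* l)) :* l :- (μ :* l) :* (μ :* l)) refl D l μ ⟩
    (D ℚ.+ (μ ℚ.+ μ) ℚ.* (μ ℚ.* l)) ℚ.* l ℚ.- (μ ℚ.* l) ℚ.* (μ ℚ.* l)
      ≡⟨ cong (λ t → (D ℚ.+ (μ ℚ.+ μ) ℚ.* t) ℚ.* l ℚ.- (μ ℚ.* l) ℚ.* (μ ℚ.* l)) (mean*length xs f) ⟩
    (D ℚ.+ (μ ℚ.+ μ) ℚ.* F) ℚ.* l ℚ.- (μ ℚ.* l) ℚ.* (μ ℚ.* l)
      ≡⟨ cong (λ t → t ℚ.* l ℚ.- (μ ℚ.* l) ℚ.* (μ ℚ.* l)) (∑ℚ-deviation xs f μ) ⟩
    (G ℚ.+ l ℚ.* (μ ℚ.* μ)) ℚ.* l ℚ.- (μ ℚ.* l) ℚ.* (μ ℚ.* l)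
      ≡⟨ solve 3 (λ G l μ → (G :+ l :* (μ :* μ)) :* l :- (μ :* l) :* (μ :* l) := l :* G) refl G l μ ⟩
    l ℚ.* G ∎
    where
      open ≡-Reasoning
      open ℚ.+-*-Solver using (solve; con; _:+_; _:*_; _:-_; _:=_)
      μ = mean xs f
      V = variance xs f
      D = ∑ℚ xs (λ x → (f x ℚ.- μ) ℚ.* (f x ℚ.- μ))
      F = ∑ℚ xs f
      G = ∑ℚ xs (λ x → f x ℚ.* f x)
      l = ⟦ length xs ⟧

-- Asymptotics

-- (1 - c / q) b ≤ a ≤ b, cleared of the division and the subtraction.
record Close (q c a b : ℕ) : Set where
  constructor close
  field
    ≤-bound : a ≤ b
    gap     : q * b ≤ q * a + c * b

Close-refl : ∀ {q a} → Close q 0 a a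
Close-refl = close ℕ.≤-refl (ℕ.m≤m+n _ _)

Close-weaken : ∀ {q c c′ a b} → c ≤ c′ → Close q c a b → Close q c′ a b
Close-weaken {q} {a = a} {b} c≤c′ (close a≤b gap) =
  close a≤b (ℕ.≤-trans gap (ℕ.+-monoʳ-≤ (q * a) (ℕ.*-monoˡ-≤ b c≤c′)))

-- Decreasing a number by one costs the relative error 1 / (a + 1), which is at most 1 / q.
Close-pred : ∀ {q a} → q ≤ suc a → Close q 1 a (suc a)
Close-pred {q} {a} q≤ = close (ℕ.n≤1+n a) (begin
  q * suc a            ≡⟨ ℕ.*-suc q a ⟩
  q + q * a            ≡⟨ ℕ.+-comm q (q * a) ⟩
  q * a + q            ≤⟨ ℕ.+-monoʳ-≤ (q * a) q≤ ⟩
  q * a + suc a        ≡⟨ cong (q * a +_) (ℕ.*-identityˡ (suc a)) ⟨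
  q * a + 1 * suc a    ∎)
  where open ≤-Reasoning

-- Relative errors add: (1 - c/q)(1 - c′/q) ≥ 1 - (c + c′)/q.
Close-* : ∀ {q c c′ a a′ b b′} → Close q c a b → Close q c′ a′ b′ → Close q (c + c′) (a * a′) (b * b′)
Close-* {q} {c} {c′} {a} {a′} {b} {b′} (close a≤b gap) (close a′≤b′ gap′) =
  close (ℕ.*-mono-≤ a≤b a′≤b′) (begin
    q * (b * b′)                                ≡⟨ ℕ.*-assoc q b b′ ⟨
    q * b * b′                                  ≤⟨ ℕ.*-monoˡ-≤ b′ gap ⟩
    (q * a + c * b) * b′                        ≡⟨ solve 5 (λ q a c b b′ → (q :* a :+ c :* b) :* b′ := a :* (q :* b′) :+ c :* (b :* b′)) refl q a c b b′ ⟩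
    a * (q * b′) + c * (b * b′)                 ≤⟨ ℕ.+-monoˡ-≤ (c * (b * b′)) (ℕ.*-monoʳ-≤ a gap′) ⟩
    a * (q * a′ + c′ * b′) + c * (b * b′)       ≡⟨ solve 6 (λ q a a′ c′ b′ r → a :* (q :* a′ :+ c′ :* b′) :+ r := q :* (a :* a′) :+ c′ :* (a :* b′) :+ r) refl q a a′ c′ b′ (c * (b * b′)) ⟩
    q * (a * a′) + c′ * (a * b′) + c * (b * b′) ≤⟨ ℕ.+-monoˡ-≤ (c * (b * b′)) (ℕ.+-monoʳ-≤ (q * (a * a′)) (ℕ.*-monoʳ-≤ c′ (ℕ.*-monoˡ-≤ b′ a≤b))) ⟩
    q * (a * a′) + c′ * (b * b′) + c * (b * b′) ≡⟨ solve 4 (λ s c c′ r → s :+ c′ :* r :+ c :* r := s :+ (c :+ c′) :* r) refl (q * (a * a′)) c c′ (b * b′) ⟩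
    q * (a * a′) + (c + c′) * (b * b′)          ∎)
  where
    open ≤-Reasoning
    open +-*-Solver using (solve; con; _:+_; _:*_; _:=_)

Close⇒≤ : ∀ {q c a b} .{{_ : NonZero q}} → 2 * c ≤ q → Close q c a b → b ≤ 2 * a
Close⇒≤ {q} {c} {a} {b} 2c≤q (close _ gap) = ℕ.*-cancelˡ-≤ q (ℕ.+-cancelʳ-≤ (q * b) _ _ (begin
  q * b + q * b                     ≤⟨ ℕ.+-mono-≤ gap gap ⟩
  q * a + c * b + (q * a + c * b)   ≡⟨ solve 4 (λ q a c b → q :* a :+ c :* b :+ (q :* a :+ c :* b)
                                         := q :* (con 2 :* a) :+ con 2 :* c :* b) refl q a c b ⟩
  q * (2 * a) + 2 * c * b           ≤⟨ ℕ.+-monoʳ-≤ (q * (2 * a)) (ℕ.*-monoˡ-≤ b 2c≤q) ⟩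
  q * (2 * a) + q * b               ∎))
  where
    open ≤-Reasoning
    open +-*-Solver using (solve; con; _:+_; _:*_; _:=_)

-- Both numbers lie between (1 - c/q) b and b, so they differ by at most c b / q; b ≤ 2 e restates
-- this relative to the eventual denominator `e`, whence the factor 2.
Close-common : ∀ {q c a a′ b e} → b ≤ 2 * e → Close q c a b → Close q c a′ b →
               q * a ≤ q * a′ + 2 * c * e
Close-common {q} {c} {a} {a′} {b} {e} b≤2e (close a≤b _) (close _ gap′) = begin
  q * a                   ≤⟨ ℕ.*-monoʳ-≤ q a≤b ⟩
  q * b                   ≤⟨ gap′ ⟩
  q * a′ + c * b          ≤⟨ ℕ.+-monoʳ-≤ (q * a′) (ℕ.*-monoʳ-≤ c b≤2e) ⟩
  q * a′ + c * (2 * e)    ≡⟨ cong (q * a′ +_) (solve 2 (λ c e → c :* (con 2 :* e) := con 2 :* c :* e) refl c e) ⟩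
  q * a′ + 2 * c * e      ∎
  where
    open ≤-Reasoning
    open +-*-Solver using (solve; con; _:+_; _:*_; _:=_)

-- A positive fraction is at least the inverse of its denominator, so the denominator of `ε` serves
-- as the witness.
Archimedean : ∀ ε → 0ℚ ℚ.< ε → ∃ λ M → 1ℚ ℚ.≤ ε ℚ.* ⟦ suc M ⟧
Archimedean ε@(ℚ.mkℚ (ℤ.+ zero) _ _) (ℚ.*<* (ℤ.+<+ ()))
Archimedean ε@(ℚ.mkℚ ℤ.-[1+ _ ] _ _) (ℚ.*<* ())
Archimedean ε@(ℚ.mkℚ (ℤ.+ suc p) e _) _ = e , subst (1ℚ ℚ.≤_)
  (sym (trans (cong (ℚ._* ⟦ suc e ⟧) (sym (ℚ.fromℚᵘ-toℚᵘ ε))) (/-⟦⟧ (suc p) (suc e))))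
  (⟦⟧-mono-≤ {1} {suc p} (s≤s z≤n))

∣∣-< : ∀ {x ε} → x ℚ.< ε → ℚ.- x ℚ.< ε → ℚ.∣ x ∣ ℚ.< ε
∣∣-< {x} {ε} x<ε -x<ε with ℚ.∣p∣≡p∨∣p∣≡-p x
... | inj₁ eq = subst (ℚ._< ε) (sym eq) x<ε
... | inj₂ eq = subst (ℚ._< ε) (sym eq) -x<ε

-- In effect x ≤ c / q < 1 / (M + 1) ≤ ε, multiplied by the positive number q a.
small : ∀ ε c M q a x .{{_ : NonZero a}} → 1ℚ ℚ.≤ ε ℚ.* ⟦ suc M ⟧ → 0ℚ ℚ.< ε → c * suc M < q →
        x ℚ.* ⟦ q * a ⟧ ℚ.≤ ⟦ c * a ⟧ → x ℚ.< ε
small ε c M q a x arch 0<ε cM<q bound =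
  ℚ.*-cancelʳ-<-nonNeg ⟦ q * a ⟧ {{ℚ.nonNegative (⟦⟧-mono-≤ {0} {q * a} z≤n)}} (begin-strict
    x ℚ.* ⟦ q * a ⟧                       ≤⟨ bound ⟩
    ⟦ c * a ⟧                             ≡⟨ ℚ.*-identityˡ ⟦ c * a ⟧ ⟨
    1ℚ ℚ.* ⟦ c * a ⟧                      ≤⟨ ℚ.*-monoʳ-≤-nonNeg ⟦ c * a ⟧ {{ℚ.nonNegative (⟦⟧-mono-≤ {0} {c * a} z≤n)}} arch ⟩
    ε ℚ.* ⟦ suc M ⟧ ℚ.* ⟦ c * a ⟧         ≡⟨ ℚ.*-assoc ε ⟦ suc M ⟧ ⟦ c * a ⟧ ⟩
    ε ℚ.* (⟦ suc M ⟧ ℚ.* ⟦ c * a ⟧)       ≡⟨ cong (ε ℚ.*_) (⟦⟧-* (suc M) (c * a)) ⟨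
    ε ℚ.* ⟦ suc M * (c * a) ⟧             <⟨ ℚ.*-monoʳ-<-pos ε {{ℚ.positive 0<ε}} (⟦⟧-mono-< {suc M * (c * a)} {q * a} below) ⟩
    ε ℚ.* ⟦ q * a ⟧                       ∎)
  where
    open ℚ.≤-Reasoning
    below : suc M * (c * a) < q * a
    below = subst (_< q * a) (trans (cong (_* a) (ℕ.*-comm c (suc M))) (ℕ.*-assoc (suc M) c a)) (ℕ.*-monoˡ-< a cM<q)

ratio-small : ∀ ε c M q r a a′ .{{_ : NonZero a′}} → 1ℚ ℚ.≤ ε ℚ.* ⟦ suc M ⟧ → 0ℚ ℚ.< ε → c * suc M < q →
              r ℚ.* ⟦ a′ ⟧ ≡ ⟦ a ⟧ → q * a ≤ q * a′ + c * a′ → q * a′ ≤ q * a + c * a′ →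
              ℚ.∣ r ℚ.- 1ℚ ∣ ℚ.< ε
ratio-small ε c M q r a a′ arch 0<ε cM<q ra′≡a upper lower =
  ∣∣-< (small ε c M q a′ _ arch 0<ε cM<q above) (small ε c M q a′ _ arch 0<ε cM<q below)
  where
    open ℚ.≤-Reasoning
    open ℚ.+-*-Solver using (solve; con; _:+_; _:*_; _:-_; :-_; _:=_)
    rqa′ : r ℚ.* ⟦ q * a′ ⟧ ≡ ⟦ q * a ⟧
    rqa′ = begin-equality
      r ℚ.* ⟦ q * a′ ⟧             ≡⟨ cong (r ℚ.*_) (⟦⟧-* q a′) ⟩
      r ℚ.* (⟦ q ⟧ ℚ.* ⟦ a′ ⟧)     ≡⟨ solve 3 (λ r q a → r :* (q :* a) := q :* (r :* a)) refl r ⟦ q ⟧ ⟦ a′ ⟧ ⟩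
      ⟦ q ⟧ ℚ.* (r ℚ.* ⟦ a′ ⟧)     ≡⟨ cong (⟦ q ⟧ ℚ.*_) ra′≡a ⟩
      ⟦ q ⟧ ℚ.* ⟦ a ⟧              ≡⟨ ⟦⟧-* q a ⟨
      ⟦ q * a ⟧                    ∎
    above : (r ℚ.- 1ℚ) ℚ.* ⟦ q * a′ ⟧ ℚ.≤ ⟦ c * a′ ⟧
    above = begin
      (r ℚ.- 1ℚ) ℚ.* X                ≡⟨ solve 2 (λ r x → (r :- con 1ℚ) :* x := r :* x :- x) refl r X ⟩
      r ℚ.* X ℚ.- X                   ≡⟨ cong (ℚ._- X) rqa′ ⟩
      ⟦ q * a ⟧ ℚ.- X                 ≤⟨ ℚ.+-monoˡ-≤ (ℚ.- X) (⟦⟧-mono-≤ upper) ⟩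
      ⟦ q * a′ + c * a′ ⟧ ℚ.- X       ≡⟨ cong (ℚ._- X) (⟦⟧-+ (q * a′) (c * a′)) ⟩
      X ℚ.+ ⟦ c * a′ ⟧ ℚ.- X          ≡⟨ solve 2 (λ x y → x :+ y :- x := y) refl X ⟦ c * a′ ⟧ ⟩
      ⟦ c * a′ ⟧                      ∎
      where X = ⟦ q * a′ ⟧
    below : ℚ.- (r ℚ.- 1ℚ) ℚ.* ⟦ q * a′ ⟧ ℚ.≤ ⟦ c * a′ ⟧
    below = begin
      ℚ.- (r ℚ.- 1ℚ) ℚ.* X                ≡⟨ solve 2 (λ r x → :- (r :- con 1ℚ) :* x := x :- r :* x) refl r X ⟩
      X ℚ.- r ℚ.* X                       ≡⟨ cong (λ t → X ℚ.- t) rqa′ ⟩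
      X ℚ.- ⟦ q * a ⟧                     ≤⟨ ℚ.+-monoˡ-≤ (ℚ.- ⟦ q * a ⟧) (⟦⟧-mono-≤ lower) ⟩
      ⟦ q * a + c * a′ ⟧ ℚ.- ⟦ q * a ⟧    ≡⟨ cong (ℚ._- ⟦ q * a ⟧) (⟦⟧-+ (q * a) (c * a′)) ⟩
      ⟦ q * a ⟧ ℚ.+ ⟦ c * a′ ⟧ ℚ.- ⟦ q * a ⟧ ≡⟨ solve 2 (λ x y → x :+ y :- x := y) refl ⟦ q * a ⟧ ⟦ c * a′ ⟧ ⟩
      ⟦ c * a′ ⟧                          ∎
      where X = ⟦ q * a′ ⟧

ratio : ∀ g h P A R S .{{_ : ℚ.NonZero h}} → g ℚ.* ⟦ A ⟧ ≡ ⟦ P ⟧ → h ℚ.* ⟦ S ⟧ ≡ ⟦ R ⟧ →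
        (g ℚ.÷ h) ℚ.* ⟦ A * R ⟧ ≡ ⟦ P * S ⟧
ratio g h P A R S gA hS = begin
  g ℚ.* ℚ.1/ h ℚ.* ⟦ A * R ⟧                      ≡⟨ cong (g ℚ.* ℚ.1/ h ℚ.*_) (trans (⟦⟧-* A R) (cong (⟦ A ⟧ ℚ.*_) (sym hS))) ⟩
  g ℚ.* ℚ.1/ h ℚ.* (⟦ A ⟧ ℚ.* (h ℚ.* ⟦ S ⟧))      ≡⟨ solve 5 (λ g i a h s → g :* i :* (a :* (h :* s)) := g :* a :* s :* (i :* h)) refl g (ℚ.1/ h) ⟦ A ⟧ h ⟦ S ⟧ ⟩
  g ℚ.* ⟦ A ⟧ ℚ.* ⟦ S ⟧ ℚ.* (ℚ.1/ h ℚ.* h)        ≡⟨ cong₂ (λ s t → s ℚ.* ⟦ S ⟧ ℚ.* t) gA (ℚ.*-inverseˡ h) ⟩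
  ⟦ P ⟧ ℚ.* ⟦ S ⟧ ℚ.* 1ℚ                          ≡⟨ ℚ.*-identityʳ _ ⟩
  ⟦ P ⟧ ℚ.* ⟦ S ⟧                                 ≡⟨ ⟦⟧-* P S ⟨
  ⟦ P * S ⟧                                       ∎
  where
    open ≡-Reasoning
    open ℚ.+-*-Solver using (solve; con; _:+_; _:*_; _:-_; _:=_)

-- Both terms of g / h = P S / A R are compared with the same b.
near-1 : ∀ c ε → 0ℚ ℚ.< ε → ∃ λ Q → ∀ q g h P A R S b .{{_ : NonZero A}} .{{_ : NonZero R}} .{{_ : NonZero S}} →
         Q ≤ q → g ℚ.* ⟦ A ⟧ ≡ ⟦ P ⟧ → h ℚ.* ⟦ S ⟧ ≡ ⟦ R ⟧ →
         Close q c (P * S) b → Close q c (A * R) b → RatioNear1 ε g h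
-- The factor 2 comes from `Close-common`; the successor gives the strict inequality that
-- `ratio-small` asks for.
near-1 c ε 0<ε = suc (2 * c * suc M) , near
  where
    M = proj₁ (Archimedean ε 0<ε)
    near : ∀ q g h P A R S b .{{_ : NonZero A}} .{{_ : NonZero R}} .{{_ : NonZero S}} →
           2 * c * suc M < q → g ℚ.* ⟦ A ⟧ ≡ ⟦ P ⟧ → h ℚ.* ⟦ S ⟧ ≡ ⟦ R ⟧ →
           Close q c (P * S) b → Close q c (A * R) b → RatioNear1 ε g h
    near q g h P A R S b Q≤q gA hS close-P close-A =
      h≢0 , ratio-small ε (2 * c) M q ((g ℚ.÷ h) {{h≢0}}) (P * S) (A * R) {{ℕ.m*n≢0 A R}}
        (proj₂ (Archimedean ε 0<ε)) 0<ε Q≤q (ratio g h P A R S {{h≢0}} gA hS)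
        (Close-common b≤ close-P close-A) (Close-common b≤ close-A close-P)
      where
        h>0 : ℚ.Positive h
        h>0 = ℚ.positive (ℚ.*-cancelʳ-<-nonNeg ⟦ S ⟧ {{ℚ.nonNegative (⟦⟧-mono-≤ {0} {S} z≤n)}} {0ℚ} {h}
                (subst₂ ℚ._<_ (sym (ℚ.*-zeroˡ ⟦ S ⟧)) (sym hS) (ℚ.positive⁻¹ ⟦ R ⟧ {{⟦⟧-positive R}})))
        h≢0 : ℚ.NonZero h
        h≢0 = ℚ.pos⇒nonZero h {{h>0}}
        b≤ : b ≤ 2 * (A * R)
        b≤ = Close⇒≤ {{>-nonZero (ℕ.≤-trans (s≤s z≤n) Q≤q)}}
               (ℕ.≤-trans (ℕ.m≤m*n (2 * c) (suc M)) (ℕ.<⇒≤ Q≤q)) close-A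

-- Here `x` is the deficit b - a, and closeness amounts to x ≤ c b / q.
Close-complement : ∀ {q c a x b} → a + x ≡ b → q * x ≤ c * b → Close q c a b
Close-complement {q} {c} {a} {x} refl qx≤ =
  close (ℕ.m≤m+n a x) (subst (_≤ q * a + c * (a + x)) (sym (ℕ.*-distribˡ-+ q a x)) (ℕ.+-monoʳ-≤ (q * a) qx≤))

+-≤-2* : ∀ {x y b} → x ≤ b → y ≤ b → x + y ≤ 2 * b
+-≤-2* {x} {y} {b} x≤b y≤b = subst (x + y ≤_) (cong (b +_) (sym (ℕ.+-identityʳ b))) (ℕ.+-mono-≤ x≤b y≤b)

-- The letters are s = q - 1, r = Q - 1, w = U - 1, t = T - 1, z = Z - q and N = Z - 1, chosen so
-- that the identities avoid subtraction and the semiring solver applies. In the bracket `b`, the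
-- positive part s Q t comes from the proportional pairs x, y and the subtracted z r from the
-- independent ones.
variance-numerator : ∀ s z r w b {A S₁ S₂ M₁ M₂ β} →
  let q = suc s; Q = suc r; U = suc w; t = r + w * Q; T = U * Q; Z = z + q in
  b + z * r ≡ s * Q * t → 1 + A ≡ T * Q →
  Z + S₁ ≡ M₁ → M₁ + T ≡ Z * T + T * Q →
  Z * Z + S₂ ≡ M₂ → M₂ + β ≡ Z * β + M₁ → β + q * U ≡ Z * U + q * T →
  (z + s) * r * (U * b) + S₁ * S₁ ≡ A * S₂
variance-numerator s z r w b {A} {S₁} {S₂} {β = β} b≡ A≡ refl M₁≡ refl M₂≡ β≡ =
  trans (cong (λ x → N * r * (U * b) + x * x) S₁≡) (trans numerator (cong (A *_) (sym S₂≡)))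
  where
    open ≡-Reasoning
    open +-*-Solver using (solve; con; _:+_; _:*_; _:=_)
    q = suc s
    Q = suc r
    U = suc w
    t = r + w * Q
    T = U * Q
    Z = z + q
    N = z + s

    S₁≡ : S₁ ≡ A + N * t
    S₁≡ = ℕ.+-cancelˡ-≡ (Z + T) _ _ (begin
      Z + T + S₁               ≡⟨ solve 3 (λ Z T S → Z :+ T :+ S := Z :+ S :+ T) refl Z T S₁ ⟩
      Z + S₁ + T               ≡⟨ M₁≡ ⟩
      Z * T + T * Q            ≡⟨ cong (Z * T +_) A≡ ⟨
      Z * T + (1 + A)          ≡⟨ solve 4 (λ z s t A →
                                    (z :+ (con 1 :+ s)) :* (con 1 :+ t) :+ (con 1 :+ A)
                                      := (z :+ (con 1 :+ s)) :+ (con 1 :+ t) :+ (A :+ (z :+ s) :* t)) refl z s t A ⟩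
      Z + T + (A + N * t)      ∎)

    β≡′ : β ≡ z * U + q * T
    β≡′ = ℕ.+-cancelʳ-≡ (q * U) _ _ (trans β≡
      (solve 4 (λ z q U T → (z :+ q) :* U :+ q :* T := z :* U :+ q :* T :+ q :* U) refl z q U T))

    S₂≡ : S₂ ≡ A + N * (z * w + s * t + 2 * t)
    S₂≡ = ℕ.+-cancelˡ-≡ (Z * Z + β) _ _ (begin
      Z * Z + β + S₂                         ≡⟨ solve 3 (λ x β S → x :+ β :+ S := x :+ S :+ β) refl (Z * Z) β S₂ ⟩
      Z * Z + S₂ + β                         ≡⟨ M₂≡ ⟩
      Z * β + (Z + S₁)                       ≡⟨ cong₂ (λ β S → Z * β + (Z + S)) β≡′ S₁≡ ⟩
      Z * (z * U + q * T) + (Z + (A + N * t)) ≡⟨ solve 5 (λ z s t w A → let Z = z :+ (con 1 :+ s); N = z :+ s; b = z :* (con 1 :+ w) :+ (con 1 :+ s) :* (con 1 :+ t) in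
                                                  Z :* b :+ (Z :+ (A :+ N :* t))
                                                    := Z :* Z :+ b :+ (A :+ N :* (z :* w :+ s :* t :+ con 2 :* t))) refl z s t w A ⟩
      Z * Z + (z * U + q * T) + (A + N * (z * w + s * t + 2 * t)) ≡⟨ cong (λ β → Z * Z + β + (A + N * (z * w + s * t + 2 * t))) β≡′ ⟨
      Z * Z + β + (A + N * (z * w + s * t + 2 * t)) ∎)

    numerator : N * r * (U * b) + (A + N * t) * (A + N * t) ≡ A * (A + N * (z * w + s * t + 2 * t))
    -- Adding the subtracted part of the bracket makes `b` disappear by `b≡`, and A becomes the
    -- polynomial T Q - 1; what remains is an identity in `s`, `z`, `r`, `w`.
    numerator = ℕ.+-cancelʳ-≡ (N * r * (U * (z * r))) _ _ (begin
      N * r * (U * b) + (A + N * t) * (A + N * t) + N * r * (U * (z * r))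
        ≡⟨ solve 5 (λ c U b x y → c :* (U :* b) :+ x :+ c :* (U :* y) := c :* (U :* (b :+ y)) :+ x) refl (N * r) U b ((A + N * t) * (A + N * t)) (z * r) ⟩
      N * r * (U * (b + z * r)) + (A + N * t) * (A + N * t)
        ≡⟨ cong₂ (λ x A → N * r * (U * x) + (A + N * t) * (A + N * t)) b≡ (ℕ.suc-injective A≡) ⟩
      N * r * (U * (s * Q * t)) + (A′ + N * t) * (A′ + N * t)
        ≡⟨ solve 4 (λ s z r w → let Q = con 1 :+ r; U = con 1 :+ w; t = r :+ w :* Q; A = r :+ t :* Q; N = z :+ s in
             N :* r :* (U :* (s :* Q :* t)) :+ (A :+ N :* t) :* (A :+ N :* t)
               := A :* (A :+ N :* (z :* w :+ s :* t :+ con 2 :* t)) :+ N :* r :* (U :* (z :* r))) refl s z r w ⟩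
      A′ * (A′ + N * (z * w + s * t + 2 * t)) + N * r * (U * (z * r))
        ≡⟨ cong (λ A → A * (A + N * (z * w + s * t + 2 * t)) + N * r * (U * (z * r))) (ℕ.suc-injective A≡) ⟨
      A * (A + N * (z * w + s * t + 2 * t)) + N * r * (U * (z * r)) ∎)
      where A′ = r + t * Q

-- Mean and variance of a code as explicit fractions

module _ {q m : ℕ} {E : FieldExtension q m} {Γ : OrderedBasis E} {n k d : ℕ} (C : Code Γ n k d) where
  open RankMetric Γ
  open RankSupport Γ
  open CodeFunctionals C
  open CodeMoments C
  open ≡-Reasoning
  private
    Q = q ^ m
    W = Code.nonzeroCodewords C
    A = length W
    S₁ = ∑ W annihilators
    S₂ = ∑ W (λ v → annihilators v * annihilators v)

    S₁-sum : q ^ n + S₁ ≡ ∑ (L.allVectors k) (annihilators ∘ codeword)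
    S₁-sum = trans (cong (_+ S₁) (sym annihilators-0ᵥ)) (∑-nonzeroCodewords annihilators)

    S₂-sum : q ^ n * q ^ n + S₂ ≡ ∑ (L.allVectors k) (λ c → annihilators (codeword c) * annihilators (codeword c))
    S₂-sum = trans (cong (λ t → t * t + S₂) (sym annihilators-0ᵥ))
                   (∑-nonzeroCodewords (λ v → annihilators v * annihilators v))

    ∑-q^[n-rk] : ∑ℚ W (λ v → q ^ᶻ (n ⊖ rk v)) ≡ ⟦ S₁ ⟧
    ∑-q^[n-rk] = ∑ℚ-⟦⟧ W q^[n-rk]≡annihilators

  2≤q : 2 ≤ q
  2≤q = K.2≤q

  mean-rational : ∀ {T} → T * Q ≡ Q ^ k → RankNondegenerate C →
    ∃₂ λ A S → 1 + A ≡ T * Q × S + (q ^ n + T) ≡ q ^ n * T + T * Q × 𝔼-rk C ℚ.* ⟦ A ⟧ ≡ ⟦ S ⟧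
  mean-rational {T} TQ nondegenerate = A , S₁ , trans length-nonzeroCodewords (sym TQ) , (begin
      S₁ + (q ^ n + T)         ≡⟨ ℕ.+-assoc S₁ (q ^ n) T ⟨
      S₁ + q ^ n + T           ≡⟨ cong (_+ T) (trans (ℕ.+-comm S₁ (q ^ n)) S₁-sum) ⟩
      _ + T                    ≡⟨ moment₁ nondegenerate TQ ⟩
      q ^ n * T + Q ^ k        ≡⟨ cong (q ^ n * T +_) TQ ⟨
      q ^ n * T + T * Q        ∎)
    , trans (mean*length W _) ∑-q^[n-rk]

  variance-rational : ∀ {s z r w} → q ≡ suc s → q ^ n ≡ z + q → Q ≡ suc r → suc w * Q * Q ≡ Q ^ k →
    ∀ b → b + z * r ≡ s * suc r * (r + w * suc r) → RankAndRank2Nondegenerate C →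
    ∃ λ A → 1 + A ≡ suc w * Q * Q × Var-rk C ℚ.* ⟦ A * A ⟧ ≡ ⟦ (z + s) * r * (suc w * b) ⟧
  variance-rational {s} {z} {r} {w} q≡ Z≡ Q≡ UQQ b b≡ (nondegenerate , rank2) =
    A , trans length-nonzeroCodewords (sym UQQ) , GroupProperties.∙-cancelʳ ℚ.+-0-group ⟦ S₁ * S₁ ⟧ _ _ (begin
      Var-rk C ℚ.* ⟦ A * A ⟧ ℚ.+ ⟦ S₁ * S₁ ⟧
        ≡⟨ cong₂ (λ x y → Var-rk C ℚ.* x ℚ.+ y) (⟦⟧-* A A) (trans (⟦⟧-* S₁ S₁) (sym (cong₂ ℚ._*_ ∑-q^[n-rk] ∑-q^[n-rk]))) ⟩
      Var-rk C ℚ.* (⟦ A ⟧ ℚ.* ⟦ A ⟧) ℚ.+ ∑ℚ W f ℚ.* ∑ℚ W f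
        ≡⟨ variance*length² W f ⟩
      ⟦ A ⟧ ℚ.* ∑ℚ W (λ v → f v ℚ.* f v)
        ≡⟨ cong (⟦ A ⟧ ℚ.*_) (∑ℚ-⟦⟧ W λ v → trans (cong₂ ℚ._*_ (q^[n-rk]≡annihilators v) (q^[n-rk]≡annihilators v))
                                                     (sym (⟦⟧-* (annihilators v) (annihilators v)))) ⟩
      ⟦ A ⟧ ℚ.* ⟦ S₂ ⟧
        ≡⟨ ⟦⟧-* A S₂ ⟨
      ⟦ A * S₂ ⟧
        ≡⟨ cong ⟦_⟧ numerator ⟨
      ⟦ (z + s) * r * (suc w * b) + S₁ * S₁ ⟧
        ≡⟨ ⟦⟧-+ ((z + s) * r * (suc w * b)) (S₁ * S₁) ⟩
      ⟦ (z + s) * r * (suc w * b) ⟧ ℚ.+ ⟦ S₁ * S₁ ⟧ ∎)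
    where
      f = λ v → q ^ᶻ (n ⊖ rk v)
      T = suc w * Q
      U = suc w
      β = z * U + q * T
      β≡ : β + q * U ≡ q ^ n * U + q * T
      β≡ = trans (solve 4 (λ z q U T → z :* U :+ q :* T :+ q :* U := (z :+ q) :* U :+ q :* T) refl z q U T)
                 (cong (λ Z → Z * U + q * T) (sym Z≡))
        where open +-*-Solver using (solve; con; _:+_; _:*_; _:=_)
      UQQ′ : U * (Q * Q) ≡ Q ^ k
      UQQ′ = trans (sym (ℕ.*-assoc U Q Q)) UQQ
      numerator : (z + s) * r * (suc w * b) + S₁ * S₁ ≡ A * S₂
      numerator = specialise q≡ Q≡ (trans length-nonzeroCodewords (sym UQQ)) Z≡
        (trans (moment₁ nondegenerate UQQ) (cong (q ^ n * T +_) (sym UQQ)))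
        (moment₂ nondegenerate rank2 UQQ UQQ′ β≡) β≡ S₁-sum S₂-sum
        where
          -- Here `q`, `Q` and `Z` become variables, so that the equations q = s + 1, Q = r + 1 and
          -- Z = z + q can be matched with `refl`.
          specialise : ∀ {q Q Z} → q ≡ suc s → Q ≡ suc r → 1 + A ≡ U * Q * Q → Z ≡ z + q →
            ∀ {M₁ M₂ β} → M₁ + U * Q ≡ Z * (U * Q) + U * Q * Q → M₂ + β ≡ Z * β + M₁ → β + q * U ≡ Z * U + q * (U * Q) →
            Z + S₁ ≡ M₁ → Z * Z + S₂ ≡ M₂ → (z + s) * r * (suc w * b) + S₁ * S₁ ≡ A * S₂
          specialise refl refl A≡ refl M₁≡ M₂≡ β≡ S₁≡ S₂≡ = variance-numerator s z r w b b≡ A≡ S₁≡ M₁≡ S₂≡ M₂≡ β≡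

-- With q = suc s, Q = suc r, T = suc t and Z = z + q, the number b is the bracket
-- (q - 1) Q (T - 1) - (Z - q)(Q - 1) in the variance.
bracket-close : ∀ {s z r t b} → z ≤ t → suc s ≤ suc t → b + z * r ≡ s * suc r * t →
                Close (suc s) 3 b (suc s * suc r * suc t)
bracket-close {s} {z} {r} {t} {b} z≤t q≤T b≡ = Close-complement {x = z * r + (q * Q + Q * t)}
  (trans (sym (ℕ.+-assoc b (z * r) _)) (trans (cong (_+ (q * Q + Q * t)) b≡)
    (solve 3 (λ s Q t → s :* Q :* t :+ ((con 1 :+ s) :* Q :+ Q :* t) := (con 1 :+ s) :* Q :* (con 1 :+ t)) refl s Q t)))
  (begin
    -- The deficit q Q T - b is the sum of z r, q Q and Q t; each of them is at most T Q, which
    -- explains the constant 3.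
    q * (z * r + (q * Q + Q * t))          ≤⟨ ℕ.*-monoʳ-≤ q (ℕ.+-mono-≤ (ℕ.*-mono-≤ (ℕ.≤-trans z≤t (ℕ.n≤1+n t)) (ℕ.n≤1+n r))
                                               (ℕ.+-mono-≤ (ℕ.*-monoˡ-≤ Q q≤T) (ℕ.*-monoʳ-≤ Q (ℕ.n≤1+n t)))) ⟩
    q * (T * Q + (T * Q + Q * T))          ≡⟨ solve 3 (λ q Q T → q :* (T :* Q :+ (T :* Q :+ Q :* T)) := con 3 :* (q :* Q :* T)) refl q Q T ⟩
    3 * (q * Q * T)                        ∎)
  where
    open ≤-Reasoning
    open +-*-Solver using (solve; con; _:+_; _:*_; _:=_)
    q = suc s
    Q = suc r
    T = suc t

Var-asymptotic-resp : ∀ {n m k h h′} → (∀ q → h q ≡ h′ q) →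
                      Asymptotic n m k RankAndRank2Nondegenerate Var-rk h →
                      Asymptotic n m k RankAndRank2Nondegenerate Var-rk h′
Var-asymptotic-resp h≡h′ asymptotic ε 0<ε = let (N , near) = asymptotic ε 0<ε in
  N , λ q pp N≤q E Γ d C c → subst (RatioNear1 ε (Var-rk C)) (h≡h′ q) (near q pp N≤q E Γ d C c)

-- Estimates for the mean

module _ {q : ℕ} (2≤q : 2 ≤ q) where
  private instance
    q≢0 : NonZero q
    q≢0 = >-nonZero (ℕ.<⇒≤ 2≤q)

  q≤q^ : ∀ {e} → 1 ≤ e → q ≤ q ^ e
  q≤q^ {e} 1≤e = subst (_≤ q ^ e) (ℕ.^-identityʳ q) (ℕ.^-monoʳ-≤ q 1≤e)

  q^*q≤q^ : ∀ {a b} → a + 1 ≤ b → q * q ^ a ≤ q ^ b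
  q^*q≤q^ {a} {b} a<b = ℕ.^-monoʳ-≤ q (subst (_≤ b) (ℕ.+-comm a 1) a<b)

1+A≡x*y⇒A≢0 : ∀ {A x y} → 1 + A ≡ x * y → 1 ≤ x → 2 ≤ y → NonZero A
1+A≡x*y⇒A≢0 {zero}  {x} {y} eq 1≤x 2≤y = contradiction (ℕ.≤-trans (ℕ.*-mono-≤ 1≤x 2≤y) (ℕ.≤-reflexive (sym eq))) λ { (s≤s ()) }
1+A≡x*y⇒A≢0 {suc A} _ _ _ = _

-- The mean is S / A with `S` close to Y = Z T + T Q and A + 1 = T Q. If Z is much smaller than Q,
-- then T Q dominates `Y`; if it is much larger, Z T does, and the quotient is compared with Z / Q;
-- if Z = Q, both terms agree and `Y` is 2 T Q.
module MeanBounds {q Z Q T A S : ℕ} (q≤Q : q ≤ Q) (1≤T : 1 ≤ T)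
                  (A≡ : 1 + A ≡ T * Q) (S≡ : S + (Z + T) ≡ Z * T + T * Q) where
  open ≤-Reasoning
  open +-*-Solver using (solve; con; _:+_; _:*_; _:=_)

  Y : ℕ
  Y = Z * T + T * Q

  TQ≤Y : T * Q ≤ Y
  TQ≤Y = ℕ.m≤n+m (T * Q) (Z * T)

  Q≤Y : Q ≤ Y
  Q≤Y = ℕ.≤-trans (ℕ.m≤n*m Q T {{>-nonZero 1≤T}}) TQ≤Y

  close-S : q * Z ≤ Y → Close q 2 S Y
  close-S qZ≤Y = Close-complement S≡ (begin
    q * (Z + T)     ≡⟨ ℕ.*-distribˡ-+ q Z T ⟩
    q * Z + q * T   ≤⟨ +-≤-2* qZ≤Y (ℕ.≤-trans (subst (q * T ≤_) (ℕ.*-comm Q T) (ℕ.*-monoˡ-≤ T q≤Q)) TQ≤Y) ⟩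
    2 * Y           ∎)

  close-A : q * Z ≤ Q → Close q 2 A Y
  close-A qZ≤Q = Close-complement {x = 1 + Z * T}
    (trans (solve 3 (λ A Z T → A :+ (con 1 :+ Z :* T) := Z :* T :+ (con 1 :+ A)) refl A Z T)
           (cong (Z * T +_) A≡))
    (begin
      q * (1 + Z * T)    ≡⟨ solve 3 (λ q Z T → q :* (con 1 :+ Z :* T) := q :+ q :* Z :* T) refl q Z T ⟩
      q + q * Z * T      ≤⟨ +-≤-2* (ℕ.≤-trans q≤Q Q≤Y)
                                   (ℕ.≤-trans (subst (q * Z * T ≤_) (ℕ.*-comm Q T) (ℕ.*-monoˡ-≤ T qZ≤Q)) TQ≤Y) ⟩
      2 * Y              ∎)

  close-A*Z : .{{_ : NonZero Q}} → q * Z ≤ Y → q * Q ≤ Z → Close q 2 (A * Z) (Y * Q)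
  close-A*Z qZ≤Y qQ≤Z = Close-complement {x = Z + Q * (T * Q)}
    (trans (solve 4 (λ A Z Q U → A :* Z :+ (Z :+ Q :* U) := (con 1 :+ A) :* Z :+ Q :* U) refl A Z Q (T * Q))
    (trans (cong (λ t → t * Z + Q * (T * Q)) A≡)
           (solve 3 (λ Z T Q → T :* Q :* Z :+ Q :* (T :* Q) := (Z :* T :+ T :* Q) :* Q) refl Z T Q)))
    (begin
      q * (Z + Q * (T * Q))        ≡⟨ solve 4 (λ q Z Q T → q :* (Z :+ Q :* (T :* Q)) := q :* Z :+ q :* Q :* T :* Q) refl q Z Q T ⟩
      q * Z + q * Q * T * Q        ≤⟨ +-≤-2* (ℕ.≤-trans qZ≤Y (ℕ.m≤m*n Y Q))
                                             (ℕ.*-monoˡ-≤ Q (ℕ.≤-trans (ℕ.*-monoˡ-≤ T qQ≤Z) (ℕ.m≤m+n (Z * T) (T * Q)))) ⟩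
      2 * (Y * Q)                  ∎)

  close-A*2 : Z ≡ Q → Close q 2 (A * 2) Y
  close-A*2 refl = Close-complement {x = 2}
    (trans (solve 1 (λ A → A :* con 2 :+ con 2 := (con 1 :+ A) :+ (con 1 :+ A)) refl A)
    (trans (cong₂ _+_ A≡ A≡) (cong (_+ T * Q) (ℕ.*-comm T Q))))
    (subst (_≤ 2 * Y) (ℕ.*-comm 2 q) (ℕ.*-monoʳ-≤ 2 (ℕ.≤-trans q≤Q Q≤Y)))

module _ {n m k′ : ℕ} .{{_ : NonZero m}} {q} (E : FieldExtension q m) (Γ : OrderedBasis E) {d}
         (C : Code Γ n (suc k′) d) (nondegenerate : RankNondegenerate C) where

  private
    Q = q ^ m
    T = Q ^ k′
    instance
      q≢0 : NonZero q
      q≢0 = >-nonZero (ℕ.<⇒≤ (2≤q C))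
    q≤Q : q ≤ Q
    q≤Q = q≤q^ (2≤q C) (ℕ.n≢0⇒n>0 (≢-nonZero⁻¹ m))
    1≤T : 1 ≤ T
    1≤T = ℕ.m^n>0 Q {{ℕ.m^n≢0 q m}} k′
    rational = mean-rational C {T} (ℕ.*-comm T Q) nondegenerate
    A = proj₁ rational
    S = proj₁ (proj₂ rational)
    A≡ : 1 + A ≡ T * Q
    A≡ = proj₁ (proj₂ (proj₂ rational))
    mean≡ : 𝔼-rk C ℚ.* ⟦ A ⟧ ≡ ⟦ S ⟧
    mean≡ = proj₂ (proj₂ (proj₂ (proj₂ rational)))
    instance
      A≢0 : NonZero A
      A≢0 = 1+A≡x*y⇒A≢0 A≡ 1≤T (ℕ.≤-trans (2≤q C) q≤Q)
      Q≢0 : NonZero Q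
      Q≢0 = ℕ.m^n≢0 q m
      Z≢0 : NonZero (q ^ n)
      Z≢0 = ℕ.m^n≢0 q n
    open MeanBounds {Z = q ^ n} {S = S} q≤Q 1≤T A≡ (proj₁ (proj₂ (proj₂ (proj₂ rational))))
    -- The term Z missing from `S` is negligible against Z T once T ≥ q; this is where k ≥ 2 enters.
    q≤T⇒ : q ≤ T → q * q ^ n ≤ Y
    q≤T⇒ q≤T = ℕ.≤-trans (subst (q * q ^ n ≤_) (ℕ.*-comm T (q ^ n)) (ℕ.*-monoˡ-≤ (q ^ n) q≤T)) (ℕ.m≤m+n (q ^ n * T) (T * Q))

  module _ (ε : ℚ) (0<ε : 0ℚ ℚ.< ε) (large : proj₁ (near-1 2 ε 0<ε) ≤ q) where

    -- The error is bounded by q Z ≤ Q ≤ Y instead of through `T`, so k = 1, where T = 1, is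
    -- covered.
    mean-near-1 : n + 1 ≤ m → RatioNear1 ε (𝔼-rk C) 1ℚ
    mean-near-1 n<m = proj₂ (near-1 2 ε 0<ε) q (𝔼-rk C) 1ℚ S A 1 1 Y large mean≡ refl
      (subst (λ x → Close q 2 x Y) (sym (ℕ.*-identityʳ S)) (close-S (ℕ.≤-trans qZ≤Q Q≤Y)))
      (subst (λ x → Close q 2 x Y) (sym (ℕ.*-identityʳ A)) (close-A qZ≤Q))
      where
        qZ≤Q : q * q ^ n ≤ Q
        qZ≤Q = q^*q≤q^ (2≤q C) n<m

    mean-near-power : q ≤ T → m + 1 ≤ n → RatioNear1 ε (𝔼-rk C) (q ^ᶻ (n ⊖ m))
    mean-near-power q≤T m<n = proj₂ (near-1 2 ε 0<ε) q (𝔼-rk C) (q ^ᶻ (n ⊖ m)) S A (q ^ n) Q (Y * Q)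
      large mean≡ (^ᶻ-⊖ q n m)
      (Close-* (close-S (q≤T⇒ q≤T)) Close-refl)
      (close-A*Z (q≤T⇒ q≤T) (q^*q≤q^ (2≤q C) m<n))

    mean-near-2 : q ≤ T → n ≡ m → RatioNear1 ε (𝔼-rk C) (1ℚ ℚ.+ 1ℚ)
    mean-near-2 q≤T n≡m = proj₂ (near-1 2 ε 0<ε) q (𝔼-rk C) (1ℚ ℚ.+ 1ℚ) S A 2 1 Y large mean≡ refl
      (subst (λ x → Close q 2 x Y) (sym (ℕ.*-identityʳ S)) (close-S (q≤T⇒ q≤T)))
      (close-A*2 (cong (q ^_) n≡m))

-- Estimates for the variance

module _ {s z r w b A : ℕ} where
  private
    q = suc s
    Q = suc r
    U = suc w
    t = r + w * Q
    T = U * Q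
    Z = z + q
    N = z + s
    P = N * r * (U * b)

  -- Cross-multiplying the variance P / A² with its target q Z / Q gives P Q and A² q Z, both
  -- compared with q Z Q² T². In P Q the factors Z - 1 and Q - 1 lose 1 each and the bracket loses
  -- 3, whence the constant 5; A² loses 2.
  variance-close : z ≤ t → s ≤ r → b + z * r ≡ s * Q * t → 1 + A ≡ T * Q →
    Close q 5 (P * Q) (Z * Q * (T * (q * Q * T))) × Close q 5 (A * A * (q * Z)) (Z * Q * (T * (q * Q * T)))
  variance-close z≤t s≤r b≡ A≡ =
      subst (λ x → Close q 5 x (Z * Q * (T * (q * Q * T))))
        (solve 5 (λ N r U b Q → N :* r :* (U :* Q :* b) := N :* r :* (U :* b) :* Q) refl N r U b Q)
        (Close-* (Close-* N-close (Close-pred (s≤s s≤r)))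
                 (Close-* (Close-refl {a = T}) (bracket-close {s} {z} {r} {t} {b} z≤t q≤T b≡)))
    , subst (Close q 5 (A * A * (q * Z)))
        (solve 4 (λ q Z Q T → T :* Q :* (T :* Q) :* (q :* Z) := Z :* Q :* (T :* (q :* Q :* T))) refl q Z Q T)
        (Close-weaken (s≤s (s≤s z≤n)) (Close-* (Close-* A-close A-close) (Close-refl {a = q * Z})))
    where
      open +-*-Solver using (solve; con; _:+_; _:*_; _:=_)
      q≤T : q ≤ T
      q≤T = s≤s (ℕ.≤-trans s≤r (ℕ.m≤m+n r (w * Q)))
      N-close : Close q 1 N Z
      N-close = subst (Close q 1 N) (sym (ℕ.+-suc z s)) (Close-pred (s≤s (ℕ.m≤n+m s z)))
      A-close : Close q 1 A (T * Q)
      A-close = subst (Close q 1 A) A≡ (Close-pred (subst (q ≤_) (sym A≡) (ℕ.≤-trans q≤T (ℕ.m≤m*n T Q))))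

module _ {n m k″ : ℕ} .{{_ : NonZero n}} .{{_ : NonZero m}} {q} (E : FieldExtension q m) (Γ : OrderedBasis E) {d}
         (C : Code Γ n (suc (suc k″)) d) (nondegenerate : RankAndRank2Nondegenerate C)
         (n≤ : n ≤ m * suc k″) (ε : ℚ) (0<ε : 0ℚ ℚ.< ε) (large : proj₁ (near-1 5 ε 0<ε) ≤ q) where
  private
    instance
      q≢0 : NonZero q
      q≢0 = >-nonZero (ℕ.<⇒≤ (2≤q C))
      Q≢0 : NonZero (q ^ m)
      Q≢0 = ℕ.m^n≢0 q m
      U≢0 : NonZero ((q ^ m) ^ k″)
      U≢0 = ℕ.m^n≢0 (q ^ m) k″

    near : ∀ {s z r w} → q ≡ suc s → q ^ n ≡ z + q → q ^ m ≡ suc r → (q ^ m) ^ k″ ≡ suc w →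
           RatioNear1 ε (Var-rk C) (q ^ᶻ ((n + 1) ⊖ m))
    near {s} {z} {r} {w} q≡ Z≡ Q≡ U≡ = go (variance-rational C {s} {z} {r} {w} q≡ Z≡ Q≡ UQQ b b≡ nondegenerate)
      where
        Q = q ^ m
        t = r + w * suc r
        -- An exact difference by `b≡`: Z ≤ T gives z ≤ t, and q ≥ 2 gives r ≤ s (r + 1).
        b = s * suc r * t ∸ z * r
        UQQ : suc w * Q * Q ≡ Q ^ suc (suc k″)
        UQQ = trans (cong (λ u → u * Q * Q) (sym U≡))
                (trans (ℕ.*-comm _ Q) (cong (Q *_) (ℕ.*-comm _ Q)))
        s≤r : s ≤ r
        s≤r = s≤s⁻¹ (subst₂ _≤_ q≡ Q≡ (q≤q^ (2≤q C) (ℕ.n≢0⇒n>0 (≢-nonZero⁻¹ m))))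
        z≤t : z ≤ t
        -- The assumption n ≤ m (k - 1) amounts to Z ≤ T; cancelling a successor leaves z + s ≤ t.
        z≤t = ℕ.m+n≤o⇒m≤o z (s≤s⁻¹ (subst₂ _≤_ (trans Z≡ (trans (cong (z +_) q≡) (ℕ.+-suc z s)))
          (trans (sym (ℕ.^-*-assoc q m (suc k″))) (trans (ℕ.*-comm Q _) (cong₂ _*_ U≡ Q≡)))
          (ℕ.^-monoʳ-≤ q n≤)))
        1≤s : 1 ≤ s
        1≤s = s≤s⁻¹ (subst (2 ≤_) q≡ (2≤q C))
        b≡ : b + z * r ≡ s * suc r * t
        b≡ = ℕ.m∸n+n≡m (subst (z * r ≤_) (ℕ.*-comm t (s * suc r))
          (ℕ.*-mono-≤ z≤t (ℕ.≤-trans (ℕ.n≤1+n r) (ℕ.m≤n*m (suc r) s {{>-nonZero 1≤s}}))))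
        go : (∃ λ A → 1 + A ≡ suc w * Q * Q × Var-rk C ℚ.* ⟦ A * A ⟧ ≡ ⟦ (z + s) * r * (suc w * b) ⟧) →
             RatioNear1 ε (Var-rk C) (q ^ᶻ ((n + 1) ⊖ m))
        go (A , A≡ , var≡) = proj₂ (near-1 5 ε 0<ε) q (Var-rk C) (q ^ᶻ ((n + 1) ⊖ m)) P (A * A) (q * q ^ n) Q Y
          {{ℕ.m*n≢0 A A}} {{ℕ.m*n≢0 q (q ^ n) {{q≢0}} {{ℕ.m^n≢0 q n}}}} large var≡
          (trans (^ᶻ-⊖ q (n + 1) m) (cong (λ e → ⟦ q ^ e ⟧) (ℕ.+-comm n 1)))
          (subst₂ (λ q Q → Close q 5 (P * Q) Y) (sym q≡) (sym Q≡) (proj₁ closes))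
          (subst₂ (λ q x → Close q 5 (A * A * x) Y) (sym q≡)
            (sym (cong₂ _*_ q≡ (trans Z≡ (cong (z +_) q≡)))) (proj₂ closes))
          where
            instance
              A≢0 : NonZero A
              A≢0 = 1+A≡x*y⇒A≢0 A≡ (>-nonZero⁻¹ (suc w * Q) {{ℕ.m*n≢0 (suc w) Q}}) (ℕ.≤-trans (2≤q C) (q≤q^ (2≤q C) (ℕ.n≢0⇒n>0 (≢-nonZero⁻¹ m))))
            P = (z + s) * r * (suc w * b)
            Y = (z + suc s) * suc r * (suc w * suc r * (suc s * suc r * (suc w * suc r)))
            closes = variance-close {s} {z} {r} {w} {b} {A} z≤t s≤r b≡ (trans A≡ (cong₂ (λ x y → suc w * x * y) Q≡ Q≡))

  variance-near : RatioNear1 ε (Var-rk C) (q ^ᶻ ((n + 1) ⊖ m))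
  -- These truncated subtractions are exact; for `z` this is q ≤ q^n, hence n ≥ 1.
  variance-near = near {s = q ∸ 1} {z = q ^ n ∸ q} {r = q ^ m ∸ 1} {w = (q ^ m) ^ k″ ∸ 1}
    (positive q) (sym (ℕ.m∸n+n≡m (q≤q^ (2≤q C) (ℕ.n≢0⇒n>0 (≢-nonZero⁻¹ n))))) (positive (q ^ m)) (positive ((q ^ m) ^ k″))
    where
      positive : ∀ a .{{_ : NonZero a}} → a ≡ suc (a ∸ 1)
      positive (suc a) = refl

-- Uniform asymptotic statements and their assembly

mean-asymptotic-small : ∀ n m k .{{_ : NonZero m}} .{{_ : NonZero k}} → n + 1 ≤ m →
                        Asymptotic n m k RankNondegenerate 𝔼-rk (λ q → 1ℚ)
mean-asymptotic-small n m (suc k′) n<m ε 0<ε =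
  proj₁ (near-1 2 ε 0<ε) , λ q _ large E Γ d C c → mean-near-1 E Γ C c ε 0<ε large n<m

q≤T : ∀ {q m} k .{{_ : NonZero m}} → 2 ≤ q → q ≤ (q ^ m) ^ suc k
q≤T {q} {m} k 2≤q = subst (q ≤_) (sym (ℕ.^-*-assoc q m (suc k)))
  (q≤q^ 2≤q (ℕ.n≢0⇒n>0 (≢-nonZero⁻¹ (m * suc k) {{ℕ.m*n≢0 m (suc k)}})))

-- The hypotheses m < n ≤ k m force k ≥ 2, which provides q ≤ T.
mean-asymptotic-large : ∀ n m k .{{_ : NonZero m}} → m + 1 ≤ n → n ≤ k * m →
                        Asymptotic n m k RankNondegenerate 𝔼-rk (λ q → q ^ᶻ (n ⊖ m))
mean-asymptotic-large n m zero m<n n≤ =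
  contradiction (ℕ.≤-trans m<n n≤) λ m+1≤0 → contradiction (subst (_≤ 0) (ℕ.+-comm m 1) m+1≤0) λ ()
mean-asymptotic-large n m (suc zero) m<n n≤ =
  contradiction (ℕ.≤-trans (subst (_≤ n) (ℕ.+-comm m 1) m<n) (subst (n ≤_) (ℕ.+-identityʳ m) n≤)) (ℕ.<-irrefl refl)
mean-asymptotic-large n m (suc (suc k″)) m<n n≤ ε 0<ε =
  proj₁ (near-1 2 ε 0<ε) , λ q _ large E Γ d C c → mean-near-power E Γ C c ε 0<ε large (q≤T k″ (2≤q C)) m<n

mean-asymptotic-equal : ∀ n m k .{{_ : NonZero m}} → 2 ≤ k → n ≡ m →
                        Asymptotic n m k RankNondegenerate 𝔼-rk (λ q → 1ℚ ℚ.+ 1ℚ)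
mean-asymptotic-equal n m (suc (suc k″)) (s≤s (s≤s z≤n)) n≡m ε 0<ε =
  proj₁ (near-1 2 ε 0<ε) , λ q _ large E Γ d C c → mean-near-2 E Γ C c ε 0<ε large (q≤T k″ (2≤q C)) n≡m

-- One statement for all ranges of `n`: the cases of the theorem differ only in the value of n + 1 -
-- m and in the reason for n ≤ m (k - 1).
variance-asymptotic : ∀ n m k″ .{{_ : NonZero n}} .{{_ : NonZero m}} → n ≤ m * suc k″ →
  Asymptotic n m (suc (suc k″)) RankAndRank2Nondegenerate Var-rk (λ q → q ^ᶻ ((n + 1) ⊖ m))
variance-asymptotic n m k″ n≤ ε 0<ε =
  proj₁ (near-1 5 ε 0<ε) , λ q _ large E Γ d C c → variance-near E Γ C c n≤ ε 0<ε large

open import Data.Integer using (+_)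

proposition4p15 :
  ∀ (n m k : ℕ) .{{_ : NonZero n}} .{{_ : NonZero m}} .{{_ : NonZero k}} →
    (∀ q → PrimePower q → ∀ (E : FieldExtension q m) (Γ : OrderedBasis E) d (C : Code Γ n k d) →
       RankNondegenerate C → n ≤ k * m)
  × (n + 1 ≤ m → Asymptotic n m k RankNondegenerate 𝔼-rk (λ q → 1ℚ))
  × (m + 1 ≤ n → n ≤ k * m → Asymptotic n m k RankNondegenerate 𝔼-rk (λ q → q ^ᶻ (n ⊖ m)))
  -- k = 1 is excluded here: every nonzero codeword then has rank n, so the mean is exactly 1.
  × (2 ≤ k → n ≡ m → Asymptotic n m k RankNondegenerate 𝔼-rk (λ q → 1ℚ ℚ.+ 1ℚ))
  -- m = 1 is excluded here: the full space with n = k ≥ 2 has zero dual, of distance n + 1 ≥ 3.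
  × (2 ≤ m → ∀ q → PrimePower q → ∀ (E : FieldExtension q m) (Γ : OrderedBasis E) d (C : Code Γ n k d) →
       RankAndRank2Nondegenerate C → 2 * n ≤ m * k)
  × (3 ≤ k → k ≤ n → n + 2 ≤ m → Asymptotic n m k RankAndRank2Nondegenerate Var-rk (λ q → q ^ᶻ ((n + 1) ⊖ m)))
  × (3 ≤ k → m + 2 ≤ n → 2 * n ≤ m * k → Asymptotic n m k RankAndRank2Nondegenerate Var-rk (λ q → q ^ᶻ ((n + 1) ⊖ m)))
  × (3 ≤ k → n + 1 ≡ m → Asymptotic n m k RankAndRank2Nondegenerate Var-rk (λ q → 1ℚ))
  × (3 ≤ k → n ≡ m → Asymptotic n m k RankAndRank2Nondegenerate Var-rk (λ q → q ^ᶻ (+ 1)))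
  × (3 ≤ k → n ≡ m + 1 → Asymptotic n m k RankAndRank2Nondegenerate Var-rk (λ q → q ^ᶻ (+ 2)))
proposition4p15 n m k =
    (λ q _ E Γ d C → CodeFunctionals.length-bound C)
  , mean-asymptotic-small n m k
  , mean-asymptotic-large n m k
  , mean-asymptotic-equal n m k
  , (λ 2≤m q _ E Γ d C nondegenerate → length-bound₂ C 2≤m (proj₂ nondegenerate))
  , (λ 3≤k _ n+2≤m → variance∼ 3≤k (n≤m⇒ 3≤k (ℕ.≤-trans (ℕ.m≤m+n n 2) n+2≤m)))
  , (λ 3≤k _ 2n≤mk → variance∼ 3≤k (2n≤mk⇒ {m = m} 3≤k 2n≤mk))
  -- For n = m - 1, m, m + 1 the exponent n + 1 - m is the constant 0, 1, 2.
  , (λ { 3≤k refl → Var-asymptotic-resp (λ q → cong (q ^ᶻ_) (ℤ.n⊖n≡0 (n + 1)))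
                      (variance∼ 3≤k (n≤m⇒ 3≤k (ℕ.m≤m+n n 1))) })
  , (λ { 3≤k refl → Var-asymptotic-resp (λ q → cong (q ^ᶻ_) (excess n 1))
                      (variance∼ 3≤k (n≤m⇒ 3≤k ℕ.≤-refl)) })
  , (λ { 3≤k refl → Var-asymptotic-resp (λ q → cong (q ^ᶻ_) (trans (cong (_⊖ m) (ℕ.+-assoc m 1 1)) (excess m 2)))
                      (variance∼ 3≤k (m+1≤ 3≤k)) })
  where
    variance∼ : ∀ {k} → 3 ≤ k → n ≤ m * pred k →
               Asymptotic n m k RankAndRank2Nondegenerate Var-rk (λ q → q ^ᶻ ((n + 1) ⊖ m))
    variance∼ {suc (suc k″)} _ = variance-asymptotic n m k″
    variance∼ {suc zero} (s≤s ())

    excess : ∀ a b → (a + b) ⊖ a ≡ + b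
    excess a b = trans (ℤ.⊖-≥ (ℕ.m≤m+n a b)) (cong +_ (ℕ.m+n∸m≡n a b))

    n≤m⇒ : ∀ {k n m} → 3 ≤ k → n ≤ m → n ≤ m * pred k
    n≤m⇒ {suc (suc k″)} {n} {m} _ n≤m = ℕ.≤-trans n≤m (ℕ.m≤m*n m (suc k″))
    n≤m⇒ {suc zero} (s≤s ())

    -- For k ≥ 3 one has m + 1 ≤ 2 m ≤ m (k - 1).
    m+1≤ : ∀ {k m} .{{_ : NonZero m}} → 3 ≤ k → m + 1 ≤ m * pred k
    m+1≤ {suc (suc (suc k))} {m} _ = ℕ.≤-trans (ℕ.+-monoʳ-≤ m (ℕ.n≢0⇒n>0 (≢-nonZero⁻¹ m)))
      (ℕ.≤-trans (ℕ.≤-reflexive (solve 1 (λ m → m :+ m := m :* con 2) refl m)) (ℕ.*-monoʳ-≤ m (s≤s (s≤s z≤n))))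
      where open +-*-Solver using (solve; con; _:+_; _:*_; _:=_)
    m+1≤ {suc (suc zero)} (s≤s (s≤s ()))
    m+1≤ {suc zero} (s≤s ())

    -- Since k / 2 ≤ k - 1 for k ≥ 2, the bound n ≤ m k / 2 implies Z ≤ T.
    2n≤mk⇒ : ∀ {k n m} → 3 ≤ k → 2 * n ≤ m * k → n ≤ m * pred k
    2n≤mk⇒ {suc (suc k″)} {n} {m} _ 2n≤ = ℕ.*-cancelˡ-≤ 2 (begin
      2 * n                         ≤⟨ 2n≤ ⟩
      m * (2 + k″)                  ≤⟨ ℕ.*-monoʳ-≤ m (ℕ.+-monoʳ-≤ 2 (ℕ.m≤n*m k″ 2)) ⟩
      m * (2 + 2 * k″)              ≡⟨ solve 2 (λ m k → m :* (con 2 :+ con 2 :* k) := con 2 :* (m :* (con 1 :+ k))) refl m k″ ⟩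
      2 * (m * suc k″)              ∎)
      where
        open ≤-Reasoning
        open +-*-Solver using (solve; con; _:+_; _:*_; _:=_)
    2n≤mk⇒ {suc zero} (s≤s ())
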